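{- Let $k,m,i$ be positive integers with $m\geq 4$ and $1\leq i\leq m-1$, and let $(X,Y)$ be the bipartition of the tree $P_m^+(i)$. Every $k$-connected triangle-free graph $G$ with $\delta(G)\geq k+\max\{|X|,|Y|\}+[P_m^+(i)\text{ is bad}]$ contains a subgraph $T\cong P_m^+(i)$ such that $\kappa(G-V(T))\geq k$. Moreover, if $\kappa(G)=k$, then for every end $F$ of $G$ such a subgraph $T$ can be chosen so that $T\subseteq F$.
   Context: All graphs are finite, undirected and simple. $\delta(G)$ is the minimum degree of $G$. For $U\subseteq V(G)$, $G-U$ is the subgraph induced by $V(G)\setminus U$, and $N_G(U)=\bigcup_{x\in U}N_G(x)\setminus U$; for a subgraph $H$, $N_G(H)=N_G(V(H))$. The connectivity $\kappa(G)$ is the minimum cardinality of a set $S\subseteq V(G)$ such that $G-S$ is disconnected or trivial (a single vertex); $G$ is $k$-connected if $\kappa(G)\geq k$. For integers $m$ and $i$ with $1\leq i\leq m-1$, $P_m^+(i)$ denotes the tree of order $m$ obtained from a path $v_1v_2\cdots v_{m-1}$ (on $m-1$ vertices) by adding a new vertex $u$ adjacent to $v_i$ only. $P_m^+(i)$ is called good if, after deleting $u$ together with its neighbor $v_i$, the remaining graph has a connected component that is a path of odd order at least three; equivalently, if at least one of $i-1$ and $m-1-i$ is odd and at least three. Otherwise $P_m^+(i)$ is called bad. Iverson's convention is used: $[A]=1$ if $A$ is true and $[A]=0$ otherwise. A vertex cut set of $G$ is a set $S\subseteq V(G)$ such that $G-S$ is disconnected or trivial. Given a vertex cut set $S$,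 a semifragment of $G$ with respect to $S$ is a non-empty union $F$ of components of $G-S$ such that $G-(S\cup V(F))$ is non-empty. If $S$ is a minimum vertex cut set of $G$ (i.e. $|S|=\kappa(G)$), a semifragment $F$ with respect to $S$ is called a fragment of $G$ to $S$ if $N_G(F)=S$. An end of $G$ is a fragment of $G$ that contains no other fragment of $G$. -}

module Defs where

open import Data.Fin using (Fin; toℕ; fromℕ<)
open import Data.Fin.Permutation using (↔⇒≡)
open import Data.Fin.Properties using (toℕ-fromℕ<; toℕ-injective; toℕ<n)
open import Data.Fin.Subset
  using (Subset; _∈_; _∉_; _⊆_; ⊤; _∪_; _∩_; _─_; ⋃; ∣_∣; Nonempty; Empty;
         inside; outside)
open import Data.Fin.Subset.Properties using (_∈?_; ∈⊤; ⊆-antisym; x∈p∧x∉q⇒x∈p─q)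
open import Data.List.Base using (List; map; filter; allFin)
open import Data.List.Relation.Unary.All using (All)
open import Data.List.Relation.Unary.Any using (Any)
open import Data.Nat
open import Data.Nat.Properties
open import Data.Product using (∃; ∃-syntax; _×_; _,_; proj₁; proj₂)
open import Data.Sum using (_⊎_; inj₁; inj₂; swap; [_,_]′) renaming (map to ⊎-map)
open import Data.Vec.Base using (_∷_; there; tabulate)
open import Data.Vec.Properties using (lookup∘tabulate; []=⇒lookup; lookup⇒[]=)
open import Data.Vec.Properties.WithK using ([]=-irrelevant)
open import Function.Base using (_∘_; id)
open import Function.Bundles using (_↔_; _⇔_; mk↔ₛ′; mk⇔; module Inverse; module Equivalence)
open import Function.Construct.Composition using (_↔-∘_)
open import Function.Construct.Symmetry using (↔-sym)
open import Relation.Binary.Construct.Closure.ReflexiveTransitive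
  using (Star; ε; _◅_; reverse)
open import Relation.Binary.PropositionalEquality
  using (_≡_; _≢_; refl; sym; trans; cong; subst; ≢-sym)
open import Relation.Nullary
  using (¬_; Dec; yes; no; does; ¬?; contradiction; _×-dec_; _⊎-dec_)
open import Relation.Nullary.Decidable using (dec-true; map′)
open import Relation.Unary using (Pred; Decidable)
open import Level using (0ℓ)

private variable
  n n′ : ℕ

------------------------------------------------------------------------
-- Subsets by comprehension

⟦_⟧ : {P : Pred (Fin n) 0ℓ} → Decidable P → Subset n
⟦ P? ⟧ = tabulate (does ∘ P?)

∈⟦⟧⁺ : {P : Pred (Fin n) 0ℓ} (P? : Decidable P) {x : Fin n} → P x → x ∈ ⟦ P? ⟧
∈⟦⟧⁺ P? {x} p =
  lookup⇒[]= x _ (trans (lookup∘tabulate (does ∘ P?) x) (dec-true (P? x) p))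

∈⟦⟧⁻ : {P : Pred (Fin n) 0ℓ} (P? : Decidable P) {x : Fin n} → x ∈ ⟦ P? ⟧ → P x
∈⟦⟧⁻ P? {x} x∈ with P? x | trans (sym (lookup∘tabulate (does ∘ P?) x)) ([]=⇒lookup x∈)
... | yes p | _ = p

------------------------------------------------------------------------
-- Finite simple graphs

-- The vertex set is a subset of an ambient Fin n, so that G, its subgraphs and
-- the graphs G ∖ U all have the same type.  N x is the neighbourhood of x.
record Graph (n : ℕ) : Set where
  field
    V        : Subset n
    N        : Fin n → Subset n
    N⊆V      : ∀ x → N x ⊆ V
    N-sym    : ∀ x y → y ∈ N x → x ∈ N y
    N-irrefl : ∀ x → x ∉ N x

open Graph public

Adj : Graph n → Fin n → Fin n → Set
Adj G x y = y ∈ N G x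

Vertex : Graph n → Set
Vertex G = ∃[ x ] x ∈ V G

infix 4 _≤ᴳ_ _≅_

_≤ᴳ_ : Graph n → Graph n → Set
H ≤ᴳ G = V H ⊆ V G × (∀ x → N H x ⊆ N G x)

record _≅_ (G : Graph n) (H : Graph n′) : Set where
  field
    bijection : Vertex G ↔ Vertex H
  open Inverse bijection public using (to; from)
  field
    adjacency : ∀ x y → Adj G (proj₁ x) (proj₁ y) ⇔ Adj H (proj₁ (to x)) (proj₁ (to y))

infixl 6 _∖_

_∖_ : Graph n → Subset n → Graph n
_∖_ {n} G U = record
  { V        = V G ─ U
  ; N        = λ x → ⟦ Q? x ⟧
  ; N⊆V      = λ x p → let (a , _ , c) = ∈⟦⟧⁻ (Q? x) p in
                 x∈p∧x∉q⇒x∈p─q (N⊆V G x a) c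
  ; N-sym    = λ x y p → let (a , b , c) = ∈⟦⟧⁻ (Q? x) p in
                 ∈⟦⟧⁺ (Q? y) (N-sym G x y a , c , b)
  ; N-irrefl = λ x p → N-irrefl G x (proj₁ (∈⟦⟧⁻ (Q? x) p))
  }
  where
  Q? : ∀ x → Decidable (λ y → Adj G x y × x ∉ U × y ∉ U)
  Q? x y = (y ∈? N G x) ×-dec (¬? (x ∈? U) ×-dec ¬? (y ∈? U))

∖-Adj⁺ : ∀ (G : Graph n) U x y → Adj G x y → x ∉ U → y ∉ U → Adj (G ∖ U) x y
∖-Adj⁺ G U x y e x∉U y∉U =
  ∈⟦⟧⁺ (λ y → (y ∈? N G x) ×-dec (¬? (x ∈? U) ×-dec ¬? (y ∈? U))) (e , x∉U , y∉U)

∖-Adj⁻ : ∀ (G : Graph n) U x y → Adj (G ∖ U) x y → Adj G x y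
∖-Adj⁻ G U x y e =
  proj₁ (∈⟦⟧⁻ (λ y → (y ∈? N G x) ×-dec (¬? (x ∈? U) ×-dec ¬? (y ∈? U))) e)

neighbourhood : Graph n → Subset n → Subset n
neighbourhood {n} G U = ⋃ (map (N G) (filter (_∈? U) (allFin n))) ─ U

TriangleFree : Graph n → Set
TriangleFree G = ∀ {x y z} → ¬ (Adj G x y × Adj G y z × Adj G z x)

record IsBipartition (G : Graph n) (X Y : Subset n) : Set where
  field
    covers        : X ∪ Y ≡ V G
    disjoint      : Empty (X ∩ Y)
    X-independent : ∀ {x y} → x ∈ X → y ∈ X → ¬ Adj G x y
    Y-independent : ∀ {x y} → x ∈ Y → y ∈ Y → ¬ Adj G x y

-- Minima are given as relations: no number is the minimum of an empty family,
-- so the graph without vertices has neither a minimum degree nor a connectivity.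
IsMinimum : Pred ℕ 0ℓ → ℕ → Set
IsMinimum P c = P c × (∀ d → P d → c ≤ d)

IsMinDegree : Graph n → ℕ → Set
IsMinDegree G = IsMinimum λ d → ∃[ x ] x ∈ V G × ∣ N G x ∣ ≡ d

------------------------------------------------------------------------
-- Connectivity

Connected : Graph n → Set
Connected G = ∀ {x y} → x ∈ V G → y ∈ V G → Star (Adj G) x y

Trivial : Graph n → Set
Trivial G = ∣ V G ∣ ≡ 1

IsVertexCut : Graph n → Subset n → Set
IsVertexCut G S = S ⊆ V G × (¬ Connected (G ∖ S) ⊎ Trivial (G ∖ S))

IsConnectivity : Graph n → ℕ → Set
IsConnectivity G = IsMinimum λ c → ∃[ S ] IsVertexCut G S × ∣ S ∣ ≡ c

_-Connected_ : ℕ → Graph n → Set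
k -Connected G = ∃[ κ ] IsConnectivity G κ × κ ≥ k

IsMinimumVertexCut : Graph n → Subset n → Set
IsMinimumVertexCut G S = IsVertexCut G S × IsConnectivity G ∣ S ∣

------------------------------------------------------------------------
-- Components, fragments and ends

record IsComponent (G C : Graph n) : Set where
  field
    subgraph  : C ≤ᴳ G
    nonempty  : Nonempty (V C)
    connected : Connected C
    maximal   : ∀ D → D ≤ᴳ G → Connected D → C ≤ᴳ D → D ≤ᴳ C

record IsUnionOfComponents (G F : Graph n) : Set where
  field
    components    : List (Graph n)
    areComponents : All (IsComponent G) components
    vertices      : ∀ x → x ∈ V F ⇔ Any (λ C → x ∈ V C) components
    edges         : ∀ x y → Adj F x y ⇔ Any (λ C → Adj C x y) components

record IsSemifragment (G : Graph n) (S : Subset n) (F : Graph n) : Set where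
  field
    cut      : IsVertexCut G S
    union    : IsUnionOfComponents (G ∖ S) F
    nonempty : Nonempty (V F)
    rest     : Nonempty (V (G ∖ (S ∪ V F)))

record IsFragmentTo (G : Graph n) (S : Subset n) (F : Graph n) : Set where
  field
    minimumCut      : IsMinimumVertexCut G S
    semifragment    : IsSemifragment G S F
    neighbourhood≡S : neighbourhood G (V F) ≡ S

IsFragment : Graph n → Graph n → Set
IsFragment G F = ∃[ S ] IsFragmentTo G S F

-- "No other fragment": a fragment inside F has the same vertices and edges as F.
-- The two fragments may belong to different minimum vertex cuts.
IsEnd : Graph n → Graph n → Set
IsEnd G F = IsFragment G F × (∀ F′ → IsFragment G F′ → F′ ≤ᴳ F → F ≤ᴳ F′)

------------------------------------------------------------------------
-- Paths and the trees P⁺ m i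

-- The graph on Fin n whose edges are the pairs related by R in either order.
graphOn : ∀ n {R : ℕ → ℕ → Set} → (∀ a b → Dec (R a b)) → (∀ {a} → ¬ R a a) → Graph n
graphOn n {R} R? irrefl = record
  { V        = ⊤
  ; N        = λ x → ⟦ S? x ⟧
  ; N⊆V      = λ _ _ → ∈⊤
  ; N-sym    = λ x y p → ∈⟦⟧⁺ (S? y) (swap (∈⟦⟧⁻ (S? x) p))
  ; N-irrefl = λ x p → [ irrefl , irrefl ]′ (∈⟦⟧⁻ (S? x) p)
  }
  where
  S? : ∀ x → Decidable (λ (y : Fin n) → R (toℕ x) (toℕ y) ⊎ R (toℕ y) (toℕ x))
  S? x y = R? _ _ ⊎-dec R? _ _

graphOn⁺ : ∀ {R : ℕ → ℕ → Set} (R? : ∀ a b → Dec (R a b)) (irr : ∀ {a} → ¬ R a a) (x y : Fin n) →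
           R (toℕ x) (toℕ y) ⊎ R (toℕ y) (toℕ x) → Adj (graphOn n R? irr) x y
graphOn⁺ R? _ x y = ∈⟦⟧⁺ (λ y → R? (toℕ x) (toℕ y) ⊎-dec R? (toℕ y) (toℕ x))

graphOn⁻ : ∀ {R : ℕ → ℕ → Set} (R? : ∀ a b → Dec (R a b)) (irr : ∀ {a} → ¬ R a a) (x y : Fin n) →
           Adj (graphOn n R? irr) x y → R (toℕ x) (toℕ y) ⊎ R (toℕ y) (toℕ x)
graphOn⁻ R? _ x y = ∈⟦⟧⁻ (λ y → R? (toℕ x) (toℕ y) ⊎-dec R? (toℕ y) (toℕ x))

PathEdge : ℕ → ℕ → Set
PathEdge a b = b ≡ suc a

pathEdge? : ∀ a b → Dec (PathEdge a b)
pathEdge? a b = b ≟ suc a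

pathEdge-irrefl : ∀ {a} → ¬ PathEdge a a
pathEdge-irrefl ()

Path : ∀ n → Graph n
Path n = graphOn n pathEdge? pathEdge-irrefl

-- Vertex 0 is u, and vertex j with 1 ≤ j ≤ m - 1 is v_j.
TreeEdge : ℕ → ℕ → ℕ → Set
TreeEdge i a b = (1 ≤ a × PathEdge a b) ⊎ (a ≡ 0 × b ≡ i)

treeEdge? : ∀ i a b → Dec (TreeEdge i a b)
treeEdge? i a b = ((1 ≤? a) ×-dec pathEdge? a b) ⊎-dec ((a ≟ 0) ×-dec (b ≟ i))

treeEdge-irrefl : ∀ i .{{_ : NonZero i}} {a} → ¬ TreeEdge i a a
treeEdge-irrefl (suc _) (inj₁ (_ , ()))
treeEdge-irrefl (suc _) (inj₂ (refl , ()))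

P⁺ : ∀ m i .{{_ : NonZero i}} → Graph m
P⁺ m i = graphOn m (treeEdge? i) (treeEdge-irrefl i)

u-or-vᵢ? : ∀ {m} i → Decidable (λ (x : Fin m) → toℕ x ≡ 0 ⊎ toℕ x ≡ i)
u-or-vᵢ? i x = (toℕ x ≟ 0) ⊎-dec (toℕ x ≟ i)

P⁺∖u∖vᵢ : ∀ m i .{{_ : NonZero i}} → Graph m
P⁺∖u∖vᵢ m i = P⁺ m i ∖ ⟦ u-or-vᵢ? i ⟧

OddAtLeast3 : ℕ → Set
OddAtLeast3 ℓ = ℓ % 2 ≡ 1 × 3 ≤ ℓ

Good : ∀ m i .{{_ : NonZero i}} → Set
Good m i = ∃[ C ] IsComponent (P⁺∖u∖vᵢ m i) C × ∃[ ℓ ] OddAtLeast3 ℓ × C ≅ Path ℓ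

Bad : ∀ m i .{{_ : NonZero i}} → Set
Bad m i = ¬ Good m i

[_] : ∀ {A : Set} → Dec A → ℕ
[ yes _ ] = 1
[ no  _ ] = 0

oddAtLeast3? : ∀ ℓ → Dec (OddAtLeast3 ℓ)
oddAtLeast3? ℓ = (ℓ % 2 ≟ 1) ×-dec (3 ≤? ℓ)

------------------------------------------------------------------------
-- Goodness is decidable: the components of P⁺ m i minus u and v_i are the
-- segments v_1 … v_{i-1} and v_{i+1} … v_{m-1} (when these are non-empty).

x∈p─q⇒x∉q : {p q : Subset n} {x : Fin n} → x ∈ p ─ q → x ∉ q
x∈p─q⇒x∉q {p = _ ∷ _} {outside ∷ _} {Fin.zero}  _          ()
x∈p─q⇒x∉q {p = _ ∷ _} {inside  ∷ _} {Fin.zero}  ()         _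
x∈p─q⇒x∉q {p = _ ∷ p} {outside ∷ q} {Fin.suc _} (there x∈) (there x∈q) = x∈p─q⇒x∉q {p = p} x∈ x∈q
x∈p─q⇒x∉q {p = _ ∷ p} {inside  ∷ q} {Fin.suc _} (there x∈) (there x∈q) = x∈p─q⇒x∉q {p = p} x∈ x∈q

vertex≡ : {p : Subset n} {v w : ∃[ x ] x ∈ p} → proj₁ v ≡ proj₁ w → v ≡ w
vertex≡ {v = x , a} {_ , b} refl = cong (x ,_) ([]=-irrelevant a b)

module Segment {m i} .{{_ : NonZero i}} (lo hi : ℕ) (hi≤m : hi ≤ m)
  (avoids : ∀ {a} → lo ≤ a → a < hi → a ≢ 0 × a ≢ i)
  (closed : ∀ {a b} → lo ≤ a → a < hi → b < m → b ≢ 0 → b ≢ i →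
            PathEdge a b ⊎ PathEdge b a → lo ≤ b × b < hi)
  where

  Q : Graph m
  Q = P⁺∖u∖vᵢ m i

  In : Fin m → Set
  In x = lo ≤ toℕ x × toℕ x < hi

  In? : Decidable In
  In? x = (lo ≤? toℕ x) ×-dec (toℕ x <? hi)

  Edge? : ∀ x → Decidable (λ y → Adj Q x y × In x × In y)
  Edge? x y = (y ∈? N Q x) ×-dec (In? x ×-dec In? y)

  Seg : Graph m
  Seg = record
    { V        = ⟦ In? ⟧
    ; N        = λ x → ⟦ Edge? x ⟧
    ; N⊆V      = λ x p → let (_ , _ , c) = ∈⟦⟧⁻ (Edge? x) p in ∈⟦⟧⁺ In? c
    ; N-sym    = λ x y p → let (a , b , c) = ∈⟦⟧⁻ (Edge? x) p in
                   ∈⟦⟧⁺ (Edge? y) (N-sym Q x y a , c , b)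
    ; N-irrefl = λ x p → N-irrefl Q x (proj₁ (∈⟦⟧⁻ (Edge? x) p))
    }

  Q-avoids : ∀ {x} → x ∈ V Q → toℕ x ≢ 0 × toℕ x ≢ i
  Q-avoids x∈Q = (λ e → x∈p─q⇒x∉q x∈Q (∈⟦⟧⁺ (u-or-vᵢ? i) (inj₁ e)))
               , (λ e → x∈p─q⇒x∉q x∈Q (∈⟦⟧⁺ (u-or-vᵢ? i) (inj₂ e)))

  In⇒∉ : ∀ {x} → In x → x ∉ ⟦ u-or-vᵢ? i ⟧
  In⇒∉ (l , h) x∈ with ∈⟦⟧⁻ (u-or-vᵢ? i) x∈
  ... | inj₁ e = proj₁ (avoids l h) e
  ... | inj₂ e = proj₂ (avoids l h) e

  QAdj⁻ : ∀ x y → Adj Q x y → PathEdge (toℕ x) (toℕ y) ⊎ PathEdge (toℕ y) (toℕ x)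
  QAdj⁻ x y e
    with graphOn⁻ (treeEdge? i) (treeEdge-irrefl i) x y (∖-Adj⁻ (P⁺ m i) ⟦ u-or-vᵢ? i ⟧ x y e)
       | Q-avoids (N⊆V Q y (N-sym Q x y e)) | Q-avoids (N⊆V Q x e)
  ... | inj₁ (inj₁ (_ , s)) | _ | _ = inj₁ s
  ... | inj₁ (inj₂ (z , _)) | (x≢0 , _) | _ = contradiction z x≢0
  ... | inj₂ (inj₁ (_ , s)) | _ | _ = inj₂ s
  ... | inj₂ (inj₂ (z , _)) | _ | (y≢0 , _) = contradiction z y≢0

  SegAdj⁺ : ∀ x y → In x → In y →
            PathEdge (toℕ x) (toℕ y) ⊎ PathEdge (toℕ y) (toℕ x) → Adj Seg x y
  SegAdj⁺ x y inx iny s = ∈⟦⟧⁺ (Edge? x)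
    (∖-Adj⁺ (P⁺ m i) ⟦ u-or-vᵢ? i ⟧ x y (graphOn⁺ (treeEdge? i) (treeEdge-irrefl i) x y (⊎-map
        (λ e → inj₁ (n≢0⇒n>0 (proj₁ (avoids (proj₁ inx) (proj₂ inx))) , e))
        (λ e → inj₁ (n≢0⇒n>0 (proj₁ (avoids (proj₁ iny) (proj₂ iny))) , e)) s))
      (In⇒∉ inx) (In⇒∉ iny)
    , inx , iny)

  Seg≤Q : Seg ≤ᴳ Q
  Seg≤Q = (λ p → x∈p∧x∉q⇒x∈p─q ∈⊤ (In⇒∉ (∈⟦⟧⁻ In? p)))
        , (λ x p → proj₁ (∈⟦⟧⁻ (Edge? x) p))

  walk : ∀ d {x y} → In x → In y → toℕ y ≡ d + toℕ x → Star (Adj Seg) x y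
  walk zero {x} inx iny e with refl ← toℕ-injective e = ε
  walk (suc d) {x} {y} inx@(l , h) iny e = SegAdj⁺ x (fromℕ< z<m) inx inz (inj₁ z≡) ◅ walk d inz iny
      (trans e (trans (sym (+-suc d (toℕ x))) (cong (d +_) (sym z≡))))
    where
    x<y : suc (toℕ x) ≤ toℕ y
    x<y = subst (suc (toℕ x) ≤_) (sym e) (s≤s (m≤n+m (toℕ x) d))
    z<m : suc (toℕ x) < m
    z<m = ≤-<-trans x<y (toℕ<n y)
    z≡ : toℕ (fromℕ< z<m) ≡ suc (toℕ x)
    z≡ = toℕ-fromℕ< z<m
    inz : In (fromℕ< z<m)
    inz = subst (lo ≤_) (sym z≡) (m≤n⇒m≤1+n l)
        , subst (_< hi) (sym z≡) (≤-<-trans x<y (proj₂ iny))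

  Seg-connected : Connected Seg
  Seg-connected {x} {y} x∈ y∈ with ≤-total (toℕ x) (toℕ y)
  ... | inj₁ x≤y = walk (toℕ y ∸ toℕ x) (∈⟦⟧⁻ In? x∈) (∈⟦⟧⁻ In? y∈) (sym (m∸n+n≡m x≤y))
  ... | inj₂ y≤x = reverse (λ {a} {b} → N-sym Seg a b)
                     (walk (toℕ x ∸ toℕ y) (∈⟦⟧⁻ In? y∈) (∈⟦⟧⁻ In? x∈) (sym (m∸n+n≡m y≤x)))

  stays : ∀ D → D ≤ᴳ Q → ∀ {x y} → In x → Star (Adj D) x y → In y
  stays D D≤Q inx ε = inx
  stays D D≤Q {x} inx (_◅_ {j = z} e es) = stays D D≤Q
    (closed (proj₁ inx) (proj₂ inx) (toℕ<n z) (proj₁ av) (proj₂ av) (QAdj⁻ x z e′)) es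
    where
    e′ = proj₂ D≤Q x e
    av = Q-avoids (N⊆V Q x e′)

  absorbs : ∀ D → D ≤ᴳ Q → Connected D → ∀ {v} → v ∈ V D → In v → D ≤ᴳ Seg
  absorbs D D≤Q conn v∈D inv =
      (λ x∈D → ∈⟦⟧⁺ In? (inD x∈D))
    , (λ x {y} p → ∈⟦⟧⁺ (Edge? x)
         (proj₂ D≤Q x p , inD (N⊆V D y (N-sym D x y p)) , inD (N⊆V D x p)))
    where
    inD : ∀ {x} → x ∈ V D → In x
    inD x∈D = stays D D≤Q inv (conn v∈D x∈D)

  isComponent : ∀ {v} → In v → IsComponent Q Seg
  isComponent {v} inv = record
    { subgraph  = Seg≤Q
    ; nonempty  = v , ∈⟦⟧⁺ In? inv
    ; connected = Seg-connected
    ; maximal   = λ D D≤Q conn Seg≤D → absorbs D D≤Q conn (proj₁ Seg≤D (∈⟦⟧⁺ In? inv)) inv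
    }

  private
    down< : ∀ {x} → In x → toℕ x ∸ lo < hi ∸ lo
    down< (l , h) = ∸-monoˡ-< h l

    up<hi : (j : Fin (hi ∸ lo)) → lo + toℕ j < hi
    up<hi j = subst (lo + toℕ j <_) (m+[n∸m]≡n lo≤hi) (+-monoʳ-< lo (toℕ<n j))
      where
      lo≤hi : lo ≤ hi
      lo≤hi = <⇒≤ (m∸n≢0⇒n<m (λ e → n≮0 (subst (toℕ j <_) e (toℕ<n j))))

    up : Fin (hi ∸ lo) → Fin m
    up j = fromℕ< (<-≤-trans (up<hi j) hi≤m)

    toℕ-up : ∀ j → toℕ (up j) ≡ lo + toℕ j
    toℕ-up j = toℕ-fromℕ< _

    up-In : ∀ j → In (up j)
    up-In j rewrite toℕ-up j = m≤m+n lo (toℕ j) , up<hi j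

    down : Vertex Seg → Fin (hi ∸ lo)
    down (x , x∈) = fromℕ< (down< (∈⟦⟧⁻ In? x∈))

    toℕ-down : ∀ v → toℕ (proj₁ v) ≡ lo + toℕ (down v)
    toℕ-down (x , x∈) = sym (trans (cong (lo +_) (toℕ-fromℕ< _))
                                   (m+[n∸m]≡n (proj₁ (∈⟦⟧⁻ In? x∈))))

  ≅Path : Seg ≅ Path (hi ∸ lo)
  ≅Path = record
    { bijection = mk↔ₛ′ (λ v → down v , ∈⊤) (λ (j , _) → up j , ∈⟦⟧⁺ In? (up-In j))
        (λ (j , j∈) → vertex≡ {p = ⊤} {w = j , j∈} (toℕ-injective (+-cancelˡ-≡ lo _ _
           (trans (sym (toℕ-down (up j , ∈⟦⟧⁺ In? (up-In j)))) (toℕ-up j)))))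
        (λ v → vertex≡ {w = v} (toℕ-injective (trans (toℕ-up (down v)) (sym (toℕ-down v)))))
    ; adjacency = λ x y → mk⇔
        (λ e → graphOn⁺ pathEdge? pathEdge-irrefl (down x) (down y) (⊎-map
           (unshift x y) (unshift y x)
           (QAdj⁻ (proj₁ x) (proj₁ y) (proj₁ (∈⟦⟧⁻ (Edge? (proj₁ x)) e)))))
        (λ e → SegAdj⁺ (proj₁ x) (proj₁ y) (∈⟦⟧⁻ In? (proj₂ x)) (∈⟦⟧⁻ In? (proj₂ y)) (⊎-map
           (shift x y) (shift y x) (graphOn⁻ pathEdge? pathEdge-irrefl (down x) (down y) e)))
    }
    where
    shift : ∀ x y → PathEdge (toℕ (down x)) (toℕ (down y)) → PathEdge (toℕ (proj₁ x)) (toℕ (proj₁ y))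
    shift x y e = trans (toℕ-down y) (trans (cong (lo +_) e)
                    (trans (+-suc lo _) (cong suc (sym (toℕ-down x)))))
    unshift : ∀ x y → PathEdge (toℕ (proj₁ x)) (toℕ (proj₁ y)) → PathEdge (toℕ (down x)) (toℕ (down y))
    unshift x y e = +-cancelˡ-≡ lo _ _ (trans (sym (toℕ-down y)) (trans e
                      (trans (cong suc (toℕ-down x)) (sym (+-suc lo _)))))

  good : OddAtLeast3 (hi ∸ lo) → Good m i
  good odd@(_ , 3≤) = Seg , isComponent (up-In (fromℕ< {0} (≤-trans (s≤s z≤n) 3≤)))
                    , hi ∸ lo , odd , ≅Path

  order : ∀ {C ℓ} → IsComponent Q C → C ≅ Path ℓ → ∀ {v} → v ∈ V C → In v → ℓ ≡ hi ∸ lo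
  order {C} {ℓ} comp iso v∈C inv = ↔⇒≡
    (vertices ↔-∘ (_≅_.bijection ≅Path ↔-∘ (subst (λ p → Vertex C ↔ ∃ (_∈ p)) V≡ ↔-id′
      ↔-∘ (↔-sym (_≅_.bijection iso) ↔-∘ ↔-sym vertices))))
    where
    open IsComponent comp
    C≤Seg = absorbs C subgraph connected v∈C inv
    V≡ : V C ≡ V Seg
    V≡ = ⊆-antisym (proj₁ C≤Seg) (proj₁ (maximal Seg Seg≤Q Seg-connected C≤Seg))
    ↔-id′ : Vertex C ↔ Vertex C
    ↔-id′ = mk↔ₛ′ id id (λ _ → refl) (λ _ → refl)
    vertices : ∀ {k} → Vertex (Path k) ↔ Fin k
    vertices = mk↔ₛ′ proj₁ (_, ∈⊤) (λ _ → refl) (λ v → vertex≡ {w = v} refl)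

module _ m i .{{_ : NonZero i}} (i≤m∸1 : i ≤ m ∸ 1) where

  private
    below : ∀ k → i ≤ k ∸ 1 → i < k
    below zero    i≤0 = contradiction (>-nonZero⁻¹ i) (≤⇒≯ i≤0)
    below (suc _) i≤k = s≤s i≤k

    i<m : i < m
    i<m = below m i≤m∸1

    left-avoids : ∀ {a} → 1 ≤ a → a < i → a ≢ 0 × a ≢ i
    left-avoids l h = ≢-sym (<⇒≢ l) , <⇒≢ h

    left-closed : ∀ {a b} → 1 ≤ a → a < i → b < m → b ≢ 0 → b ≢ i →
                  PathEdge a b ⊎ PathEdge b a → 1 ≤ b × b < i
    left-closed l h _ b≢0 b≢i (inj₁ refl) = s≤s z≤n , ≤∧≢⇒< h b≢i
    left-closed l h _ b≢0 b≢i (inj₂ refl) = n≢0⇒n>0 b≢0 , <-trans (n<1+n _) h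

    right-avoids : ∀ {a} → suc i ≤ a → a < m → a ≢ 0 × a ≢ i
    right-avoids l h = ≢-sym (<⇒≢ (≤-<-trans z≤n l)) , ≢-sym (<⇒≢ l)

    right-closed : ∀ {a b} → suc i ≤ a → a < m → b < m → b ≢ 0 → b ≢ i →
                   PathEdge a b ⊎ PathEdge b a → suc i ≤ b × b < m
    right-closed l h b<m _ _   (inj₁ refl) = m≤n⇒m≤1+n l , b<m
    right-closed l h b<m _ b≢i (inj₂ refl) = ≤∧≢⇒< (s≤s⁻¹ l) (≢-sym b≢i) , b<m

    module Left  = Segment {m} {i} 1 i (<⇒≤ i<m) left-avoids left-closed
    module Right = Segment {m} {i} (suc i) m ≤-refl right-avoids right-closed

    m∸[1+i]≡ : m ∸ suc i ≡ m ∸ 1 ∸ i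
    m∸[1+i]≡ = sym (∸-+-assoc m 1 i)

  good⇔ : Good m i ⇔ (OddAtLeast3 (i ∸ 1) ⊎ OddAtLeast3 (m ∸ 1 ∸ i))
  good⇔ = mk⇔ split
    [ Left.good , (λ odd → Right.good (subst OddAtLeast3 (sym m∸[1+i]≡) odd)) ]′
    where
    split : Good m i → OddAtLeast3 (i ∸ 1) ⊎ OddAtLeast3 (m ∸ 1 ∸ i)
    split (C , comp , ℓ , odd , iso) with IsComponent.nonempty comp
    ... | v , v∈C with Left.Q-avoids (proj₁ (IsComponent.subgraph comp) v∈C) | toℕ v <? i
    ...   | v≢0 , _   | yes v<i =
      inj₁ (subst OddAtLeast3 (Left.order comp iso v∈C (n≢0⇒n>0 v≢0 , v<i)) odd)
    ...   | _   , v≢i | no  v≮i =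
      inj₂ (subst OddAtLeast3 (trans (Right.order comp iso v∈C
        (≤∧≢⇒< (≮⇒≥ v≮i) (≢-sym v≢i) , toℕ<n v)) m∸[1+i]≡) odd)

  good? : Dec (Good m i)
  good? = map′ (Equivalence.from good⇔) (Equivalence.to good⇔)
    (oddAtLeast3? (i ∸ 1) ⊎-dec oddAtLeast3? (m ∸ 1 ∸ i))

  bad? : Dec (Bad m i)
  bad? = ¬? good?

module Submission where

open import Data.Bool.Base using (true; false)
import Data.Empty as Empty
open import Data.Fin.Base using (Fin; zero; suc; toℕ; fromℕ<)
open import Data.Fin.Properties using (any?; toℕ-fromℕ<; toℕ<n; toℕ-injective) renaming (_≟_ to _≟ᶠ_)
open import Data.Fin.Subset hiding (_⊂_)
open import Data.Fin.Subset.Properties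
open import Data.List.Base using (List; []; _∷_; _++_; _∷ʳ_; length; reverse)
open import Data.List.Membership.Propositional using (find; lose) renaming (_∈_ to _∈ᴸ_; _∉_ to _∉ᴸ_)
open import Data.List.Membership.Propositional.Properties using (∈-++⁺ˡ; ∈-++⁺ʳ; ∈-++⁻)
import Data.List.Properties as List
open import Data.List.Relation.Binary.Permutation.Propositional using (↭-sym; ↭⇒↭ₛ)
open import Data.List.Relation.Binary.Permutation.Propositional.Properties using (↭-reverse; ∈-resp-↭)
import Data.List.Relation.Binary.Permutation.Setoid.Properties as PermutationSetoid
open import Data.List.Relation.Unary.All as All using (All; []; _∷_)
import Data.List.Relation.Unary.All.Properties as All
open import Data.List.Relation.Unary.AllPairs using ([]; _∷_)
open import Data.List.Relation.Unary.Any using (here; there)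
open import Data.List.Relation.Unary.Linked as Linked using (Linked; []; [-]; _∷_)
open import Data.List.Relation.Unary.Unique.Propositional using (Unique)
open import Data.Nat using (ℕ; zero; suc; _+_; _∸_; _⊔_; _≤_; _<_; _≥_; _%_; ⌊_/2⌋; ⌈_/2⌉; z≤n; s≤s; z<s; s≤s⁻¹;
  NonZero; _≤?_; _<?_; _≟_; >-nonZero⁻¹; ≢-nonZero⁻¹)
open import Data.Nat.Induction using (<-wellFounded)
open import Data.Nat.Properties hiding (_≟_; _≤?_; _<?_; ≡-irrelevant)
open import Data.Product using (∃; ∃-syntax; _×_; _,_; proj₁; proj₂)
open import Data.Sum.Base using (_⊎_; inj₁; inj₂; [_,_]′; swap)
open import Data.Vec.Base using ([]; _∷_; here; there)
open import Function.Base using (_∘_; id)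
open import Function.Bundles using (module Equivalence; mk↔ₛ′; mk⇔)
open import Induction.WellFounded using (Acc; acc)
open import Level using (0ℓ)
open import Relation.Binary.Construct.Closure.ReflexiveTransitive using (Star; ε; _◅_; _◅◅_; gmap) renaming (reverse to ◅-reverse)
open import Relation.Binary.PropositionalEquality using (_≡_; _≢_; refl; sym; trans; cong; cong₂; subst; subst₂; setoid)
open import Relation.Nullary using (¬_; Dec; yes; no; ¬?; contradiction; _×-dec_; _⊎-dec_)
open import Relation.Nullary.Decidable using (decidable-stable)
open import Relation.Unary using (Pred; Decidable)
open import Defs

-- Call a vertex set D of G - Y with more than k elements and at most k outer
-- neighbours a piece.  If D is an inclusion-minimal piece of a k-connected graph
-- G - Y, then removing a vertex x of D keeps the graph k-connected, and a minimal
-- piece inside D - x is again adjacent to x.  So a path can be prolonged for ever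
-- into smaller and smaller pieces, as long as the removed vertices do not lower
-- the degrees too much.  To achieve this only the first vertex e of the path and
-- its last a + 2 vertices p, c, q₁, …, q_a are kept removed.  The pieces cannot
-- shrink for ever, hence at some time c is adjacent to the current piece; then c
-- has the leaf p, the arm q₁ … q_a, and a second arm can be grown from c into the
-- piece.  In a triangle-free graph a vertex has at most one neighbour on an edge,
-- so it loses at most half of each arm, which is what the minimum degree pays for,
-- except that e costs one more than is available when the second arm is nearly
-- complete; there the few vertices of low degree are all adjacent to e.

-- A removed vertex may be given back if it keeps k neighbours, which saves the connectivity, and if
-- the current piece is not adjacent to it, since otherwise the piece could get more than k outer
-- neighbours. Every vertex but the first comes to the place of p from the place of c, where the
-- piece was found not adjacent to it, and pieces only shrink. The first vertex e never was in the
-- place of c; nothing is known about its edges to the piece, so it stays removed until the last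
-- step. The arithmetic starts from the colour class that avoids the branch vertex: for arms of
-- orders a and b it has at least 1 + ⌈a/2⌉ + ⌈b/2⌉ vertices, and no vertex has more neighbours on
-- the tree. So k neighbours always remain, but removing x requires k + 1 at the neighbours of x. If
-- b is odd, the arm without its last vertex costs one less; b ≥ 3 covers the sliding, where e and a
-- path of a + 2 vertices cost 2 + ⌈a/2⌉. For a bad tree the extra term supplies the unit.
-- Triangle-freeness has a second use: the ends of an edge have disjoint neighbourhoods, so a set
-- that contains an edge between vertices of high degree and has at most k outer neighbours is
-- large, as a piece must be.

private variable
  n : ℕ

-- Cardinalities of subsets

∣p∪q∣+∣p∩q∣≡∣p∣+∣q∣ : (p q : Subset n) → ∣ p ∪ q ∣ + ∣ p ∩ q ∣ ≡ ∣ p ∣ + ∣ q ∣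
∣p∪q∣+∣p∩q∣≡∣p∣+∣q∣ []          []          = refl
∣p∪q∣+∣p∩q∣≡∣p∣+∣q∣ (true  ∷ p) (true  ∷ q) = cong suc (trans (+-suc ∣ p ∪ q ∣ ∣ p ∩ q ∣)
  (trans (cong suc (∣p∪q∣+∣p∩q∣≡∣p∣+∣q∣ p q)) (sym (+-suc ∣ p ∣ ∣ q ∣))))
∣p∪q∣+∣p∩q∣≡∣p∣+∣q∣ (true  ∷ p) (false ∷ q) = cong suc (∣p∪q∣+∣p∩q∣≡∣p∣+∣q∣ p q)
∣p∪q∣+∣p∩q∣≡∣p∣+∣q∣ (false ∷ p) (true  ∷ q) =
  trans (cong suc (∣p∪q∣+∣p∩q∣≡∣p∣+∣q∣ p q)) (sym (+-suc ∣ p ∣ ∣ q ∣))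
∣p∪q∣+∣p∩q∣≡∣p∣+∣q∣ (false ∷ p) (false ∷ q) = ∣p∪q∣+∣p∩q∣≡∣p∣+∣q∣ p q

-- Inclusion-exclusion on both sides. It yields the submodularity of outer neighbourhoods and, when
-- the left pair is disjoint, the count of the neighbourhoods of adjacent vertices.
uncross : (p q r s : Subset n) →
          (∀ {x} → x ∈ p → x ∈ r ⊎ x ∈ s) → (∀ {x} → x ∈ q → x ∈ r ⊎ x ∈ s) →
          (∀ {x} → x ∈ p → x ∈ q → x ∈ r × x ∈ s) → ∣ p ∣ + ∣ q ∣ ≤ ∣ r ∣ + ∣ s ∣
uncross p q r s p⊆ q⊆ ∩⊆ = begin
  ∣ p ∣ + ∣ q ∣           ≡⟨ ∣p∪q∣+∣p∩q∣≡∣p∣+∣q∣ p q ⟨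
  ∣ p ∪ q ∣ + ∣ p ∩ q ∣   ≤⟨ +-mono-≤ (p⊆q⇒∣p∣≤∣q∣ (x∈p∪q⁺ ∘ [ p⊆ , q⊆ ]′ ∘ x∈p∪q⁻ p q))
                                      (p⊆q⇒∣p∣≤∣q∣ λ x∈ → let (a , b) = x∈p∩q⁻ p q x∈ in x∈p∩q⁺ (∩⊆ a b)) ⟩
  ∣ r ∪ s ∣ + ∣ r ∩ s ∣   ≡⟨ ∣p∪q∣+∣p∩q∣≡∣p∣+∣q∣ r s ⟩
  ∣ r ∣ + ∣ s ∣           ∎
  where open ≤-Reasoning

∣p∣≤∣q∣+∣r∣ : (p q r : Subset n) → (∀ {x} → x ∈ p → x ∈ q ⊎ x ∈ r) → ∣ p ∣ ≤ ∣ q ∣ + ∣ r ∣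
∣p∣≤∣q∣+∣r∣ {n} p q r p⊆ = ≤-trans (m≤m+n ∣ p ∣ ∣ ⊥ {n} ∣)
  (uncross p ⊥ q r p⊆ (λ x∈ → contradiction x∈ ∉⊥) (λ _ x∈ → contradiction x∈ ∉⊥))

∣p∣≤1+∣q∣ : ∀ (p q : Subset n) x → (∀ {y} → y ∈ p → y ≢ x → y ∈ q) → ∣ p ∣ ≤ suc ∣ q ∣
∣p∣≤1+∣q∣ p q x p⊆ = subst (λ c → ∣ p ∣ ≤ c + ∣ q ∣) (∣⁅x⁆∣≡1 x) (∣p∣≤∣q∣+∣r∣ p ⁅ x ⁆ q sub)
  where
  sub : ∀ {y} → y ∈ p → y ∈ ⁅ x ⁆ ⊎ y ∈ q
  sub {y} y∈ with y ∈? ⁅ x ⁆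
  ... | yes y∈x = inj₁ y∈x
  ... | no  y∉x = inj₂ (p⊆ y∈ λ { refl → y∉x (x∈⁅x⁆ x) })

¬⊆⇒∃∈p∖q : {p q : Subset n} → ¬ (p ⊆ q) → ∃[ x ] x ∈ p × x ∉ q
¬⊆⇒∃∈p∖q {p = p} {q} p⊈q with any? (λ x → (x ∈? p) ×-dec ¬? (x ∈? q))
... | yes found = found
... | no  none  = contradiction (λ {x} → p⊆q x) p⊈q
  where
  p⊆q : ∀ x → x ∈ p → x ∈ q
  p⊆q x x∈p with x ∈? q
  ... | yes x∈q = x∈q
  ... | no  x∉q = contradiction (x , x∈p , x∉q) none

∣q∣<∣p∣⇒∃∈p∖q : (p q : Subset n) → ∣ q ∣ < ∣ p ∣ → ∃[ x ] x ∈ p × x ∉ q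
∣q∣<∣p∣⇒∃∈p∖q p q q<p = ¬⊆⇒∃∈p∖q λ p⊆q → <⇒≱ q<p (p⊆q⇒∣p∣≤∣q∣ p⊆q)

0<∣p∣⇒Nonempty : (p : Subset n) → 0 < ∣ p ∣ → Nonempty p
0<∣p∣⇒Nonempty {n} p 0<p =
  let (x , x∈p , _) = ∣q∣<∣p∣⇒∃∈p∖q p ⊥ (subst (_< ∣ p ∣) (sym (∣⊥∣≡0 n)) 0<p) in x , x∈p

∈─⁻ : {p q : Subset n} {x : Fin n} → x ∈ p ─ q → x ∈ p × x ∉ q
∈─⁻ {p = p} {q} x∈ = p─q⊆p p q x∈ , x∈p─q⇒x∉q x∈

infixl 6 _▷_

opaque
  _▷_ : Subset n → Fin n → Subset n
  Y ▷ x = Y ∪ ⁅ x ⁆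

  ∈▷⁻ : ∀ {Y : Subset n} {x y} → y ∈ Y ▷ x → y ∈ Y ⊎ y ≡ x
  ∈▷⁻ {Y = Y} {x} y∈ with x∈p∪q⁻ Y ⁅ x ⁆ y∈
  ... | inj₁ y∈Y = inj₁ y∈Y
  ... | inj₂ y∈x = inj₂ (x∈⁅y⁆⇒x≡y x y∈x)

  ∈▷ˡ : ∀ {Y : Subset n} {x y} → y ∈ Y → y ∈ Y ▷ x
  ∈▷ˡ y∈Y = x∈p∪q⁺ (inj₁ y∈Y)

  ∈▷ʳ : ∀ {Y : Subset n} x → x ∈ Y ▷ x
  ∈▷ʳ x = x∈p∪q⁺ (inj₂ (x∈⁅x⁆ x))

∉▷ : ∀ {Y : Subset n} {x y} → y ∉ Y → y ≢ x → y ∉ Y ▷ x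
∉▷ y∉Y y≢x y∈ with ∈▷⁻ y∈
... | inj₁ y∈Y = y∉Y y∈Y
... | inj₂ y≡x = y≢x y≡x

∣Y▷x∣≤ : ∀ (Y : Subset n) x → ∣ Y ▷ x ∣ ≤ suc ∣ Y ∣
∣Y▷x∣≤ Y x = ∣p∣≤1+∣q∣ (Y ▷ x) Y x λ y∈ y≢x → [ id , (λ y≡x → contradiction y≡x y≢x) ]′ (∈▷⁻ y∈)

-- Outer neighbours, linkedness and pieces

module Cut {n} (G : Graph n) where

  infix 4 _~_ _~?_
  _~_ : Fin n → Fin n → Set
  x ~ y = Adj G x y

  _~?_ : ∀ x y → Dec (x ~ y)
  x ~? y = y ∈? N G x

  ~-sym : ∀ {x y} → x ~ y → y ~ x
  ~-sym = N-sym G _ _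

  ~-∈V : ∀ {x y} → x ~ y → y ∈ V G
  ~-∈V = N⊆V G _

  infix 4 _≈_
  _≈_ : Subset n → Fin n → Set
  D ≈ x = ∃[ d ] d ∈ D × d ~ x

  _≈?_ : ∀ D x → Dec (D ≈ x)
  D ≈? x = any? λ d → (d ∈? D) ×-dec (d ~? x)

  U : Subset n → Subset n
  U Y = V G ─ Y

  opaque
    deg : Subset n → Fin n → ℕ
    deg Y z = ∣ N G z ─ Y ∣

    deg≡ : ∀ Y z → deg Y z ≡ ∣ N G z ─ Y ∣
    deg≡ Y z = refl

    ∂? : ∀ Y A → Decidable (λ v → v ∉ Y × v ∉ A × A ≈ v)
    ∂? Y A v = ¬? (v ∈? Y) ×-dec (¬? (v ∈? A) ×-dec (A ≈? v))

    ∂ : Subset n → Subset n → Subset n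
    ∂ Y A = ⟦ ∂? Y A ⟧

    Rest? : ∀ Y A → Decidable (λ v → v ∈ V G × v ∉ Y × v ∉ A × ¬ (A ≈ v))
    Rest? Y A v = (v ∈? V G) ×-dec (¬? (v ∈? Y) ×-dec (¬? (v ∈? A) ×-dec ¬? (A ≈? v)))

    Rest : Subset n → Subset n → Subset n
    Rest Y A = ⟦ Rest? Y A ⟧

    ∂⁺ : ∀ {Y A v a} → v ∉ Y → v ∉ A → a ∈ A → a ~ v → v ∈ ∂ Y A
    ∂⁺ {Y} {A} v∉Y v∉A a∈A a~v = ∈⟦⟧⁺ (∂? Y A) (v∉Y , v∉A , _ , a∈A , a~v)

    ∂⁻ : ∀ {Y A v} → v ∈ ∂ Y A → v ∉ Y × v ∉ A × A ≈ v
    ∂⁻ {Y} {A} = ∈⟦⟧⁻ (∂? Y A)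

    Rest⁺ : ∀ {Y A v} → v ∈ V G → v ∉ Y → v ∉ A → ¬ (A ≈ v) → v ∈ Rest Y A
    Rest⁺ {Y} {A} a b c d = ∈⟦⟧⁺ (Rest? Y A) (a , b , c , d)

    Rest⁻ : ∀ {Y A v} → v ∈ Rest Y A → v ∈ V G × v ∉ Y × v ∉ A × ¬ (A ≈ v)
    Rest⁻ {Y} {A} = ∈⟦⟧⁻ (Rest? Y A)

  module _ {Y A : Subset n} where
    trichotomy : ∀ {v} → v ∈ V G → v ∉ Y → v ∈ A ⊎ v ∈ ∂ Y A ⊎ v ∈ Rest Y A
    trichotomy {v} v∈V v∉Y with v ∈? A | A ≈? v
    ... | yes v∈A | _                   = inj₁ v∈A
    ... | no  v∉A | yes (_ , a∈A , a~v) = inj₂ (inj₁ (∂⁺ v∉Y v∉A a∈A a~v))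
    ... | no  v∉A | no  A≉v             = inj₂ (inj₂ (Rest⁺ v∈V v∉Y v∉A A≉v))

    N─⊆ : ∀ {a v} → a ∈ A → v ∈ N G a ─ Y → v ∈ A ⊎ v ∈ ∂ Y A
    N─⊆ {a} {v} a∈A v∈ with v ∈? A
    ... | yes v∈A = inj₁ v∈A
    ... | no  v∉A = let (a~v , v∉Y) = ∈─⁻ v∈ in inj₂ (∂⁺ v∉Y v∉A a∈A a~v)

  Rest-anti : ∀ {Y A A′} → A′ ⊆ A → Rest Y A ⊆ Rest Y A′
  Rest-anti A′⊆A v∈ = let (a , b , c , d) = Rest⁻ v∈ in
    Rest⁺ a b (c ∘ A′⊆A) λ (x , x∈ , e) → d (x , A′⊆A x∈ , e)

  -- κ(G - Y) ≥ k, except that G - Y may be too small.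
  _-LinkedOff_ : ℕ → Subset n → Set
  k -LinkedOff Y = ∀ A → A ⊆ U Y → Nonempty A → Nonempty (Rest Y A) → k ≤ ∣ ∂ Y A ∣

  module _ (k : ℕ) where
    -- The alternative U Y ⊆ D is for κ(G - Y) > k, when there are no separators of order k.
    Piece : Subset n → Subset n → Set
    Piece Y D = D ⊆ U Y × k < ∣ D ∣ × ∣ ∂ Y D ∣ ≤ k × (U Y ⊆ D ⊎ k ≤ ∣ Rest Y D ∣)

    piece? : ∀ Y D → Dec (Piece Y D)
    piece? Y D = (D ⊆? U Y) ×-dec ((k <? ∣ D ∣) ×-dec ((∣ ∂ Y D ∣ ≤? k) ×-dec
                 ((U Y ⊆? D) ⊎-dec (k ≤? ∣ Rest Y D ∣))))

    MinPiece : Subset n → Subset n → Set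
    MinPiece Y D = Piece Y D × (∀ D′ → Piece Y D′ → D′ ⊆ D → D ⊆ D′)

    minPiece : ∀ {Y D} → Piece Y D → ∃[ D′ ] D′ ⊆ D × MinPiece Y D′
    minPiece {Y} {D} pD = go D pD (<-wellFounded ∣ D ∣)
      where
      go : ∀ D → Piece Y D → Acc _<_ ∣ D ∣ → ∃[ D′ ] D′ ⊆ D × MinPiece Y D′
      go D pD (acc rec) with anySubset? (λ D′ → piece? Y D′ ×-dec ((D′ ⊆? D) ×-dec ¬? (D ⊆? D′)))
      ... | yes (D′ , pD′ , D′⊆D , D⊈D′) =
        let (D″ , D″⊆D′ , m) = go D′ pD′ (rec (p⊂q⇒∣p∣<∣q∣ (D′⊆D , ¬⊆⇒∃∈p∖q D⊈D′)))
        in D″ , D′⊆D ∘ D″⊆D′ , m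
      ... | no none = D , (λ x∈ → x∈) , pD , min
        where
        min : ∀ D′ → Piece Y D′ → D′ ⊆ D → D ⊆ D′
        min D′ pD′ D′⊆D with D ⊆? D′
        ... | yes D⊆D′ = D⊆D′
        ... | no  D⊈D′ = contradiction (D′ , pD′ , (λ {x} → D′⊆D {x}) , D⊈D′) none

-- Connectivity and separations

minimum : {P : Pred ℕ 0ℓ} → Decidable P → ∀ c → P c → ∃ (IsMinimum P)
minimum {P} P? c Pc = go c Pc (<-wellFounded c)
  where
  go : ∀ c → P c → Acc _<_ c → ∃ (IsMinimum P)
  go c Pc (acc rec) with anyUpTo? P? c
  ... | yes (d , d<c , Pd) = go d Pd (rec d<c)
  ... | no  none           = c , Pc , λ d Pd → ≮⇒≥ λ d<c → none (d , d<c , Pd)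

module _ {n} (H : Graph n) where

  Leaves : Subset n → Set
  Leaves A = ∃[ x ] x ∈ A × ∃[ y ] Adj H x y × y ∉ A

  leaves? : Decidable Leaves
  leaves? A = any? λ x → (x ∈? A) ×-dec any? λ y → (y ∈? N H x) ×-dec ¬? (y ∈? A)

  -- A finite witness that a graph is disconnected; unlike the absence of a walk it can be searched
  -- for.
  Splits : Subset n → Set
  Splits A = (∃[ a ] a ∈ V H × a ∈ A) × (∃[ b ] b ∈ V H × b ∉ A) × ¬ Leaves A

  splits? : Decidable Splits
  splits? A = any? (λ a → (a ∈? V H) ×-dec (a ∈? A)) ×-dec
              (any? (λ b → (b ∈? V H) ×-dec ¬? (b ∈? A)) ×-dec ¬? (leaves? A))

  stays-inside : ∀ {A x y} → ¬ Leaves A → x ∈ A → Star (Adj H) x y → y ∈ A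
  stays-inside closed x∈A ε = x∈A
  stays-inside {A} {x} closed x∈A (_◅_ {j = z} x~z walk) with z ∈? A
  ... | yes z∈A = stays-inside closed z∈A walk
  ... | no  z∉A = contradiction (x , x∈A , z , x~z , z∉A) closed

  splits⇒¬connected : ∀ {A} → Splits A → ¬ Connected H
  splits⇒¬connected ((a , a∈V , a∈A) , (b , b∈V , b∉A) , closed) connected =
    b∉A (stays-inside closed a∈A (connected a∈V b∈V))

  -- The component of `x`, grown by one vertex at a time; the complement shrinks, so the growth
  -- stops at a set that no edge leaves.
  reachable : ∀ x → ∃[ A ] x ∈ A × ¬ Leaves A × (∀ {y} → y ∈ A → Star (Adj H) x y)
  reachable x = go ⁅ x ⁆ (x∈⁅x⁆ x) (λ y∈ → subst (Star (Adj H) x) (sym (x∈⁅y⁆⇒x≡y x y∈)) ε) (<-wellFounded _)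
    where
    go : ∀ A → x ∈ A → (∀ {y} → y ∈ A → Star (Adj H) x y) → Acc _<_ (n ∸ ∣ A ∣) →
         ∃[ A ] x ∈ A × ¬ Leaves A × (∀ {y} → y ∈ A → Star (Adj H) x y)
    go A x∈A reach (acc rec) with leaves? A
    ... | no  closed                    = A , x∈A , closed , reach
    ... | yes (y , y∈A , z , y~z , z∉A) = go (A ▷ z) (∈▷ˡ x∈A) reach′
      (rec (∸-monoʳ-< (p⊂q⇒∣p∣<∣q∣ (∈▷ˡ , z , ∈▷ʳ z , z∉A)) (∣p∣≤n (A ▷ z))))
      where
      reach′ : ∀ {w} → w ∈ A ▷ z → Star (Adj H) x w
      reach′ w∈ with ∈▷⁻ w∈
      ... | inj₁ w∈A  = reach w∈A
      ... | inj₂ refl = reach y∈A ◅◅ (y~z ◅ ε)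

  ¬splits⇒connected : (∀ A → ¬ Splits A) → Connected H
  ¬splits⇒connected none {x} {y} x∈V y∈V with reachable x
  ... | A , x∈A , closed , reach with y ∈? A
  ...   | yes y∈A = reach y∈A
  ...   | no  y∉A = contradiction ((x , x∈V , x∈A) , (y , y∈V , y∉A) , closed) (none A)

connected? : ∀ {n} (H : Graph n) → Dec (Connected H)
connected? H with anySubset? (splits? H)
... | yes (A , splits) = no (splits⇒¬connected H splits)
... | no  none         = yes (¬splits⇒connected H λ A splits → none (A , splits))

vertexCut? : ∀ {n} (H : Graph n) → Decidable (IsVertexCut H)
vertexCut? H S = (S ⊆? V H) ×-dec (¬? (connected? (H ∖ S)) ⊎-dec (∣ V (H ∖ S) ∣ ≟ 1))

-- Removing all vertices but `v` leaves a trivial graph, so there is a cut to start the minimisation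
-- from.
connectivity : ∀ {n} (H : Graph n) {v} → v ∈ V H → ∃ (IsConnectivity H)
connectivity H {v} v∈V = minimum (λ c → anySubset? λ S → vertexCut? H S ×-dec (∣ S ∣ ≟ c))
  ∣ V H - v ∣ (V H - v , (p─q⊆p (V H) ⁅ v ⁆ , inj₂ trivial) , refl)
  where
  trivial : ∣ V H ─ (V H - v) ∣ ≡ 1
  trivial = trans (cong ∣_∣ (⊆-antisym to from)) (∣⁅x⁆∣≡1 v)
    where
    to : V H ─ (V H - v) ⊆ ⁅ v ⁆
    to {w} w∈ with w ∈? ⁅ v ⁆
    ... | yes w∈v = w∈v
    ... | no  w∉v = let (w∈V , w∉) = ∈─⁻ w∈ in contradiction (x∈p∧x∉q⇒x∈p─q w∈V w∉v) w∉
    from : ⁅ v ⁆ ⊆ V H ─ (V H - v)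
    from w∈ with refl ← x∈⁅y⁆⇒x≡y v w∈ = x∈p∧x∉q⇒x∈p─q v∈V λ v∈ → proj₂ (∈─⁻ v∈) (x∈⁅x⁆ v)

∖-Adj-∉ : ∀ {n} (G : Graph n) Z {x y} → Adj (G ∖ Z) x y → Adj G x y × x ∉ Z × y ∉ Z
∖-Adj-∉ G Z {x} {y} x~y = ∖-Adj⁻ G Z x y x~y
  , proj₂ (∈─⁻ (N⊆V (G ∖ Z) y (N-sym (G ∖ Z) x y x~y))) , proj₂ (∈─⁻ (N⊆V (G ∖ Z) x x~y))

-- Removing vertices of minimal pieces

surplus : ∀ {i j a b c s} → i ≤ a → j ≤ b → a + b ≤ c + s → s ≤ j → i ≤ c
surplus {i} {j} {a} {b} {c} {s} i≤a j≤b a+b≤c+s s≤j = +-cancelʳ-≤ j i c (begin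
  i + j   ≤⟨ +-mono-≤ i≤a j≤b ⟩
  a + b   ≤⟨ a+b≤c+s ⟩
  c + s   ≤⟨ +-monoʳ-≤ c s≤j ⟩
  c + j   ∎)
  where open ≤-Reasoning

module Removal {n} (G : Graph n) (triangleFree : TriangleFree G) (k : ℕ) where
  open Cut G public

  -- A common neighbour of `z` and `z′` would close a triangle, so both neighbourhoods fit side by
  -- side into `A` and `S`. This turns lower bounds on degrees into lower bounds on the size of `A`.
  edge-degrees : ∀ Y A S {z z′} → z ~ z′ →
                 (∀ {v} → v ∈ N G z ─ Y → v ∈ A ⊎ v ∈ S) →
                 (∀ {v} → v ∈ N G z′ ─ Y → v ∈ A ⊎ v ∈ S) →
                 deg Y z + deg Y z′ ≤ ∣ A ∣ + ∣ S ∣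
  edge-degrees Y A S {z} {z′} z~z′ Nz⊆ Nz′⊆ rewrite deg≡ Y z | deg≡ Y z′ = uncross (N G z ─ Y) (N G z′ ─ Y) A S Nz⊆ Nz′⊆
    λ v∈ v∈′ → contradiction (z~z′ , proj₁ (∈─⁻ v∈′) , ~-sym (proj₁ (∈─⁻ v∈))) triangleFree

  inner-neighbour : ∀ Y A S {z} → (∀ {v} → v ∈ N G z ─ Y → v ∈ A ⊎ v ∈ S) → ∣ S ∣ < deg Y z →
                    ∃[ z′ ] z′ ∈ A × z ~ z′ × z′ ∉ Y
  inner-neighbour Y A S {z} Nz⊆ S<deg with ∣q∣<∣p∣⇒∃∈p∖q (N G z ─ Y) S (subst (∣ S ∣ <_) (deg≡ Y z) S<deg)
  ... | z′ , z′∈N , z′∉S with Nz⊆ z′∈N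
  ...   | inj₁ z′∈A = z′ , z′∈A , ∈─⁻ z′∈N
  ...   | inj₂ z′∈S = contradiction z′∈S z′∉S

  -- Unlike `∂` and `Rest`, this form is symmetric in the two sides; `S` only has to contain what
  -- the sides leave over.
  record Separation (Y A B S : Subset n) : Set where
    field
      A⊆U      : A ⊆ U Y
      B⊆U      : B ⊆ U Y
      A≢∅      : Nonempty A
      B≢∅      : Nonempty B
      disjoint : ∀ {v} → v ∈ A → v ∉ B
      no-edge  : ∀ {a b} → a ∈ A → b ∈ B → ¬ a ~ b
      cover    : ∀ {v} → v ∈ U Y → v ∈ A ⊎ v ∈ B ⊎ v ∈ S

  flip : ∀ {Y A B S} → Separation Y A B S → Separation Y B A S
  flip sep = record
    { A⊆U = B⊆U ; B⊆U = A⊆U ; A≢∅ = B≢∅ ; B≢∅ = A≢∅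
    ; disjoint = λ v∈B v∈A → disjoint v∈A v∈B
    ; no-edge  = λ b∈B a∈A b~a → no-edge a∈A b∈B (~-sym b~a)
    ; cover    = λ v∈ → [ inj₂ ∘ inj₁ , [ inj₁ , inj₂ ∘ inj₂ ]′ ]′ (cover v∈)
    } where open Separation sep

  ∂-separation : ∀ {Y A} → A ⊆ U Y → Nonempty A → Nonempty (Rest Y A) →
                 Separation Y A (Rest Y A) (∂ Y A)
  ∂-separation A⊆U A≢∅ R≢∅ = record
    { A⊆U = A⊆U ; A≢∅ = A≢∅ ; B≢∅ = R≢∅
    ; B⊆U = λ v∈ → let (a , b , _) = Rest⁻ v∈ in x∈p∧x∉q⇒x∈p─q a b
    ; disjoint = λ v∈A v∈R → proj₁ (proj₂ (proj₂ (Rest⁻ v∈R))) v∈A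
    ; no-edge  = λ a∈A b∈R a~b → proj₂ (proj₂ (proj₂ (Rest⁻ b∈R))) (_ , a∈A , a~b)
    ; cover    = λ v∈ → let (a , b) = ∈─⁻ v∈ in
                 [ inj₁ , [ inj₂ ∘ inj₂ , inj₂ ∘ inj₁ ]′ ]′ (trichotomy a b)
    }

  linked⁺ : ∀ {Y} → (∀ {A B S} → Separation Y A B S → k ≤ ∣ S ∣) → k -LinkedOff Y
  linked⁺ bound A A⊆U A≢∅ R≢∅ = bound (∂-separation A⊆U A≢∅ R≢∅)

  linked⁻ : ∀ {Y} → k -LinkedOff Y → ∀ {A B S} → Separation Y A B S → k ≤ ∣ S ∣
  linked⁻ {Y} linked {A} {B} {S} sep = ≤-trans (linked A A⊆U A≢∅ (b , Rest⁺ (proj₁ b∈U) (proj₂ b∈U)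
      (λ b∈A → disjoint b∈A b∈B) λ (a , a∈A , a~b) → no-edge a∈A b∈B a~b)) (p⊆q⇒∣p∣≤∣q∣ ∂⊆S)
    where
    open Separation sep
    b   = proj₁ B≢∅
    b∈B = proj₂ B≢∅
    b∈U = ∈─⁻ (B⊆U b∈B)
    ∂⊆S : ∂ Y A ⊆ S
    ∂⊆S v∈∂ with ∂⁻ v∈∂
    ... | v∉Y , v∉A , a , a∈A , a~v with cover (x∈p∧x∉q⇒x∈p─q (~-∈V a~v) v∉Y)
    ...   | inj₁ v∈A        = contradiction v∈A v∉A
    ...   | inj₂ (inj₁ v∈B) = contradiction a~v (no-edge a∈A v∈B)
    ...   | inj₂ (inj₂ v∈S) = v∈S

  -- The core of the proof.  A separation of G - Y⁻ - x of order less than k would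
  -- give one of G - Y of order k whose separator contains x.  Uncrossing it with
  -- the minimal piece D produces a part of D with at most k outer neighbours,
  -- which contains an edge at a neighbour of x and is therefore a smaller piece.
  module _ {Y⁻ Y D x} (Y⁻⊆Y : Y⁻ ⊆ Y) (linked : k -LinkedOff Y) (minD : MinPiece k Y D) (x∈D : x ∈ D)
    (deg≥ : ∀ {z} → z ∈ D → k ≤ deg Y z) (deg> : ∀ {z} → z ∈ D → z ~ x → k < deg Y z)
    (sides : ∀ {A B S} → Separation (Y⁻ ▷ x) A B S → ∣ S ∣ < k → k < ∣ A ─ Y ∣)
    where

    private
      D⊆U = proj₁ (proj₁ minD)
      k<D = proj₁ (proj₂ (proj₁ minD))
      ∂D≤ = proj₁ (proj₂ (proj₂ (proj₁ minD)))
      R   = Rest Y D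

      D∩R : ∀ {v} → v ∈ D → v ∉ R
      D∩R v∈D v∈R = proj₁ (proj₂ (proj₂ (Rest⁻ v∈R))) v∈D

      D∩∂ : ∀ {v} → v ∈ D → v ∉ ∂ Y D
      D∩∂ v∈D v∈∂ = proj₁ (proj₂ (∂⁻ v∈∂)) v∈D

      module _ {A B S} (sep : Separation (Y⁻ ▷ x) A B S) where
        open Separation sep

        classify : ∀ {v} → v ∈ V G → v ∉ Y → v ∈ A ⊎ v ∈ B ⊎ v ∈ S ▷ x
        classify {v} v∈V v∉Y with v ≟ᶠ x
        ... | yes refl = inj₂ (inj₂ (∈▷ʳ x))
        ... | no  v≢x  = [ inj₁ , inj₂ ∘ [ inj₁ , inj₂ ∘ ∈▷ˡ ]′ ]′
          (cover (x∈p∧x∉q⇒x∈p─q v∈V (∉▷ (v∉Y ∘ Y⁻⊆Y) v≢x)))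

        x∉A : x ∉ A
        x∉A x∈A = proj₂ (∈─⁻ (A⊆U x∈A)) (∈▷ʳ x)

        S▷x≤ : ∣ S ∣ < k → ∣ S ▷ x ∣ ≤ k
        S▷x≤ S<k = ≤-trans (∣Y▷x∣≤ S x) S<k

        private
          -- Two opposite corners of the crossing separations of G - Y given by `D`, `∂ Y D`, `R`
          -- and by `A`, `S ▷ x`, `B`.
          C  = D ∩ A
          C′ = R ∩ B

          C⁻ : ∀ {v} → v ∈ C → v ∈ D × v ∈ A
          C⁻ = x∈p∩q⁻ D A

          C′⁻ : ∀ {v} → v ∈ C′ → v ∈ R × v ∈ B
          C′⁻ = x∈p∩q⁻ R B

          near : ∀ {z v} → z ∈ C → z ~ v → v ∉ Y → (v ∈ D ⊎ v ∈ ∂ Y D) × (v ∈ A ⊎ v ∈ S ▷ x)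
          near {z} z∈C z~v v∉Y = left , right
            where
            z∈ = C⁻ z∈C
            left = [ inj₁ , [ inj₂ , (λ v∈R → contradiction (_ , proj₁ z∈ , z~v) (proj₂ (proj₂ (proj₂ (Rest⁻ v∈R))))) ]′ ]′
                     (trichotomy (~-∈V z~v) v∉Y)
            right = [ inj₁ , [ (λ v∈B → contradiction z~v (no-edge (proj₂ z∈) v∈B)) , inj₂ ]′ ]′
                      (classify (~-∈V z~v) v∉Y)

          near′ : ∀ {z v} → z ∈ C′ → z ~ v → v ∉ Y → (v ∈ R ⊎ v ∈ ∂ Y D) × (v ∈ B ⊎ v ∈ S ▷ x)
          near′ {z} z∈C′ z~v v∉Y = left , right
            where
            z∈ = C′⁻ z∈C′
            left = [ (λ v∈D → contradiction (_ , v∈D , ~-sym z~v) (proj₂ (proj₂ (proj₂ (Rest⁻ (proj₁ z∈))))))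
                   , [ inj₂ , inj₁ ]′ ]′ (trichotomy (~-∈V z~v) v∉Y)
            right = [ (λ v∈A → contradiction (~-sym z~v) (no-edge v∈A (proj₂ z∈))) , [ inj₁ , inj₂ ]′ ]′
                      (classify (~-∈V z~v) v∉Y)

          ∂C⊆ : ∀ {v} → v ∈ ∂ Y C → v ∈ ∂ Y D ⊎ v ∈ S ▷ x
          ∂C⊆ v∈ with ∂⁻ v∈
          ... | v∉Y , v∉C , z , z∈C , z~v with near z∈C z~v v∉Y
          ...   | inj₂ v∈∂ , _         = inj₁ v∈∂
          ...   | inj₁ _   , inj₂ v∈S  = inj₂ v∈S
          ...   | inj₁ v∈D , inj₁ v∈A  = contradiction (x∈p∩q⁺ (v∈D , v∈A)) v∉C

          ∂C′⊆ : ∀ {v} → v ∈ ∂ Y C′ → v ∈ ∂ Y D ⊎ v ∈ S ▷ x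
          ∂C′⊆ v∈ with ∂⁻ v∈
          ... | v∉Y , v∉C , z , z∈C , z~v with near′ z∈C z~v v∉Y
          ...   | inj₂ v∈∂ , _         = inj₁ v∈∂
          ...   | inj₁ _   , inj₂ v∈S  = inj₂ v∈S
          ...   | inj₁ v∈R , inj₁ v∈B  = contradiction (x∈p∩q⁺ (v∈R , v∈B)) v∉C

          ∂C∩∂C′ : ∀ {v} → v ∈ ∂ Y C → v ∈ ∂ Y C′ → v ∈ ∂ Y D × v ∈ S ▷ x
          ∂C∩∂C′ v∈ v∈′ with ∂⁻ v∈ | ∂⁻ v∈′
          ... | v∉Y , _ , z , z∈C , z~v | _ , _ , z′ , z′∈C′ , z′~v
            with near z∈C z~v v∉Y | near′ z′∈C′ z′~v v∉Y
          ...   | a , b | c , d = left a c , right b d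
            where
            left : ∀ {v} → v ∈ D ⊎ v ∈ ∂ Y D → v ∈ R ⊎ v ∈ ∂ Y D → v ∈ ∂ Y D
            left (inj₂ v∈∂) _          = v∈∂
            left (inj₁ _)   (inj₂ v∈∂) = v∈∂
            left (inj₁ v∈D) (inj₁ v∈R) = contradiction v∈R (D∩R v∈D)
            right : ∀ {v} → v ∈ A ⊎ v ∈ S ▷ x → v ∈ B ⊎ v ∈ S ▷ x → v ∈ S ▷ x
            right (inj₂ v∈S) _          = v∈S
            right (inj₁ _)   (inj₂ v∈S) = v∈S
            right (inj₁ v∈A) (inj₁ v∈B) = contradiction v∈B (disjoint v∈A)

          x∉∂C′ : x ∉ ∂ Y C′
          x∉∂C′ x∈ with ∂⁻ x∈
          ... | x∉Y , _ , z , z∈C′ , z~x with proj₁ (near′ z∈C′ z~x x∉Y)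
          ...   | inj₁ x∈R = D∩R x∈D x∈R
          ...   | inj₂ x∈∂ = D∩∂ x∈D x∈∂

          drop-x : ∀ {v} → v ≢ x → v ∈ ∂ Y D ⊎ v ∈ S ▷ x → v ∈ ∂ Y D ⊎ v ∈ S
          drop-x v≢x (inj₁ v∈∂) = inj₁ v∈∂
          drop-x v≢x (inj₂ v∈S) = [ inj₂ , (λ v≡x → contradiction v≡x v≢x) ]′ (∈▷⁻ v∈S)

          module _ (S<k : ∣ S ∣ < k) (C≢∅ : Nonempty C) (C′≢∅ : Nonempty C′) where
            k≤∂C : k ≤ ∣ ∂ Y C ∣
            k≤∂C = linked C (D⊆U ∘ proj₁ ∘ C⁻) C≢∅
              (_ , Rest-anti (proj₁ ∘ C⁻) (proj₁ (C′⁻ (proj₂ C′≢∅))))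

            k≤∂C′ : k ≤ ∣ ∂ Y C′ ∣
            k≤∂C′ = linked C′ (λ v∈ → let (a , b , _) = Rest⁻ (proj₁ (C′⁻ v∈)) in x∈p∧x∉q⇒x∈p─q a b) C′≢∅
              (c , Rest⁺ (proj₁ c∈U) (proj₂ c∈U) (λ c∈C′ → D∩R c∈D (proj₁ (C′⁻ c∈C′)))
                λ (z , z∈C′ , z~c) → proj₂ (proj₂ (proj₂ (Rest⁻ (proj₁ (C′⁻ z∈C′))))) (c , c∈D , ~-sym z~c))
              where
              c   = proj₁ C≢∅
              c∈D = proj₁ (C⁻ (proj₂ C≢∅))
              c∈U = ∈─⁻ (D⊆U c∈D)

            -- By submodularity the two corners have at most k + k outer neighbours together, and
            -- linkedness reserves k of them for `C′`.
            ∂C≤k : ∣ ∂ Y C ∣ ≤ k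
            ∂C≤k = +-cancelʳ-≤ k ∣ ∂ Y C ∣ k (begin
              ∣ ∂ Y C ∣ + k             ≤⟨ +-monoʳ-≤ ∣ ∂ Y C ∣ k≤∂C′ ⟩
              ∣ ∂ Y C ∣ + ∣ ∂ Y C′ ∣    ≤⟨ uncross (∂ Y C) (∂ Y C′) (∂ Y D) (S ▷ x) ∂C⊆ ∂C′⊆ ∂C∩∂C′ ⟩
              ∣ ∂ Y D ∣ + ∣ S ▷ x ∣     ≤⟨ +-mono-≤ ∂D≤ (S▷x≤ S<k) ⟩
              k + k                     ∎)
              where open ≤-Reasoning

            -- As `x` lies in `D`, it is not in `∂ Y C′`. If `∂ Y C` avoided it too, the uncrossing
            -- would work with `S` in place of `S ▷ x` and leave fewer than k + k outer neighbours
            -- for two corners that need k each.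
            x∈∂C : x ∈ ∂ Y C
            x∈∂C with x ∈? ∂ Y C
            ... | yes x∈ = x∈
            ... | no  x∉ = contradiction (begin-strict
              ∣ ∂ Y C ∣ + ∣ ∂ Y C′ ∣    ≤⟨ uncross (∂ Y C) (∂ Y C′) (∂ Y D) S
                                             (λ v∈ → drop-x (≢x v∈) (∂C⊆ v∈))
                                             (λ v∈ → drop-x (λ { refl → x∉∂C′ v∈ }) (∂C′⊆ v∈))
                                             (λ v∈ v∈′ → let (a , b) = ∂C∩∂C′ v∈ v∈′ in
                                               a , [ (λ v∈S → v∈S) , (λ v≡x → contradiction v≡x (≢x v∈)) ]′ (∈▷⁻ b)) ⟩
              ∣ ∂ Y D ∣ + ∣ S ∣         <⟨ +-mono-≤-< ∂D≤ S<k ⟩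
              k + k                     ≤⟨ +-mono-≤ k≤∂C k≤∂C′ ⟩
              ∣ ∂ Y C ∣ + ∣ ∂ Y C′ ∣    ∎) (n≮n _)
              where
              open ≤-Reasoning
              ≢x : ∀ {v} → v ∈ ∂ Y C → v ≢ x
              ≢x v∈ refl = x∉ v∈

            -- A neighbour of `x` in `C` has degree above k, hence a neighbour inside `C`; the two
            -- disjoint neighbourhoods have to fit into `C` and its at most k outer neighbours.
            k<C : k < ∣ C ∣
            k<C = surplus {a = deg Y z} {deg Y z′} {∣ C ∣} {∣ ∂ Y C ∣} k<deg
              (deg≥ (proj₁ (C⁻ z′∈C))) (edge-degrees Y C (∂ Y C) z~z′ (N─⊆ z∈C) (N─⊆ z′∈C)) ∂C≤k
              where
              C≈x   = proj₂ (proj₂ (∂⁻ {Y} {C} x∈∂C))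
              z     = proj₁ C≈x
              z∈C   = proj₁ (proj₂ C≈x)
              k<deg : k < deg Y z
              k<deg = deg> (proj₁ (C⁻ z∈C)) (proj₂ (proj₂ C≈x))
              inner = inner-neighbour Y C (∂ Y C) {z} (N─⊆ z∈C) (≤-<-trans ∂C≤k k<deg)
              z′    = proj₁ inner
              z′∈C  = proj₁ (proj₂ inner)
              z~z′  = proj₁ (proj₂ (proj₂ inner))

            pieceC : Piece k Y C
            pieceC = D⊆U ∘ proj₁ ∘ C⁻ , k<C , ∂C≤k , inj₂ (rest (proj₂ (proj₂ (proj₂ (proj₁ minD)))))
              where
              rest : U Y ⊆ D ⊎ k ≤ ∣ R ∣ → k ≤ ∣ Rest Y C ∣
              rest (inj₂ k≤R) = ≤-trans k≤R (p⊆q⇒∣p∣≤∣q∣ (Rest-anti {Y} {D} {C} (proj₁ ∘ C⁻)))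
              rest (inj₁ U⊆D) = let (a , b , c , _) = Rest⁻ (proj₁ (C′⁻ (proj₂ C′≢∅))) in
                contradiction (U⊆D (x∈p∧x∉q⇒x∈p─q a b)) c

        corner : ∣ S ∣ < k → Nonempty (D ∩ A) → Nonempty (R ∩ B) → Empty.⊥
        corner S<k C≢∅ C′≢∅ =
          x∉A (proj₂ (C⁻ (proj₂ minD (D ∩ A) (pieceC S<k C≢∅ C′≢∅) (proj₁ ∘ C⁻) x∈D)))

        A─Y⊆U : A ─ Y ⊆ U Y
        A─Y⊆U v∈ = let (a , b) = ∈─⁻ v∈ in x∈p∧x∉q⇒x∈p─q (proj₁ (∈─⁻ (A⊆U a))) b

        -- Here `R` is empty and there is nothing to cross with. Instead the side `A ─ Y` is itself
        -- a smaller piece; `sides` is used for `A` as its size and for `B` as the size of its rest.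
        full : ∣ S ∣ < k → U Y ⊆ D → Empty.⊥
        full S<k U⊆D = x∉A (proj₁ (∈─⁻ (proj₂ minD (A ─ Y) piece (U⊆D ∘ A─Y⊆U) x∈D)))
          where
          ∂⊆ : ∂ Y (A ─ Y) ⊆ S ▷ x
          ∂⊆ v∈ with ∂⁻ v∈
          ... | v∉Y , v∉A , a , a∈A , a~v with classify (~-∈V a~v) v∉Y
          ...   | inj₁ v∈A        = contradiction (x∈p∧x∉q⇒x∈p─q v∈A v∉Y) v∉A
          ...   | inj₂ (inj₁ v∈B) = contradiction a~v (no-edge (proj₁ (∈─⁻ a∈A)) v∈B)
          ...   | inj₂ (inj₂ v∈S) = v∈S
          B⊆R : B ─ Y ⊆ Rest Y (A ─ Y)
          B⊆R v∈ = let (v∈B , v∉Y) = ∈─⁻ v∈ in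
            Rest⁺ (proj₁ (∈─⁻ (B⊆U v∈B))) v∉Y (λ v∈A → disjoint (proj₁ (∈─⁻ v∈A)) v∈B)
              λ (a , a∈A , a~v) → no-edge (proj₁ (∈─⁻ a∈A)) v∈B a~v
          piece : Piece k Y (A ─ Y)
          piece = A─Y⊆U , sides sep S<k , ≤-trans (p⊆q⇒∣p∣≤∣q∣ ∂⊆) (S▷x≤ S<k)
                , inj₂ (≤-trans (<⇒≤ (sides (flip sep) S<k)) (p⊆q⇒∣p∣≤∣q∣ B⊆R))

        D⊈S▷x : ∣ S ∣ < k → ¬ Nonempty (D ∩ A) → ¬ Nonempty (D ∩ B) → Empty.⊥
        D⊈S▷x S<k DA DB = <⇒≱ k<D (≤-trans (p⊆q⇒∣p∣≤∣q∣ D⊆) (S▷x≤ S<k))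
          where
          D⊆ : D ⊆ S ▷ x
          D⊆ v∈D with classify (proj₁ (∈─⁻ (D⊆U v∈D))) (proj₂ (∈─⁻ (D⊆U v∈D)))
          ... | inj₁ v∈A        = contradiction (_ , x∈p∩q⁺ (v∈D , v∈A)) DA
          ... | inj₂ (inj₁ v∈B) = contradiction (_ , x∈p∩q⁺ (v∈D , v∈B)) DB
          ... | inj₂ (inj₂ v∈S) = v∈S

        R⊈S : ∣ S ∣ < k → k ≤ ∣ R ∣ → ¬ Nonempty (R ∩ A) → ¬ Nonempty (R ∩ B) → Empty.⊥
        R⊈S S<k k≤R RA RB = <⇒≱ S<k (≤-trans k≤R (p⊆q⇒∣p∣≤∣q∣ R⊆))
          where
          R⊆ : R ⊆ S
          R⊆ v∈R with classify (proj₁ (Rest⁻ v∈R)) (proj₁ (proj₂ (Rest⁻ v∈R)))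
          ... | inj₁ v∈A        = contradiction (_ , x∈p∩q⁺ (v∈R , v∈A)) RA
          ... | inj₂ (inj₁ v∈B) = contradiction (_ , x∈p∩q⁺ (v∈R , v∈B)) RB
          ... | inj₂ (inj₂ v∈S) = [ (λ v∈S → v∈S) , (λ { refl → contradiction v∈R (D∩R x∈D) }) ]′ (∈▷⁻ v∈S)

        A⊈∂D : ∣ S ∣ < k → ¬ Nonempty (D ∩ A) → ¬ Nonempty (R ∩ A) → Empty.⊥
        A⊈∂D S<k DA RA = <⇒≱ (sides sep S<k) (≤-trans (p⊆q⇒∣p∣≤∣q∣ A⊆) ∂D≤)
          where
          A⊆ : A ─ Y ⊆ ∂ Y D
          A⊆ v∈ with ∈─⁻ v∈
          ... | v∈A , v∉Y with trichotomy {Y} {D} (proj₁ (∈─⁻ (A⊆U v∈A))) v∉Y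
          ...   | inj₁ v∈D        = contradiction (_ , x∈p∩q⁺ (v∈D , v∈A)) DA
          ...   | inj₂ (inj₁ v∈∂) = v∈∂
          ...   | inj₂ (inj₂ v∈R) = contradiction (_ , x∈p∩q⁺ (v∈R , v∈A)) RA

      -- If no two opposite corners are both nonempty, then one of `D`, `R`, `A`, `B` has both its
      -- corners empty, so that it lies, up to `Y`, in a separator too small to contain it.
      no-separation : ∀ {A B S} → Separation (Y⁻ ▷ x) A B S → ∣ S ∣ < k → Empty.⊥
      no-separation {A} {B} sep S<k with proj₂ (proj₂ (proj₂ (proj₁ minD)))
      ... | inj₁ U⊆D = full sep S<k U⊆D
      ... | inj₂ k≤R with nonempty? (D ∩ A) | nonempty? (D ∩ B) | nonempty? (R ∩ A) | nonempty? (R ∩ B)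
      ...   | yes DA | _      | _      | yes RB = corner sep S<k DA RB
      ...   | _      | yes DB | yes RA | _      = corner (flip sep) S<k DB RA
      ...   | no DA  | no DB  | _      | _      = D⊈S▷x sep S<k DA DB
      ...   | no DA  | yes _  | no RA  | _      = A⊈∂D sep S<k DA RA
      ...   | yes _  | no DB  | _      | no RB  = A⊈∂D (flip sep) S<k DB RB
      ...   | yes _  | yes _  | no RA  | no RB  = R⊈S sep S<k k≤R RA RB

    removable : k -LinkedOff (Y⁻ ▷ x)
    removable = linked⁺ λ {_} {_} {S} sep → ≮⇒≥ (no-separation sep)

  -- Removing, exchanging and restoring single vertices

  side-closed : ∀ {Y A B S} → Separation Y A B S → ∀ {a v} → a ∈ A → v ∈ N G a ─ Y → v ∈ A ⊎ v ∈ S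
  side-closed sep a∈A v∈ with ∈─⁻ v∈
  ... | a~v , v∉Y with Separation.cover sep (x∈p∧x∉q⇒x∈p─q (~-∈V a~v) v∉Y)
  ...   | inj₁ v∈A        = inj₁ v∈A
  ...   | inj₂ (inj₁ v∈B) = contradiction a~v (Separation.no-edge sep a∈A v∈B)
  ...   | inj₂ (inj₂ v∈S) = inj₂ v∈S

  side-closed▷ : ∀ {Y x A B S} → Separation (Y ▷ x) A B S → ∀ {a v} → a ∈ A → v ∈ N G a ─ Y →
                 v ∈ A ⊎ v ∈ S ▷ x
  side-closed▷ {x = x} sep {v = v} a∈A v∈ with v ≟ᶠ x
  ... | yes refl = inj₂ (∈▷ʳ x)
  ... | no  v≢x  = let (a~v , v∉Y) = ∈─⁻ v∈ in
    [ inj₁ , inj₂ ∘ ∈▷ˡ ]′ (side-closed sep a∈A (x∈p∧x∉q⇒x∈p─q a~v (∉▷ v∉Y v≢x)))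

  side-avoids : ∀ {Y x A B S} → Separation (Y ▷ x) A B S → ∀ {a} → a ∈ A → a ∈ U Y
  side-avoids sep a∈A = let (a∈V , a∉) = ∈─⁻ (Separation.A⊆U sep a∈A) in
    x∈p∧x∉q⇒x∈p─q a∈V (a∉ ∘ ∈▷ˡ)

  side∌x : ∀ {Y x A B S} → Separation (Y ▷ x) A B S → x ∉ A
  side∌x {x = x} sep x∈A = proj₂ (∈─⁻ (Separation.A⊆U sep x∈A)) (∈▷ʳ x)

  -- Otherwise `x` could join the side `B`, and `S` alone would separate G - Y.
  side≈x : ∀ {Y x A B S} → k -LinkedOff Y → Separation (Y ▷ x) A B S → x ∈ V G → x ∉ Y → ∣ S ∣ < k → A ≈ x
  side≈x {Y} {x} {A} {B} {S} linked sep x∈V x∉Y S<k with A ≈? x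
  ... | yes A≈x = A≈x
  ... | no  A≉x = contradiction (linked⁻ linked sep′) (<⇒≱ S<k)
    where
    open Separation sep
    sep′ : Separation Y A (B ▷ x) S
    sep′ = record
      { A⊆U = side-avoids sep
      ; B⊆U = λ v∈ → [ side-avoids (flip sep) , (λ { refl → x∈p∧x∉q⇒x∈p─q x∈V x∉Y }) ]′ (∈▷⁻ v∈)
      ; A≢∅ = A≢∅
      ; B≢∅ = x , ∈▷ʳ x
      ; disjoint = λ v∈A v∈ → [ disjoint v∈A , (λ { refl → side∌x sep v∈A }) ]′ (∈▷⁻ v∈)
      ; no-edge = λ a∈A v∈ a~v → [ (λ v∈B → no-edge a∈A v∈B a~v) , (λ { refl → A≉x (_ , a∈A , a~v) }) ]′ (∈▷⁻ v∈)
      ; cover = cover′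
      }
      where
      cover′ : ∀ {v} → v ∈ U Y → v ∈ A ⊎ v ∈ B ▷ x ⊎ v ∈ S
      cover′ {v} v∈U with v ≟ᶠ x
      ... | yes refl = inj₂ (inj₁ (∈▷ʳ x))
      ... | no  v≢x  = let (v∈V , v∉Y) = ∈─⁻ v∈U in
        [ inj₁ , [ inj₂ ∘ inj₁ ∘ ∈▷ˡ , inj₂ ∘ inj₂ ]′ ]′ (cover (x∈p∧x∉q⇒x∈p─q v∈V (∉▷ v∉Y v≢x)))

  -- The degrees exceed ∣S∣, so there is an edge inside `A`; its ends have 2k + 2 distinct
  -- neighbours, of which at most k are in `S`.
  closed-size : ∀ Y A S → (∀ {z v} → z ∈ A → v ∈ N G z ─ Y → v ∈ A ⊎ v ∈ S) → ∣ S ∣ ≤ k →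
                (∀ {z} → z ∈ A → k < deg Y z) → Nonempty A → suc k < ∣ A ∣
  closed-size Y A S closed S≤k deg> (z , z∈A)
    with inner-neighbour Y A S (closed z∈A) (≤-<-trans S≤k (deg> z∈A))
  ... | z′ , z′∈A , z~z′ , _ = +-cancelʳ-≤ k (2 + k) ∣ A ∣ (begin
      2 + k + k             ≡⟨ cong suc (+-suc k k) ⟨
      suc k + suc k         ≤⟨ +-mono-≤ (deg> z∈A) (deg> z′∈A) ⟩
      deg Y z + deg Y z′    ≤⟨ edge-degrees Y A S z~z′ (closed z∈A) (closed z′∈A) ⟩
      ∣ A ∣ + ∣ S ∣         ≤⟨ +-monoʳ-≤ ∣ A ∣ S≤k ⟩
      ∣ A ∣ + k             ∎)
      where open ≤-Reasoning

  -- Only neighbours of `x` are known to have degree above k, so the size of a side is obtained from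
  -- an edge at a neighbour of `x` in it: k + 1 and k neighbours, at most k of them in `S ▷ x`.
  remove : ∀ {Y D x} → k -LinkedOff Y → MinPiece k Y D → x ∈ D →
           (∀ {z} → z ∈ U Y → k ≤ deg Y z) → (∀ {z} → z ∈ U Y → z ~ x → k < deg Y z) →
           k -LinkedOff (Y ▷ x)
  remove {Y} {D} {x} linked minD x∈D deg≥ deg> =
    removable id linked minD x∈D (deg≥ ∘ D⊆U) (deg> ∘ D⊆U) sides
    where
    D⊆U = proj₁ (proj₁ minD)
    sides : ∀ {A B S} → Separation (Y ▷ x) A B S → ∣ S ∣ < k → k < ∣ A ─ Y ∣
    sides {A} {B} {S} sep S<k
      with side≈x linked sep (proj₁ (∈─⁻ (D⊆U x∈D))) (proj₂ (∈─⁻ (D⊆U x∈D))) S<k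
    ... | a , a∈A , a~x
      with inner-neighbour Y A (S ▷ x) (side-closed▷ sep a∈A)
             (≤-<-trans (≤-trans (∣Y▷x∣≤ S x) S<k) (deg> (side-avoids sep a∈A) a~x))
    ...   | a′ , a′∈A , a~a′ , _ = ≤-trans (+-cancelʳ-≤ k (suc k) ∣ A ∣ (begin
      suc k + k             ≤⟨ +-mono-≤ (deg> (side-avoids sep a∈A) a~x) (deg≥ (side-avoids sep a′∈A)) ⟩
      deg Y a + deg Y a′    ≤⟨ edge-degrees Y A (S ▷ x) a~a′ (side-closed▷ sep a∈A) (side-closed▷ sep a′∈A) ⟩
      ∣ A ∣ + ∣ S ▷ x ∣     ≤⟨ +-monoʳ-≤ ∣ A ∣ (≤-trans (∣Y▷x∣≤ S x) S<k) ⟩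
      ∣ A ∣ + k             ∎))
      (p⊆q⇒∣p∣≤∣q∣ λ v∈A → x∈p∧x∉q⇒x∈p─q v∈A (proj₂ (∈─⁻ (side-avoids sep v∈A))))
      where open ≤-Reasoning

  -- While x is removed, e is returned: in G - Y⁻ the degrees exceed k, but in G - Y
  -- they need to do so only at the neighbours of x in D.
  exchange : ∀ {Y⁻ Y D e x} → Y⁻ ⊆ Y → (∀ {v} → v ∈ Y → v ∈ Y⁻ ⊎ v ≡ e) →
             k -LinkedOff Y → MinPiece k Y D → x ∈ D →
             (∀ {z} → z ∈ D → k ≤ deg Y z) → (∀ {z} → z ∈ D → z ~ x → k < deg Y z) →
             (∀ {z} → z ∈ U Y⁻ → k < deg Y⁻ z) → k -LinkedOff (Y⁻ ▷ x)
  exchange {Y⁻} {Y} {D} {e} {x} Y⁻⊆Y Y⊆ linked minD x∈D deg≥ deg> deg⁻> =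
    removable Y⁻⊆Y linked minD x∈D deg≥ deg> sides
    where
    sides : ∀ {A B S} → Separation (Y⁻ ▷ x) A B S → ∣ S ∣ < k → k < ∣ A ─ Y ∣
    -- In G - Y⁻ the side has k + 2 vertices, and passing to G - Y loses at most `e`.
    sides {A} {B} {S} sep S<k = s≤s⁻¹ (≤-trans
      (closed-size Y⁻ A (S ▷ x) (side-closed▷ sep) (≤-trans (∣Y▷x∣≤ S x) S<k)
        (λ a∈A → deg⁻> (side-avoids sep a∈A)) (Separation.A≢∅ sep))
      (∣p∣≤1+∣q∣ A (A ─ Y) e λ v∈A v≢e → x∈p∧x∉q⇒x∈p─q v∈A
        λ v∈Y → [ proj₂ (∈─⁻ (side-avoids sep v∈A)) , v≢e ]′ (Y⊆ v∈Y)))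

  -- A separation of G - Y either survives the deletion of `v`, or has `v` as the only vertex of a
  -- side; then all neighbours of `v` lie in `S`.
  restore : ∀ {Y v} → k -LinkedOff (Y ▷ v) → k ≤ deg Y v → k -LinkedOff Y
  restore {Y} {v} linked k≤deg = linked⁺ bound
    where
    lonely : ∀ {A B S} → Separation Y A B S → ¬ Nonempty (A ─ ⁅ v ⁆) → k ≤ ∣ S ∣
    lonely {A} {B} {S} sep none = ≤-trans (≤-trans k≤deg (≤-reflexive (deg≡ Y v))) (p⊆q⇒∣p∣≤∣q∣ N⊆S)
      where
      ≡v : ∀ {a} → a ∈ A → a ≡ v
      ≡v {a} a∈A with a ≟ᶠ v
      ... | yes a≡v = a≡v
      ... | no  a≢v = contradiction (a , x∈p∧x∉q⇒x∈p─q a∈A (a≢v ∘ x∈⁅y⁆⇒x≡y v)) none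
      v∈A : v ∈ A
      v∈A with Separation.A≢∅ sep
      ... | a , a∈A = subst (_∈ A) (≡v a∈A) a∈A
      N⊆S : N G v ─ Y ⊆ S
      N⊆S w∈ with side-closed sep v∈A w∈
      ... | inj₂ w∈S = w∈S
      ... | inj₁ w∈A with refl ← ≡v w∈A = contradiction (proj₁ (∈─⁻ w∈)) (N-irrefl G v)

    bound : ∀ {A B S} → Separation Y A B S → k ≤ ∣ S ∣
    bound {A} {B} {S} sep with nonempty? (A ─ ⁅ v ⁆) | nonempty? (B ─ ⁅ v ⁆)
    ... | no none | _       = lonely sep none
    ... | _       | no none = lonely (flip sep) none
    ... | yes A≢∅ | yes B≢∅ = linked⁻ linked (record
      { A⊆U = λ w∈ → shrink (A⊆U (proj₁ (∈─⁻ w∈))) (proj₂ (∈─⁻ w∈))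
      ; B⊆U = λ w∈ → shrink (B⊆U (proj₁ (∈─⁻ w∈))) (proj₂ (∈─⁻ w∈))
      ; A≢∅ = A≢∅ ; B≢∅ = B≢∅
      ; disjoint = λ w∈A w∈B → disjoint (proj₁ (∈─⁻ w∈A)) (proj₁ (∈─⁻ w∈B))
      ; no-edge  = λ a∈A b∈B → no-edge (proj₁ (∈─⁻ a∈A)) (proj₁ (∈─⁻ b∈B))
      ; cover    = λ w∈ → let (w∈V , w∉) = ∈─⁻ w∈
                              w∉v = λ w∈v → w∉ (subst (_∈ Y ▷ v) (sym (x∈⁅y⁆⇒x≡y v w∈v)) (∈▷ʳ v)) in
                   [ (λ w∈A → inj₁ (x∈p∧x∉q⇒x∈p─q w∈A w∉v))
                   , [ (λ w∈B → inj₂ (inj₁ (x∈p∧x∉q⇒x∈p─q w∈B w∉v))) , inj₂ ∘ inj₂ ]′ ]′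
                   (cover (x∈p∧x∉q⇒x∈p─q w∈V (w∉ ∘ ∈▷ˡ)))
      })
      where
      open Separation sep hiding (A≢∅; B≢∅)
      shrink : ∀ {w} → w ∈ U Y → w ∉ ⁅ v ⁆ → w ∈ U (Y ▷ v)
      shrink w∈U w∉v = let (w∈V , w∉Y) = ∈─⁻ w∈U in
        x∈p∧x∉q⇒x∈p─q w∈V λ w∈ → [ w∉Y , (λ { refl → w∉v (x∈⁅x⁆ v) }) ]′ (∈▷⁻ w∈)

  -- The neighbourhoods of `x` and of a neighbour of it in `D` take 2k + 2 places, at most k of them
  -- outside `D`. The bound is one more than a piece needs, so `D - x` is still large enough.
  piece-size : ∀ {Y D x} → Piece k Y D → x ∈ D → (∀ {z} → z ∈ D → z ~ x → k < deg Y z) → k < deg Y x →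
               D ≈ x × suc k < ∣ D ∣
  piece-size {Y} {D} {x} (_ , _ , ∂≤ , _) x∈D deg> k<deg
    with inner-neighbour Y D (∂ Y D) (N─⊆ x∈D) (≤-<-trans ∂≤ k<deg)
  ... | z , z∈D , x~z , _ = (z , z∈D , ~-sym x~z) , +-cancelʳ-≤ k (2 + k) ∣ D ∣ (begin
      2 + k + k             ≡⟨ cong suc (+-suc k k) ⟨
      suc k + suc k         ≤⟨ +-mono-≤ k<deg (deg> z∈D (~-sym x~z)) ⟩
      deg Y x + deg Y z     ≤⟨ edge-degrees Y D (∂ Y D) x~z (N─⊆ x∈D) (N─⊆ z∈D) ⟩
      ∣ D ∣ + ∣ ∂ Y D ∣     ≤⟨ +-monoʳ-≤ ∣ D ∣ ∂≤ ⟩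
      ∣ D ∣ + k             ∎)
      where open ≤-Reasoning

  -- Nesting: a minimal piece D₁ inside D - x is adjacent to x, since otherwise it
  -- would have been a piece before the removal of x.
  nest : ∀ {Y D x} → MinPiece k Y D → x ∈ D → D ≈ x → suc k < ∣ D ∣ →
         ∃[ D₁ ] D₁ ⊆ D × x ∉ D₁ × D₁ ≈ x × MinPiece k (Y ▷ x) D₁
  nest {Y} {D} {x} ((D⊆U , k<D , ∂≤ , size) , min) x∈D (d , d∈D , d~x) k+1<D
    with minPiece k {Y ▷ x} {D - x} piece
    where
    D-x⊆ : ∀ {v} → v ∈ D - x → v ∈ D × v ≢ x
    D-x⊆ v∈ = let (v∈D , v∉) = ∈─⁻ v∈ in v∈D , λ { refl → v∉ (x∈⁅x⁆ x) }
    D-x⁺ : ∀ {v} → v ∈ D → v ≢ x → v ∈ D - x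
    D-x⁺ v∈D v≢x = x∈p∧x∉q⇒x∈p─q v∈D (v≢x ∘ x∈⁅y⁆⇒x≡y x)
    ∂⊆ : ∂ (Y ▷ x) (D - x) ⊆ ∂ Y D
    ∂⊆ v∈ with ∂⁻ v∈
    ... | v∉ , v∉D , a , a∈D , a~v =
      ∂⁺ (v∉ ∘ ∈▷ˡ) (λ v∈D → v∉D (D-x⁺ v∈D λ { refl → v∉ (∈▷ʳ x) })) (proj₁ (D-x⊆ a∈D)) a~v
    R⊆ : Rest Y D ⊆ Rest (Y ▷ x) (D - x)
    R⊆ v∈ = let (a , b , c , e) = Rest⁻ v∈ in
      Rest⁺ a (∉▷ b λ { refl → c x∈D }) (c ∘ proj₁ ∘ D-x⊆) λ (z , z∈ , z~v) → e (z , proj₁ (D-x⊆ z∈) , z~v)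
    size′ : U Y ⊆ D ⊎ k ≤ ∣ Rest Y D ∣ → U (Y ▷ x) ⊆ D - x ⊎ k ≤ ∣ Rest (Y ▷ x) (D - x) ∣
    size′ (inj₂ k≤R) = inj₂ (≤-trans k≤R (p⊆q⇒∣p∣≤∣q∣ R⊆))
    size′ (inj₁ U⊆D) = inj₁ λ v∈ → let (v∈V , v∉) = ∈─⁻ v∈ in
      D-x⁺ (U⊆D (x∈p∧x∉q⇒x∈p─q v∈V (v∉ ∘ ∈▷ˡ))) λ { refl → v∉ (∈▷ʳ x) }
    piece : Piece k (Y ▷ x) (D - x)
    piece = (λ v∈ → let (v∈D , v≢x) = D-x⊆ v∈ ; (v∈V , v∉Y) = ∈─⁻ (D⊆U v∈D) in x∈p∧x∉q⇒x∈p─q v∈V (∉▷ v∉Y v≢x))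
          , s≤s⁻¹ (≤-trans k+1<D (∣p∣≤1+∣q∣ D (D - x) x D-x⁺))
          , ≤-trans (p⊆q⇒∣p∣≤∣q∣ ∂⊆) ∂≤
          , size′ size
  ... | D₁ , D₁⊆ , min₁@((D₁⊆U , k<D₁ , ∂₁≤ , size₁) , _) = D₁ , D₁⊆D , x∉D₁ , D₁≈x , min₁
    where
    D₁⊆D : D₁ ⊆ D
    D₁⊆D = p─q⊆p D ⁅ x ⁆ ∘ D₁⊆
    x∉D₁ : x ∉ D₁
    x∉D₁ x∈ = proj₂ (∈─⁻ (D₁⊆ x∈)) (x∈⁅x⁆ x)
    D₁≈x : D₁ ≈ x
    D₁≈x with D₁ ≈? x
    ... | yes D₁≈x = D₁≈x
    ... | no  D₁≉x = contradiction (min D₁ piece₁ D₁⊆D x∈D) x∉D₁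
      where
      ∂⊆ : ∂ Y D₁ ⊆ ∂ (Y ▷ x) D₁
      ∂⊆ v∈ with ∂⁻ v∈
      ... | v∉Y , v∉D , a , a∈D , a~v = ∂⁺ (∉▷ v∉Y λ { refl → D₁≉x (a , a∈D , a~v) }) v∉D a∈D a~v
      R⊆ : Rest (Y ▷ x) D₁ ⊆ Rest Y D₁
      R⊆ v∈ = let (a , b , c , e) = Rest⁻ v∈ in Rest⁺ a (b ∘ ∈▷ˡ) c e
      size′ : U (Y ▷ x) ⊆ D₁ ⊎ k ≤ ∣ Rest (Y ▷ x) D₁ ∣ → k ≤ ∣ Rest Y D₁ ∣
      size′ (inj₂ k≤R)  = ≤-trans k≤R (p⊆q⇒∣p∣≤∣q∣ R⊆)
      size′ (inj₁ U⊆D₁) = contradiction (d , U⊆D₁ (x∈p∧x∉q⇒x∈p─q (proj₁ (∈─⁻ (D⊆U d∈D)))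
        (∉▷ (proj₂ (∈─⁻ (D⊆U d∈D))) λ { refl → N-irrefl G d d~x })) , d~x) D₁≉x
      piece₁ : Piece k Y D₁
      piece₁ = D⊆U ∘ D₁⊆D , k<D₁ , ≤-trans (p⊆q⇒∣p∣≤∣q∣ ∂⊆) ∂₁≤
        , inj₂ (size′ size₁)

  -- A vertex not adjacent to `D` joins the rest and leaves the outer neighbours as they are. The
  -- alternative p ∈ Y is for the first slide, where `p` is `e` and remains removed. A neighbour of
  -- `p` that is still present shows that `D` was not everything, hence that its rest has k
  -- vertices.
  restore-min : ∀ {Y p D} → p ∈ Y ⊎ ¬ (D ≈ p) → p ∈ V G → 0 < deg (Y ▷ p) p →
                MinPiece k (Y ▷ p) D → MinPiece k Y D
  restore-min {Y} {p} {D} hole p∈V 0<deg minD with p ∈? Y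
  ... | yes p∈Y = subst (λ Z → MinPiece k Z D)
    (⊆-antisym (λ v∈ → [ id , (λ { refl → p∈Y }) ]′ (∈▷⁻ v∈)) ∈▷ˡ) minD
  ... | no  p∉Y = (D⊆U′ , k<D , ≤-trans (p⊆q⇒∣p∣≤∣q∣ ∂⊆) ∂≤ , inj₂ (≤-trans k≤R (p⊆q⇒∣p∣≤∣q∣ (R⊆ {D})))) , min′
    where
    D⊆U = proj₁ (proj₁ minD)
    k<D = proj₁ (proj₂ (proj₁ minD))
    ∂≤  = proj₁ (proj₂ (proj₂ (proj₁ minD)))
    D≉p : ¬ (D ≈ p)
    D≉p = [ (λ p∈Y → contradiction p∈Y p∉Y) , id ]′ hole
    D⊆U′ : D ⊆ U Y
    D⊆U′ v∈ = let (v∈V , v∉) = ∈─⁻ (D⊆U v∈) in x∈p∧x∉q⇒x∈p─q v∈V (v∉ ∘ ∈▷ˡ)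
    k≤R : k ≤ ∣ Rest (Y ▷ p) D ∣
    k≤R with proj₂ (proj₂ (proj₂ (proj₁ minD)))
    ... | inj₂ k≤R = k≤R
    ... | inj₁ U⊆D with 0<∣p∣⇒Nonempty (N G p ─ (Y ▷ p)) (subst (0 <_) (deg≡ (Y ▷ p) p) 0<deg)
    ...   | w , w∈ = let (p~w , w∉) = ∈─⁻ w∈ in
      contradiction (w , U⊆D (x∈p∧x∉q⇒x∈p─q (~-∈V p~w) w∉) , ~-sym p~w) D≉p
    ∂⊆ : ∂ Y D ⊆ ∂ (Y ▷ p) D
    ∂⊆ v∈ with ∂⁻ v∈
    ... | v∉Y , v∉D , a , a∈D , a~v = ∂⁺ (∉▷ v∉Y λ { refl → D≉p (a , a∈D , a~v) }) v∉D a∈D a~v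
    R⊆ : ∀ {A} → Rest (Y ▷ p) A ⊆ Rest Y A
    R⊆ v∈ = let (a , b , c , e) = Rest⁻ v∈ in Rest⁺ a (b ∘ ∈▷ˡ) c e
    min′ : ∀ D′ → Piece k Y D′ → D′ ⊆ D → D ⊆ D′
    min′ D′ (_ , k<D′ , ∂′≤ , _) D′⊆D = proj₂ minD D′
      ( D⊆U ∘ D′⊆D , k<D′
      , ≤-trans (p⊆q⇒∣p∣≤∣q∣ λ v∈ → let (v∉ , v∉D , a , a∈ , a~v) = ∂⁻ v∈ in ∂⁺ (v∉ ∘ ∈▷ˡ) v∉D a∈ a~v) ∂′≤
      , inj₂ (≤-trans k≤R (p⊆q⇒∣p∣≤∣q∣ (Rest-anti {Y ▷ p} {D} {D′} D′⊆D))) ) D′⊆D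

  connected⇒linked : k -Connected G → k -LinkedOff ⊥
  connected⇒linked (κ , (_ , min) , k≤κ) A A⊆U (a , a∈A) (r , r∈R) =
    ≤-trans k≤κ (min ∣ ∂ ⊥ A ∣ (∂ ⊥ A , (∂⊆V , inj₁ disconnected) , refl))
    where
    ∂⊆V : ∂ ⊥ A ⊆ V G
    ∂⊆V v∈ with ∂⁻ v∈
    ... | _ , _ , _ , _ , a~v = ~-∈V a~v
    disconnected : ¬ Connected (G ∖ ∂ ⊥ A)
    disconnected = splits⇒¬connected (G ∖ ∂ ⊥ A) {A}
      ( (a , x∈p∧x∉q⇒x∈p─q (proj₁ (∈─⁻ (A⊆U a∈A))) (λ a∈∂ → proj₁ (proj₂ (∂⁻ a∈∂)) a∈A) , a∈A)
      , (r , x∈p∧x∉q⇒x∈p─q (proj₁ (Rest⁻ r∈R)) (λ r∈∂ → proj₂ (proj₂ (proj₂ (Rest⁻ r∈R))) (proj₂ (proj₂ (∂⁻ r∈∂))))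
           , proj₁ (proj₂ (proj₂ (Rest⁻ r∈R))))
      , λ (x , x∈A , y , x~y , y∉A) → let (x~y′ , _ , y∉∂) = ∖-Adj-∉ G (∂ ⊥ A) x~y in
          y∉∂ (∂⁺ ∉⊥ y∉A x∈A x~y′) )

  -- The size bound is for the cuts that leave a single vertex.
  linked⇒connected : ∀ {Z} → k -LinkedOff Z → k < ∣ U Z ∣ → k -Connected (G ∖ Z)
  linked⇒connected {Z} linked k<U = proj₁ κ , proj₂ κ , lower (proj₁ (proj₂ κ))
    where
    H = G ∖ Z
    κ : ∃ (IsConnectivity H)
    κ = connectivity H (proj₂ (0<∣p∣⇒Nonempty (U Z) (≤-trans (s≤s z≤n) k<U)))

    split⇒k≤ : ∀ {S A} → Splits (H ∖ S) A → k ≤ ∣ S ∣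
    split⇒k≤ {S} {A} ((a , a∈V , a∈A) , (b , b∈V , b∉A) , closed) = linked⁻ {Z} linked record
      { A⊆U = λ v∈ → proj₁ (∈─⁻ (proj₁ (x∈p∩q⁻ (V (H ∖ S)) A v∈)))
      ; B⊆U = λ v∈ → proj₁ (∈─⁻ (proj₁ (∈─⁻ v∈)))
      ; A≢∅ = a , x∈p∩q⁺ (a∈V , a∈A)
      ; B≢∅ = b , x∈p∧x∉q⇒x∈p─q b∈V b∉A
      ; disjoint = λ v∈ v∈′ → proj₂ (∈─⁻ v∈′) (proj₂ (x∈p∩q⁻ (V (H ∖ S)) A v∈))
      ; no-edge = λ {x} {y} x∈ y∈ x~y →
          let (x∈V , x∈A) = x∈p∩q⁻ (V (H ∖ S)) A x∈
              (y∈V , y∉A) = ∈─⁻ y∈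
              (x∈H , x∉S) = ∈─⁻ x∈V
              (y∈H , y∉S) = ∈─⁻ y∈V
          in closed (x , x∈A , y , ∖-Adj⁺ H S x y (∖-Adj⁺ G Z x y x~y (proj₂ (∈─⁻ x∈H)) (proj₂ (∈─⁻ y∈H))) x∉S y∉S , y∉A)
      ; cover = cover
      }
      where
      cover : ∀ {v} → v ∈ U Z → v ∈ V (H ∖ S) ∩ A ⊎ v ∈ V (H ∖ S) ─ A ⊎ v ∈ S
      cover {v} v∈U with v ∈? S | v ∈? A
      ... | yes v∈S | _       = inj₂ (inj₂ v∈S)
      ... | no  v∉S | yes v∈A = inj₁ (x∈p∩q⁺ (x∈p∧x∉q⇒x∈p─q v∈U v∉S , v∈A))
      ... | no  v∉S | no  v∉A = inj₂ (inj₁ (x∈p∧x∉q⇒x∈p─q (x∈p∧x∉q⇒x∈p─q v∈U v∉S) v∉A))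

    lower : ∀ {c} → ∃[ S ] IsVertexCut H S × ∣ S ∣ ≡ c → k ≤ c
    lower (S , (_ , inj₁ disconnected) , refl) = decidable-stable (k ≤? ∣ S ∣)
      λ k≰S → disconnected (¬splits⇒connected (H ∖ S) λ A splits → k≰S (split⇒k≤ splits))
    lower (S , (_ , inj₂ trivial) , refl) = s≤s⁻¹ (begin
      suc k                       ≤⟨ k<U ⟩
      ∣ U Z ∣                     ≤⟨ ∣p∣≤∣q∣+∣r∣ (U Z) (U Z ─ S) S split ⟩
      ∣ U Z ─ S ∣ + ∣ S ∣         ≡⟨ cong (_+ ∣ S ∣) trivial ⟩
      suc ∣ S ∣                   ∎)
      where
      open ≤-Reasoning
      split : ∀ {v} → v ∈ U Z → v ∈ U Z ─ S ⊎ v ∈ S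
      split {v} v∈U with v ∈? S
      ... | yes v∈S = inj₂ v∈S
      ... | no  v∉S = inj₁ (x∈p∧x∉q⇒x∈p─q v∈U v∉S)

-- Fragments

-- Maximality is applied to the subgraph induced on `C` and `y`, which gives the edge as well as the
-- vertex: components are induced subgraphs.
component-closed : ∀ {n} {Q C : Graph n} → IsComponent Q C → ∀ {x y} → x ∈ V C → Adj Q x y → Adj C x y
component-closed {Q = Q} {C} comp {x} {y} x∈C x~y = proj₂ (maximal D D≤Q D-connected C≤D) x x~y′
  where
  open IsComponent comp
  W = V C ▷ y
  D = Q ∖ ∁ W
  D≤Q : D ≤ᴳ Q
  D≤Q = (λ v∈ → proj₁ (∈─⁻ v∈)) , λ u {v} u~v → ∖-Adj⁻ Q (∁ W) u v u~v
  adj : ∀ {u v} → u ∈ W → v ∈ W → Adj Q u v → Adj D u v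
  adj {u} {v} u∈ v∈ u~v = ∖-Adj⁺ Q (∁ W) u v u~v (x∈p⇒x∉∁p u∈) (x∈p⇒x∉∁p v∈)
  x~y′ : Adj D x y
  x~y′ = adj (∈▷ˡ x∈C) (∈▷ʳ y) x~y
  adjC : ∀ {u v} → Adj C u v → Adj D u v
  adjC {u} {v} u~v = adj (∈▷ˡ (N⊆V C v (N-sym C u v u~v))) (∈▷ˡ (N⊆V C u u~v)) (proj₂ subgraph u u~v)
  C≤D : C ≤ᴳ D
  C≤D = (λ v∈ → x∈p∧x∉q⇒x∈p─q (proj₁ subgraph v∈) (x∈p⇒x∉∁p (∈▷ˡ v∈))) , λ u → adjC
  to-x : ∀ {v} → v ∈ V D → Star (Adj D) v x
  to-x v∈ with ∈▷⁻ (x∉∁p⇒x∈p (proj₂ (∈─⁻ v∈)))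
  ... | inj₁ v∈C  = gmap id adjC (connected v∈C x∈C)
  ... | inj₂ refl = N-sym D x y x~y′ ◅ ε
  D-connected : Connected D
  D-connected u∈ v∈ = to-x u∈ ◅◅ ◅-reverse (λ {a} {b} → N-sym D a b) (to-x v∈)

module _ {n} {G : Graph n} {S} {F : Graph n} (semi : IsSemifragment G S F) where
  open IsSemifragment semi
  open IsUnionOfComponents union

  semifragment⊆V : ∀ {x} → x ∈ V F → x ∈ V G × x ∉ S
  semifragment⊆V x∈F with find (Equivalence.to (vertices _) x∈F)
  ... | C , C∈ , x∈C = ∈─⁻ (proj₁ (IsComponent.subgraph (All.lookup areComponents C∈)) x∈C)

  semifragment-closed : ∀ {x y} → x ∈ V F → Adj G x y → y ∉ S → Adj F x y
  semifragment-closed {x} {y} x∈F x~y y∉S with find (Equivalence.to (vertices _) x∈F)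
  ... | C , C∈ , x∈C = Equivalence.from (edges x y) (lose C∈
    (component-closed (All.lookup areComponents C∈) x∈C
      (∖-Adj⁺ G S x y x~y (proj₂ (semifragment⊆V x∈F)) y∉S)))

module Pieces {n} (G : Graph n) (triangleFree : TriangleFree G) (k : ℕ)
  (minDegree : ∀ {z} → z ∈ V G → k < ∣ N G z ∣) where

  open Removal G triangleFree k public

  private
    deg> : ∀ {z} → z ∈ V G → k < deg ⊥ z
    deg> {z} z∈V = subst (k <_) (trans (cong ∣_∣ (sym (p─⊥≡p (N G z)))) (sym (deg≡ ⊥ z))) (minDegree z∈V)

    V⊆U : V G ⊆ U ⊥
    V⊆U v∈ = x∈p∧x∉q⇒x∈p─q v∈ ∉⊥

  graph-piece : Nonempty (V G) → Piece k ⊥ (V G)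
  graph-piece (v , v∈V) = V⊆U , ≤-trans (minDegree v∈V) (p⊆q⇒∣p∣≤∣q∣ (N⊆V G v))
    , ≤-trans (p⊆q⇒∣p∣≤∣q∣ ∂⊆⊥) (≤-trans (≤-reflexive (∣⊥∣≡0 n)) z≤n)
    , inj₁ (λ v∈ → proj₁ (∈─⁻ v∈))
    where
    ∂⊆⊥ : ∂ ⊥ (V G) ⊆ ⊥
    ∂⊆⊥ v∈ with ∂⁻ v∈
    ... | _ , v∉V , _ , _ , a~v = contradiction (~-∈V a~v) v∉V

  -- Neighbours of `F` and of its rest stay inside up to at most k outer neighbours of `F`, so
  -- `closed-size` bounds both from below.
  semifragment-piece : ∀ {S F} → IsSemifragment G S F → ∣ S ∣ ≤ k → Piece k ⊥ (V F)
  semifragment-piece {S} {F} semi S≤k = V⊆U ∘ F⊆V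
    , <-trans (n<1+n k) (closed-size ⊥ (V F) (∂ ⊥ (V F)) N─⊆ ∂≤ (deg> ∘ F⊆V) nonempty)
    , ∂≤ , inj₂ (≤-trans (n≤1+n k) (≤-trans (n≤1+n (suc k))
        (closed-size ⊥ R (∂ ⊥ (V F)) closed ∂≤ (λ z∈R → deg> (proj₁ (Rest⁻ z∈R))) R≢∅)))
    where
    open IsSemifragment semi
    R = Rest ⊥ (V F)
    F⊆V : V F ⊆ V G
    F⊆V x∈ = proj₁ (semifragment⊆V semi x∈)
    enter : ∀ {x y} → x ∈ V F → x ~ y → y ∉ S → y ∈ V F
    enter {x} {y} x∈F x~y y∉S = N⊆V F x (semifragment-closed semi x∈F x~y y∉S)
    ∂⊆S : ∂ ⊥ (V F) ⊆ S
    ∂⊆S {v} v∈ with ∂⁻ v∈ | v ∈? S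
    ... | _                        | yes v∈S = v∈S
    ... | _ , v∉F , a , a∈F , a~v  | no  v∉S = contradiction (enter a∈F a~v v∉S) v∉F
    ∂≤ : ∣ ∂ ⊥ (V F) ∣ ≤ k
    ∂≤ = ≤-trans (p⊆q⇒∣p∣≤∣q∣ ∂⊆S) S≤k
    closed : ∀ {z v} → z ∈ R → v ∈ N G z ─ ⊥ → v ∈ R ⊎ v ∈ ∂ ⊥ (V F)
    closed z∈R v∈ with trichotomy {⊥} {V F} (~-∈V (proj₁ (∈─⁻ v∈))) ∉⊥
    ... | inj₁ v∈F        = contradiction (_ , v∈F , ~-sym (proj₁ (∈─⁻ v∈))) (proj₂ (proj₂ (proj₂ (Rest⁻ z∈R))))
    ... | inj₂ (inj₁ v∈∂) = inj₂ v∈∂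
    ... | inj₂ (inj₂ v∈R) = inj₁ v∈R
    R≢∅ : Nonempty R
    R≢∅ with rest
    ... | r , r∈ = let (r∈V , r∉) = ∈─⁻ r∈ in
      r , Rest⁺ r∈V ∉⊥ (r∉ ∘ x∈p∪q⁺ ∘ inj₂) λ (a , a∈F , a~r) →
        r∉ (x∈p∪q⁺ (inj₂ (enter a∈F a~r (r∉ ∘ x∈p∪q⁺ ∘ inj₁))))

-- Sliding a path into smaller and smaller pieces

⌈/2⌉-subadditive : ∀ m n → ⌈ m + n /2⌉ ≤ ⌈ m /2⌉ + ⌈ n /2⌉
⌈/2⌉-subadditive zero          n       = ≤-refl
⌈/2⌉-subadditive (suc zero)    zero    = ≤-refl
⌈/2⌉-subadditive (suc zero)    (suc n) = s≤s (⌊n/2⌋-mono (n≤1+n (suc n)))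
⌈/2⌉-subadditive (suc (suc m)) n       = s≤s (⌈/2⌉-subadditive m n)

[]≤1 : ∀ {A : Set} (d : Dec A) → [ d ] ≤ 1
[]≤1 (yes _) = ≤-refl
[]≤1 (no  _) = z≤n

¬⇒[]≡0 : ∀ {A : Set} (d : Dec A) → ¬ A → [ d ] ≡ 0
¬⇒[]≡0 (yes a) ¬a = contradiction a ¬a
¬⇒[]≡0 (no  _) _  = refl

infixl 6 _▷*_
_▷*_ : ∀ {n} → Subset n → List (Fin n) → Subset n
Y ▷* []      = Y
Y ▷* (x ∷ L) = (Y ▷* L) ▷ x

set : ∀ {n} → List (Fin n) → Subset n
set L = ⊥ ▷* L

module _ {n} {Y : Subset n} where
  ∈▷*⁻ : ∀ L {v} → v ∈ Y ▷* L → v ∈ Y ⊎ v ∈ᴸ L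
  ∈▷*⁻ []      v∈ = inj₁ v∈
  ∈▷*⁻ (x ∷ L) v∈ with ∈▷⁻ v∈
  ... | inj₂ refl = inj₂ (here refl)
  ... | inj₁ v∈′  = [ inj₁ , inj₂ ∘ there ]′ (∈▷*⁻ L v∈′)

  ∈▷*ˡ : ∀ L {v} → v ∈ Y → v ∈ Y ▷* L
  ∈▷*ˡ []      v∈ = v∈
  ∈▷*ˡ (_ ∷ L) v∈ = ∈▷ˡ (∈▷*ˡ L v∈)

  ∈▷*ʳ : ∀ L {v} → v ∈ᴸ L → v ∈ Y ▷* L
  ∈▷*ʳ (x ∷ L) (here refl) = ∈▷ʳ x
  ∈▷*ʳ (_ ∷ L) (there v∈)  = ∈▷ˡ (∈▷*ʳ L v∈)

∈set⁻ : ∀ {n} (L : List (Fin n)) {v} → v ∈ set L → v ∈ᴸ L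
∈set⁻ L v∈ = [ (λ v∈⊥ → contradiction v∈⊥ ∉⊥) , id ]′ (∈▷*⁻ L v∈)

∈set⁺ : ∀ {n} (L : List (Fin n)) {v} → v ∈ᴸ L → v ∈ set L
∈set⁺ = ∈▷*ʳ

∉⇒All≢ : ∀ {A : Set} {x : A} L → x ∉ᴸ L → All (x ≢_) L
∉⇒All≢ L x∉ = All.tabulate λ y∈ x≡y → x∉ (subst (_∈ᴸ L) (sym x≡y) y∈)

last : ∀ {A : Set} → A → List A → A
last x []      = x
last _ (y ∷ L) = last y L

last-∷ʳ : ∀ {A : Set} (x : A) L y → last x (L ∷ʳ y) ≡ y
last-∷ʳ _ []      _ = refl
last-∷ʳ _ (z ∷ L) y = last-∷ʳ z L y

linked-∷ʳ : ∀ {A : Set} {R : A → A → Set} x L {y} →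
            Linked R (x ∷ L) → R (last x L) y → Linked R (x ∷ L ∷ʳ y)
linked-∷ʳ _ []      [-]     r = r ∷ [-]
linked-∷ʳ _ (z ∷ L) (s ∷ l) r = s ∷ linked-∷ʳ z L l r

linked-++ˡ : ∀ {A : Set} {R : A → A → Set} (L : List A) {M} → Linked R (L ++ M) → Linked R L
linked-++ˡ []          _       = []
linked-++ˡ (_ ∷ [])    _       = [-]
linked-++ˡ (_ ∷ x ∷ L) (r ∷ l) = r ∷ linked-++ˡ (x ∷ L) l

linked-++ʳ : ∀ {A : Set} {R : A → A → Set} (L : List A) {M} → Linked R (L ++ M) → Linked R M
linked-++ʳ []      l = l
linked-++ʳ (_ ∷ L) l = linked-++ʳ L (Linked.tail l)

unique-∷ʳ : ∀ {A : Set} {x : A} L → Unique L → x ∉ᴸ L → Unique (L ∷ʳ x)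
unique-∷ʳ []      _       _  = [] ∷ []
unique-∷ʳ (y ∷ L) (y∉ ∷ u) x∉ =
  All.++⁺ y∉ ((λ { refl → x∉ (here refl) }) ∷ []) ∷ unique-∷ʳ L u (x∉ ∘ there)

-- The arms have orders `a` and `suc b₁`, and `K` is what the minimum degree grants beyond the arm
-- of order `a`. 2 ≤ K pays for `e` next to a sliding path of a + 2 vertices; the other bound pays
-- for the second arm without its last vertex and for one further unit.
module Search {n} (G : Graph n) (triangleFree : TriangleFree G) (k : ℕ) (1≤k : 1 ≤ k)
  (a b₁ K : ℕ) (2≤K : 2 ≤ K) (b₁≤K : suc ⌈ b₁ /2⌉ ≤ K)
  (minDegree : ∀ {z} → z ∈ V G → suc k + (⌈ a /2⌉ + K) ≤ ∣ N G z ∣) where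

  open Removal G triangleFree k public

  IsPath : List (Fin n) → Set
  IsPath = Linked _~_

  -- Repetitions are counted: `e` and `p` may coincide, and only upper bounds are wanted.
  cnt : Fin n → List (Fin n) → ℕ
  cnt z []      = 0
  cnt z (x ∷ L) = [ z ~? x ] + cnt z L

  cnt-++ : ∀ z L M → cnt z (L ++ M) ≡ cnt z L + cnt z M
  cnt-++ z []      M = refl
  cnt-++ z (x ∷ L) M = trans (cong ([ z ~? x ] +_) (cnt-++ z L M)) (sym (+-assoc [ z ~? x ] _ _))

  cnt-pair : ∀ z {x y} → x ~ y → [ z ~? x ] + [ z ~? y ] ≤ 1
  cnt-pair z {x} {y} x~y with z ~? x
  ... | no  _   = []≤1 (z ~? y)
  ... | yes z~x = ≤-reflexive (cong suc (¬⇒[]≡0 (z ~? y) λ z~y → triangleFree (z~x , x~y , ~-sym z~y)))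

  cnt-path : ∀ z {L} → IsPath L → cnt z L ≤ ⌈ length L /2⌉
  cnt-path z []                      = z≤n
  cnt-path z {x ∷ []} [-]            = ≤-trans (≤-reflexive (+-identityʳ [ z ~? x ])) ([]≤1 (z ~? x))
  cnt-path z {x ∷ y ∷ L} (x~y ∷ pathL) = begin
    [ z ~? x ] + ([ z ~? y ] + cnt z L)   ≡⟨ +-assoc [ z ~? x ] _ _ ⟨
    [ z ~? x ] + [ z ~? y ] + cnt z L     ≤⟨ +-mono-≤ (cnt-pair z x~y) (cnt-path z (Linked.tail pathL)) ⟩
    suc ⌈ length L /2⌉                    ∎
    where open ≤-Reasoning

  cnt-∷≤ : ∀ z x L → cnt z (x ∷ L) ≤ suc (cnt z L)
  cnt-∷≤ z x L = +-monoˡ-≤ (cnt z L) ([]≤1 (z ~? x))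

  cnt-∷≁ : ∀ {z x} L → ¬ z ~ x → cnt z (x ∷ L) ≡ cnt z L
  cnt-∷≁ {z} {x} L z≁x = cong (_+ cnt z L) (¬⇒[]≡0 (z ~? x) z≁x)

  card≤cnt : ∀ (p q : Subset n) z L → (∀ {v} → v ∈ p → v ∉ q → z ~ v × v ∈ᴸ L) → ∣ p ∣ ≤ ∣ q ∣ + cnt z L
  card≤cnt p q z [] p⊆ = ≤-trans (p⊆q⇒∣p∣≤∣q∣ sub) (m≤m+n ∣ q ∣ 0)
    where
    sub : p ⊆ q
    sub {v} v∈ with v ∈? q
    ... | yes v∈q = v∈q
    ... | no  v∉q with () ← proj₂ (p⊆ v∈ v∉q)
  card≤cnt p q z (x ∷ L) p⊆ with z ~? x
  ... | yes _ = ≤-trans (card≤cnt p (q ▷ x) z L p⊆′)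
                  (≤-trans (+-monoˡ-≤ (cnt z L) (∣Y▷x∣≤ q x)) (≤-reflexive (sym (+-suc ∣ q ∣ (cnt z L)))))
    where
    p⊆′ : ∀ {v} → v ∈ p → v ∉ q ▷ x → z ~ v × v ∈ᴸ L
    p⊆′ v∈ v∉ with p⊆ v∈ (v∉ ∘ ∈▷ˡ)
    ... | _   , here refl = contradiction (∈▷ʳ x) v∉
    ... | z~v , there v∈L = z~v , v∈L
  ... | no z≁x = card≤cnt p q z L p⊆′
    where
    p⊆′ : ∀ {v} → v ∈ p → v ∉ q → z ~ v × v ∈ᴸ L
    p⊆′ v∈ v∉ with p⊆ v∈ v∉
    ... | z~x , here refl = contradiction z~x z≁x
    ... | z~v , there v∈L = z~v , v∈L

  -- Only those vertices of `Y` that are adjacent to `z` have to be listed, so `p` may be left out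
  -- for vertices of a piece not adjacent to it.
  module _ {Y z} L (z∈V : z ∈ V G) (Y⊆L : ∀ {v} → v ∈ Y → z ~ v → v ∈ᴸ L) where
    deg-bound : ∀ {i c} → i + c ≡ suc k + (⌈ a /2⌉ + K) → cnt z L ≤ c → i ≤ deg Y z
    deg-bound {i} {c} eq cnt≤ = +-cancelʳ-≤ c i (deg Y z) (begin
      i + c                    ≡⟨ eq ⟩
      suc k + (⌈ a /2⌉ + K)    ≤⟨ minDegree z∈V ⟩
      ∣ N G z ∣                ≤⟨ card≤cnt (N G z) (N G z ─ Y) z L sub ⟩
      ∣ N G z ─ Y ∣ + cnt z L  ≡⟨ cong (_+ cnt z L) (deg≡ Y z) ⟨
      deg Y z + cnt z L        ≤⟨ +-monoʳ-≤ (deg Y z) cnt≤ ⟩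
      deg Y z + c              ∎)
      where
      open ≤-Reasoning
      sub : ∀ {v} → v ∈ N G z → v ∉ N G z ─ Y → z ~ v × v ∈ᴸ L
      sub {v} z~v v∉ with v ∈? Y
      ... | yes v∈Y = z~v , Y⊆L v∈Y z~v
      ... | no  v∉Y = contradiction (x∈p∧x∉q⇒x∈p─q z~v v∉Y) v∉

    k<deg : cnt z L ≤ ⌈ a /2⌉ + K → k < deg Y z
    k<deg = deg-bound refl

    k≤deg : cnt z L ≤ suc (⌈ a /2⌉ + K) → k ≤ deg Y z
    k≤deg = deg-bound (+-suc k _)

  set-deg : ∀ L {z} → z ∈ V G → cnt z L ≤ ⌈ a /2⌉ + K → k < deg (set L) z
  set-deg L z∈V = k<deg L z∈V λ v∈ _ → ∈set⁻ L v∈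

  -- The tree that is sought: p is a leaf at c, and c has two further arms.
  record Copy (W : Subset n) : Set where
    field
      p c     : Fin n
      arm ys  : List (Fin n)
      p~c     : p ~ c
      path    : IsPath (ys ++ c ∷ arm)
      unique  : Unique (ys ++ c ∷ arm)
      p∉      : p ∉ᴸ (ys ++ c ∷ arm)
      p∈W     : p ∈ W
      inW     : All (_∈ W) (ys ++ c ∷ arm)
      ∣arm∣   : length arm ≡ a
      ∣ys∣    : length ys ≡ suc b₁
      linked  : k -LinkedOff (set (p ∷ c ∷ arm) ▷* ys)

  -- Once c is adjacent to the piece, the second arm ys is grown into the piece.
  -- The vertex e, which is not part of the tree, is only given back to the graph
  -- when the last vertex is removed.
  module Grow (W : Subset n) (e p c : Fin n) (arm : List (Fin n)) (∣arm∣ : length arm ≡ a)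
              (p~c : p ~ c) (p∈W : p ∈ W) (W⊆V : W ⊆ V G) where

    Y : List (Fin n) → Subset n
    Y ys = set (e ∷ p ∷ c ∷ arm) ▷* ys

    -- The second arm is listed from its tip towards `c`, so new vertices are put in front; before
    -- the first one the tip is `c`.
    head : List (Fin n) → Fin n
    head []      = c
    head (y ∷ _) = y

    tail : List (Fin n) → List (Fin n)
    tail []       = arm
    tail (_ ∷ ys) = ys ++ c ∷ arm

    head∷tail : ∀ ys → head ys ∷ tail ys ≡ ys ++ c ∷ arm
    head∷tail []      = refl
    head∷tail (_ ∷ _) = refl

    Y⊆ : ∀ ys {v} → v ∈ Y ys → v ∈ᴸ (e ∷ p ∷ ys ++ c ∷ arm)
    Y⊆ ys v∈ with ∈▷*⁻ ys v∈
    ... | inj₂ v∈ys = there (there (∈-++⁺ˡ v∈ys))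
    ... | inj₁ v∈′ with ∈set⁻ (e ∷ p ∷ c ∷ arm) v∈′
    ...   | here eq          = here eq
    ...   | there (here eq)  = there (here eq)
    ...   | there (there v∈) = there (there (∈-++⁺ʳ ys v∈))

    record Growth (ys : List (Fin n)) (D : Subset n) : Set where
      field
        linked  : k -LinkedOff (Y ys)
        minD    : MinPiece k (Y ys) D
        D⊆W     : D ⊆ W
        path    : IsPath (ys ++ c ∷ arm)
        unique  : Unique (ys ++ c ∷ arm)
        p∉      : p ∉ᴸ (ys ++ c ∷ arm)
        inW     : All (_∈ W) (ys ++ c ∷ arm)
        -- Vertices of D lose at most one neighbour to e and p together.
        hole    : p ≡ e ⊎ ¬ (D ≈ p)
        next    : D ≈ head ys

      D⊆U : D ⊆ U (Y ys)
      D⊆U = proj₁ (proj₁ minD)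

      module _ {x} (x∈D : x ∈ D) (x~h : x ~ head ys) where
        x∉ : x ∉ Y ys
        x∉ = proj₂ (∈─⁻ (D⊆U x∈D))

        x∉P : x ∉ᴸ (ys ++ c ∷ arm)
        x∉P x∈ with ∈-++⁻ ys x∈
        ... | inj₁ x∈ys = x∉ (∈▷*ʳ ys x∈ys)
        ... | inj₂ x∈   = x∉ (∈▷*ˡ ys (∈set⁺ (e ∷ p ∷ c ∷ arm) (there (there x∈))))

        path′ : IsPath (x ∷ ys ++ c ∷ arm)
        path′ = subst (λ L → IsPath (x ∷ L)) (head∷tail ys)
          (x~h ∷ subst IsPath (sym (head∷tail ys)) path)

        unique′ : Unique (x ∷ ys ++ c ∷ arm)
        unique′ = ∉⇒All≢ _ x∉P ∷ unique

        p∉′ : p ∉ᴸ (x ∷ ys ++ c ∷ arm)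
        p∉′ (here refl) = x∉ (∈▷*ˡ ys (∈set⁺ (e ∷ p ∷ c ∷ arm) (there (here refl))))
        p∉′ (there p∈)  = p∉ p∈

        inW′ : All (_∈ W) (x ∷ ys ++ c ∷ arm)
        inW′ = D⊆W x∈D ∷ inW

        ≁head : ∀ {z} → z ~ x → ¬ z ~ head ys
        ≁head z~x z~h = triangleFree (z~x , x~h , ~-sym z~h)

      D-cover : ∀ {z} → z ∈ D → ∀ {v} → v ∈ Y ys → z ~ v → v ∈ᴸ (e ∷ ys ++ c ∷ arm)
      D-cover z∈D v∈ z~v with Y⊆ ys v∈
      ... | here v≡e             = here v≡e
      ... | there (there v∈P)    = there v∈P
      ... | there (here refl)    = here ([ id , (λ D≉p → contradiction (_ , z∈D , z~v) D≉p) ]′ hole)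

      arm-path : IsPath arm
      arm-path = Linked.tail (linked-++ʳ ys path)

      cnt-arm : ∀ z → cnt z arm ≤ ⌈ a /2⌉
      cnt-arm z = subst (λ l → cnt z arm ≤ ⌈ l /2⌉) ∣arm∣ (cnt-path z arm-path)

    -- The edge from `p` to `c` costs one unit and each arm half its order, rounded up. This is the
    -- same sum as in the bound for the colour class that avoids the branch vertex.
    cnt-spider : ∀ z L → IsPath L → cnt z arm ≤ ⌈ a /2⌉ →
                 cnt z (p ∷ L ++ c ∷ arm) ≤ suc ⌈ length L /2⌉ + ⌈ a /2⌉
    cnt-spider z L pathL cnt-arm = begin
      [ z ~? p ] + cnt z (L ++ c ∷ arm)                      ≡⟨ cong ([ z ~? p ] +_) (cnt-++ z L (c ∷ arm)) ⟩
      [ z ~? p ] + (cnt z L + ([ z ~? c ] + cnt z arm))      ≡⟨ rearrange [ z ~? p ] (cnt z L) [ z ~? c ] (cnt z arm) ⟩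
      [ z ~? p ] + [ z ~? c ] + cnt z L + cnt z arm          ≤⟨ +-mono-≤ (+-mono-≤ (cnt-pair z p~c) (cnt-path z pathL)) cnt-arm ⟩
      suc ⌈ length L /2⌉ + ⌈ a /2⌉                           ∎
      where
      open ≤-Reasoning
      rearrange : ∀ i j l m → i + (j + (l + m)) ≡ i + l + j + m
      rearrange i j l m = trans (sym (+-assoc i j (l + m))) (trans (sym (+-assoc (i + j) l m))
        (cong (_+ m) (trans (+-assoc i j l) (trans (cong (i +_) (+-comm j l)) (sym (+-assoc i l j))))))

    module _ {ys D} (growth : Growth ys D) where
      open Growth growth

      private
        j = length ys

        D∈V : ∀ {z} → z ∈ D → z ∈ V G
        D∈V = W⊆V ∘ D⊆W

        ∣P∣ : length (ys ++ c ∷ arm) ≡ suc (j + a)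
        ∣P∣ = trans (List.length-++ ys) (trans (+-suc j (length arm)) (cong (λ l → suc (j + l)) ∣arm∣))

      module _ (j≤b₁ : j ≤ b₁) where
        private
          j≤K : suc ⌈ j /2⌉ ≤ K
          j≤K = ≤-trans (s≤s (⌈n/2⌉-mono j≤b₁)) b₁≤K

        cnt-pP : ∀ z → cnt z (p ∷ ys ++ c ∷ arm) ≤ ⌈ a /2⌉ + K
        cnt-pP z = begin
          cnt z (p ∷ ys ++ c ∷ arm)   ≤⟨ cnt-spider z ys (linked-++ˡ ys path) (cnt-arm z) ⟩
          suc ⌈ j /2⌉ + ⌈ a /2⌉       ≤⟨ +-monoˡ-≤ ⌈ a /2⌉ j≤K ⟩
          K + ⌈ a /2⌉                 ≡⟨ +-comm K ⌈ a /2⌉ ⟩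
          ⌈ a /2⌉ + K                 ∎
          where open ≤-Reasoning

        k≤deg-Y : ∀ {z} → z ∈ V G → k ≤ deg (Y ys) z
        k≤deg-Y {z} z∈V = k≤deg (e ∷ p ∷ ys ++ c ∷ arm) z∈V (λ v∈ _ → Y⊆ ys v∈)
          (≤-trans (cnt-∷≤ z e (p ∷ ys ++ c ∷ arm)) (s≤s (cnt-pP z)))

        cnt-tail : ∀ z → cnt z (tail ys) ≤ ⌈ j /2⌉ + ⌈ a /2⌉
        cnt-tail z = begin
          cnt z (tail ys)          ≤⟨ cnt-path z (Linked.tail (subst IsPath (sym (head∷tail ys)) path)) ⟩
          ⌈ length (tail ys) /2⌉   ≡⟨ cong ⌈_/2⌉ (suc-injective (trans (cong length (head∷tail ys)) ∣P∣)) ⟩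
          ⌈ j + a /2⌉              ≤⟨ ⌈/2⌉-subadditive j a ⟩
          ⌈ j /2⌉ + ⌈ a /2⌉        ∎
          where open ≤-Reasoning

        -- One unit covers `e` and `p` together, and without the tip only j + a vertices of the path
        -- remain. For j = b₁ this uses up all that the bound on `K` allows.
        k<deg-D : ∀ {z} → z ∈ D → ¬ z ~ head ys → k < deg (Y ys) z
        k<deg-D {z} z∈D z≁h = k<deg (e ∷ ys ++ c ∷ arm) (D∈V z∈D) (D-cover z∈D) (begin
          cnt z (e ∷ ys ++ c ∷ arm)     ≤⟨ cnt-∷≤ z e (ys ++ c ∷ arm) ⟩
          suc (cnt z (ys ++ c ∷ arm))   ≡⟨ cong (suc ∘ cnt z) (head∷tail ys) ⟨
          suc (cnt z (head ys ∷ tail ys)) ≡⟨ cong suc (cnt-∷≁ (tail ys) z≁h) ⟩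
          suc (cnt z (tail ys))         ≤⟨ s≤s (cnt-tail z) ⟩
          suc ⌈ j /2⌉ + ⌈ a /2⌉         ≤⟨ +-monoˡ-≤ ⌈ a /2⌉ j≤K ⟩
          K + ⌈ a /2⌉                   ≡⟨ +-comm K ⌈ a /2⌉ ⟩
          ⌈ a /2⌉ + K                   ∎)
          where open ≤-Reasoning

      finish : j ≡ b₁ → Copy W
      finish j≡b₁ with next
      ... | x , x∈D , x~h = record
        { p = p ; c = c ; arm = arm ; ys = x ∷ ys ; p~c = p~c
        ; path = path′ x∈D x~h ; unique = unique′ x∈D x~h ; p∉ = p∉′ x∈D x~h
        ; p∈W = p∈W ; inW = inW′ x∈D x~h ; ∣arm∣ = ∣arm∣ ; ∣ys∣ = cong suc j≡b₁
        -- Neighbours of `x` miss the tip, since `x` is adjacent to it; so within `D` they have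
        -- degree above k although `e` is still removed.
        ; linked = exchange {Y⁻} {Y ys} {D} {e} {x} Y⁻⊆Y Y⊆Y⁻ linked minD x∈D
            (k≤deg-Y j≤b₁ ∘ D∈V) (λ z∈D z~x → k<deg-D j≤b₁ z∈D (≁head x∈D x~h z~x)) deg⁻
        }
        where
        j≤b₁ = ≤-reflexive j≡b₁
        Y⁻ = set (p ∷ c ∷ arm) ▷* ys
        Y⁻⊆Y : Y⁻ ⊆ Y ys
        Y⁻⊆Y v∈ = [ ∈▷*ˡ ys ∘ ∈▷ˡ , ∈▷*ʳ ys ]′ (∈▷*⁻ ys v∈)
        Y⊆Y⁻ : ∀ {v} → v ∈ Y ys → v ∈ Y⁻ ⊎ v ≡ e
        Y⊆Y⁻ v∈ with ∈▷*⁻ ys v∈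
        ... | inj₂ v∈ys = inj₁ (∈▷*ʳ ys v∈ys)
        ... | inj₁ v∈′  = [ inj₁ ∘ ∈▷*ˡ ys , inj₂ ]′ (∈▷⁻ v∈′)
        Y⁻⊆ : ∀ {v} → v ∈ Y⁻ → v ∈ᴸ (p ∷ ys ++ c ∷ arm)
        Y⁻⊆ v∈ with ∈▷*⁻ ys v∈
        ... | inj₂ v∈ys = there (∈-++⁺ˡ v∈ys)
        ... | inj₁ v∈′ with ∈set⁻ (p ∷ c ∷ arm) v∈′
        ...   | here eq  = here eq
        ...   | there v∈ = there (∈-++⁺ʳ ys v∈)
        deg⁻ : ∀ {z} → z ∈ U Y⁻ → k < deg Y⁻ z
        deg⁻ {z} z∈U = k<deg (p ∷ ys ++ c ∷ arm) (proj₁ (∈─⁻ z∈U)) (λ v∈ _ → Y⁻⊆ v∈) (cnt-pP j≤b₁ z)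

      module _ (j<b₁ : j < b₁) where
        private
          j≤b₁ = <⇒≤ j<b₁

          1+j≤K : suc ⌈ suc j /2⌉ ≤ K
          1+j≤K = ≤-trans (s≤s (⌈n/2⌉-mono j<b₁)) b₁≤K

        cnt-epP : ∀ z → ¬ z ~ head ys → cnt z (e ∷ p ∷ ys ++ c ∷ arm) ≤ ⌈ a /2⌉ + K
        cnt-epP z z≁h = ≤-trans (cnt-∷≤ z e (p ∷ ys ++ c ∷ arm))
          (≤-trans (go ys (linked-++ˡ ys path) z≁h 1+j≤K) (≤-reflexive (+-comm K ⌈ a /2⌉)))
          where
          open ≤-Reasoning
          go : ∀ ys → IsPath ys → ¬ z ~ head ys → suc ⌈ suc (length ys) /2⌉ ≤ K →
               suc (cnt z (p ∷ ys ++ c ∷ arm)) ≤ K + ⌈ a /2⌉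
          -- The tip is `c` itself; what remains to be paid besides the first arm is `e` and `p`,
          -- hence 2 ≤ K.
          go [] _ z≁c _ = begin
            suc ([ z ~? p ] + cnt z (c ∷ arm))   ≡⟨ cong (λ l → suc ([ z ~? p ] + l)) (cnt-∷≁ arm z≁c) ⟩
            suc ([ z ~? p ] + cnt z arm)         ≤⟨ s≤s (+-mono-≤ ([]≤1 (z ~? p)) (cnt-arm z)) ⟩
            2 + ⌈ a /2⌉                          ≤⟨ +-monoˡ-≤ ⌈ a /2⌉ 2≤K ⟩
            K + ⌈ a /2⌉                          ∎
          -- The hypothesis counts one vertex more than `y ∷ ys` has, thus two more than `ys`. Its
          -- left side computes to 2 + ⌈ length ys /2⌉, which includes the unit for `e`.
          go (y ∷ ys) pathys z≁y le = begin
            suc ([ z ~? p ] + cnt z (y ∷ ys ++ c ∷ arm))  ≡⟨ cong (λ l → suc ([ z ~? p ] + l)) (cnt-∷≁ (ys ++ c ∷ arm) z≁y) ⟩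
            suc (cnt z (p ∷ ys ++ c ∷ arm))               ≤⟨ s≤s (cnt-spider z ys (Linked.tail pathys) (cnt-arm z)) ⟩
            2 + ⌈ length ys /2⌉ + ⌈ a /2⌉                 ≤⟨ +-monoˡ-≤ ⌈ a /2⌉ le ⟩
            K + ⌈ a /2⌉                                   ∎

        -- A vertex adjacent to the tip cannot save the tip; being in `D` it saves a unit on `e` and
        -- `p` instead.
        k<deg-x : ∀ {x} → x ∈ D → k < deg (Y ys) x
        k<deg-x {x} x∈D = k<deg (e ∷ ys ++ c ∷ arm) (D∈V x∈D) (D-cover x∈D) (begin
          cnt x (e ∷ ys ++ c ∷ arm)       ≤⟨ cnt-∷≤ x e (ys ++ c ∷ arm) ⟩
          suc (cnt x (ys ++ c ∷ arm))     ≤⟨ s≤s (cnt-path x path) ⟩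
          suc ⌈ length (ys ++ c ∷ arm) /2⌉ ≡⟨ cong (λ l → suc ⌈ l /2⌉) ∣P∣ ⟩
          suc ⌈ suc j + a /2⌉             ≤⟨ s≤s (⌈/2⌉-subadditive (suc j) a) ⟩
          suc ⌈ suc j /2⌉ + ⌈ a /2⌉       ≤⟨ +-monoˡ-≤ ⌈ a /2⌉ 1+j≤K ⟩
          K + ⌈ a /2⌉                     ≡⟨ +-comm K ⌈ a /2⌉ ⟩
          ⌈ a /2⌉ + K                     ∎)
          where open ≤-Reasoning

        deg>-step : ∀ {x z} → x ∈ D → x ~ head ys → z ∈ U (Y ys) → z ~ x → k < deg (Y ys) z
        deg>-step {z = z} x∈D x~h z∈U z~x = k<deg (e ∷ p ∷ ys ++ c ∷ arm) (proj₁ (∈─⁻ z∈U))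
          (λ v∈ _ → Y⊆ ys v∈) (cnt-epP z (≁head x∈D x~h z~x))

        step : ∃[ x ] ∃[ D₁ ] Growth (x ∷ ys) D₁
        step = x , D₁ , record
          { linked = remove {Y ys} {D} {x} linked minD x∈D (λ z∈U → k≤deg-Y j≤b₁ (proj₁ (∈─⁻ z∈U))) (deg>-step x∈D x~h)
          ; minD = proj₂ (proj₂ (proj₂ (proj₂ nested))) ; D⊆W = D⊆W ∘ D₁⊆D
          ; path = path′ x∈D x~h ; unique = unique′ x∈D x~h ; p∉ = p∉′ x∈D x~h ; inW = inW′ x∈D x~h
          ; hole = [ inj₁ , (λ D≉p → inj₂ λ (z , z∈ , z~p) → D≉p (z , D₁⊆D z∈ , z~p)) ]′ hole
          ; next = proj₁ (proj₂ (proj₂ (proj₂ nested)))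
          }
          where
          x   = proj₁ next
          x∈D = proj₁ (proj₂ next)
          x~h = proj₂ (proj₂ next)
          size : D ≈ x × suc k < ∣ D ∣
          size = piece-size {Y ys} {D} {x} (proj₁ minD) x∈D (λ z∈D z~x → deg>-step x∈D x~h (D⊆U z∈D) z~x) (k<deg-x x∈D)
          nested : ∃[ D₁ ] D₁ ⊆ D × x ∉ D₁ × D₁ ≈ x × MinPiece k (Y ys ▷ x) D₁
          nested = nest {Y ys} {D} {x} minD x∈D (proj₁ size) (proj₂ size)
          D₁   = proj₁ nested
          D₁⊆D : D₁ ⊆ D
          D₁⊆D = proj₁ (proj₂ nested)

    grow : ∀ r ys D → length ys + r ≡ b₁ → Growth ys D → Copy W
    grow zero    ys D eq growth = finish {ys} {D} growth (trans (sym (+-identityʳ (length ys))) eq)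
    grow (suc r) ys D eq growth = grow r (proj₁ next ∷ ys) (proj₁ (proj₂ next))
      (trans (sym (+-suc (length ys) r)) eq) (proj₂ (proj₂ next))
      where
      next : ∃[ x ] ∃[ D₁ ] Growth (x ∷ ys) D₁
      next = step {ys} {D} growth (≤-trans (m<m+n (length ys) {suc r} z<s) (≤-reflexive eq))

  -- The sliding window

  Advance : Subset n → Subset n → Fin n → Set
  Advance Y D x = ∃[ D₁ ] D₁ ⊆ D × x ∉ D₁ × D₁ ≈ x × MinPiece k (Y ▷ x) D₁ × k -LinkedOff (Y ▷ x)

  advance : ∀ Y D x → k -LinkedOff Y → MinPiece k Y D → x ∈ D → (∀ {z} → z ∈ U Y → k < deg Y z) → Advance Y D x
  advance Y D x linked minD x∈D deg> =
    proj₁ nested , proj₁ (proj₂ nested) , proj₁ (proj₂ (proj₂ nested)) , proj₁ (proj₂ (proj₂ (proj₂ nested)))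
    , proj₂ (proj₂ (proj₂ (proj₂ nested)))
    , remove {Y} {D} {x} linked minD x∈D (λ z∈ → <⇒≤ (deg> z∈)) (λ z∈ _ → deg> z∈)
    where
    D⊆U : D ⊆ U Y
    D⊆U = proj₁ (proj₁ minD)
    size : D ≈ x × suc k < ∣ D ∣
    size = piece-size {Y} {D} {x} (proj₁ minD) x∈D (λ z∈D _ → deg> (D⊆U z∈D)) (deg> (D⊆U x∈D))
    nested : ∃[ D₁ ] D₁ ⊆ D × x ∉ D₁ × D₁ ≈ x × MinPiece k (Y ▷ x) D₁
    nested = nest {Y} {D} {x} minD x∈D (proj₁ size) (proj₂ size)

  module _ (W : Subset n) (W⊆V : W ⊆ V G) where

    record Window (e p c : Fin n) (arm : List (Fin n)) (D : Subset n) : Set where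
      field
        linked  : k -LinkedOff (set (e ∷ p ∷ c ∷ arm))
        minD    : MinPiece k (set (e ∷ p ∷ c ∷ arm)) D
        D⊆W     : D ⊆ W
        path    : IsPath (p ∷ c ∷ arm)
        unique  : Unique (p ∷ c ∷ arm)
        inW     : All (_∈ W) (p ∷ c ∷ arm)
        ∣arm∣   : length arm ≡ a
        hole    : p ≡ e ⊎ ¬ (D ≈ p)
        next    : D ≈ last c arm

    found : ∀ {e p c arm D} → Window e p c arm D → D ≈ c → Copy W
    found {e} {p} {c} {arm} {D} window D≈c =
      Grow.grow W e p c arm ∣arm∣ p~c p∈W W⊆V b₁ [] D refl record
        { linked = linked ; minD = minD ; D⊆W = D⊆W ; path = Linked.tail path
        ; unique = uniqueTail unique ; p∉ = p∉ unique ; inW = All.tail inW ; hole = hole ; next = D≈c }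
      where
      open Window window
      p~c : p ~ c
      p~c = Linked.head path
      p∈W : p ∈ W
      p∈W = All.head inW
      uniqueTail : Unique (p ∷ c ∷ arm) → Unique (c ∷ arm)
      uniqueTail (_ ∷ u) = u
      p∉ : Unique (p ∷ c ∷ arm) → p ∉ᴸ (c ∷ arm)
      p∉ (p≢ ∷ _) p∈ = All.lookup p≢ p∈ refl

    -- The window slides along the path.  Its last vertex p is given back to the graph.
    slide : ∀ {e p c c′ arm′ D} → Window e p c (c′ ∷ arm′) D → ¬ (D ≈ c) →
            ∃[ x ] ∃[ D₁ ] ∣ D₁ ∣ < ∣ D ∣ × Window e c c′ (arm′ ∷ʳ x) D₁
    slide {e} {p} {c} {c′} {arm′} {D} window D≉c = x , D₁ , smaller , record
      { linked = restore {Y′} {p} linked▷p k≤deg-p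
      ; minD   = restore-min {Y′} {p} {D₁} hole′ (W⊆V (All.head inW)) 0<deg-p minD▷p
      ; D⊆W    = D⊆W ∘ D₁⊆D
      ; path   = linked-∷ʳ c (c′ ∷ arm′) (Linked.tail path) (~-sym x~l)
      ; unique = unique′ unique
      ; inW    = All.++⁺ (All.tail inW) (D⊆W x∈D ∷ [])
      ; ∣arm∣  = trans (List.length-++ arm′) (trans (+-comm (length arm′) 1) ∣arm∣)
      -- The old `c` becomes the new `p`, and the piece has just been found not adjacent to it.
      ; hole   = inj₂ λ (z , z∈ , z~c) → D≉c (z , D₁⊆D z∈ , z~c)
      ; next   = subst (D₁ ≈_) (sym (last-∷ʳ c′ arm′ x)) (proj₁ (proj₂ (proj₂ (proj₂ next′))))
      }
      where
      open Window window
      L  = c ∷ c′ ∷ arm′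
      Y  = set (e ∷ p ∷ L)
      x  = proj₁ next
      x∈D = proj₁ (proj₂ next)
      x~l = proj₂ (proj₂ next)
      Y′ = set (e ∷ L ∷ʳ x)
      x∉Y : x ∉ Y
      x∉Y = proj₂ (∈─⁻ (proj₁ (proj₁ minD) x∈D))
      ∣L∣ : length L ≡ suc a
      ∣L∣ = cong suc ∣arm∣
      -- One unit for `e`, and one because a window has two vertices more than the arm.
      2+a≤ : suc (suc ⌈ a /2⌉) ≤ ⌈ a /2⌉ + K
      2+a≤ = ≤-trans (+-monoˡ-≤ ⌈ a /2⌉ 2≤K) (≤-reflexive (+-comm K ⌈ a /2⌉))
      cnt≤ : ∀ z M → IsPath M → length M ≤ 2 + a → cnt z (e ∷ M) ≤ ⌈ a /2⌉ + K
      cnt≤ z M pathM ∣M∣ = ≤-trans (cnt-∷≤ z e M)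
        (≤-trans (s≤s (≤-trans (cnt-path z pathM) (⌈n/2⌉-mono ∣M∣))) 2+a≤)
      next′ : Advance Y D x
      next′ = advance Y D x linked minD x∈D λ {z} z∈U →
        set-deg (e ∷ p ∷ L) (proj₁ (∈─⁻ z∈U)) (cnt≤ z (p ∷ L) path (≤-reflexive (cong suc ∣L∣)))
      D₁ = proj₁ next′
      D₁⊆D : D₁ ⊆ D
      D₁⊆D = proj₁ (proj₂ next′)
      smaller : ∣ D₁ ∣ < ∣ D ∣
      smaller = p⊂q⇒∣p∣<∣q∣ (D₁⊆D , x , x∈D , proj₁ (proj₂ (proj₂ next′)))
      Y▷x≡ : Y ▷ x ≡ Y′ ▷ p
      Y▷x≡ = ⊆-antisym to from
        where
        to : Y ▷ x ⊆ Y′ ▷ p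
        to v∈ with ∈▷⁻ v∈
        ... | inj₂ refl = ∈▷ˡ (∈set⁺ (e ∷ L ∷ʳ x) (there (∈-++⁺ʳ L (here refl))))
        ... | inj₁ v∈Y with ∈set⁻ (e ∷ p ∷ L) v∈Y
        ...   | here refl          = ∈▷ˡ (∈set⁺ (e ∷ L ∷ʳ x) (here refl))
        ...   | there (here refl)  = ∈▷ʳ p
        ...   | there (there v∈L) = ∈▷ˡ (∈set⁺ (e ∷ L ∷ʳ x) (there (∈-++⁺ˡ v∈L)))
        from : Y′ ▷ p ⊆ Y ▷ x
        from v∈ with ∈▷⁻ v∈
        ... | inj₂ refl = ∈▷ˡ (∈set⁺ (e ∷ p ∷ L) (there (here refl)))
        ... | inj₁ v∈Y with ∈set⁻ (e ∷ L ∷ʳ x) v∈Y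
        ...   | here refl = ∈▷ˡ (∈set⁺ (e ∷ p ∷ L) (here refl))
        ...   | there v∈Lx with ∈-++⁻ L v∈Lx
        ...     | inj₁ v∈L         = ∈▷ˡ (∈set⁺ (e ∷ p ∷ L) (there (there v∈L)))
        ...     | inj₂ (here refl) = ∈▷ʳ x
      linked▷p : k -LinkedOff (Y′ ▷ p)
      linked▷p = subst (k -LinkedOff_) Y▷x≡ (proj₂ (proj₂ (proj₂ (proj₂ (proj₂ next′)))))
      minD▷p : MinPiece k (Y′ ▷ p) D₁
      minD▷p = subst (λ Z → MinPiece k Z D₁) Y▷x≡ (proj₁ (proj₂ (proj₂ (proj₂ (proj₂ next′)))))
      path′ : IsPath (p ∷ L ∷ʳ x)
      path′ = linked-∷ʳ p L path (~-sym x~l)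
      ∣L∷ʳx∣ : length (L ∷ʳ x) ≡ 2 + a
      ∣L∷ʳx∣ = trans (List.length-++ L) (trans (+-comm (length L) 1) (cong suc ∣L∣))
      k≤deg-p : k ≤ deg Y′ p
      k≤deg-p = <⇒≤ (set-deg (e ∷ L ∷ʳ x) (W⊆V (All.head inW))
        (cnt≤ p (L ∷ʳ x) (Linked.tail path′) (≤-reflexive ∣L∷ʳx∣)))
      0<deg-p : 0 < deg (Y′ ▷ p) p
      0<deg-p = ≤-trans 1≤k (k≤deg (p ∷ e ∷ L ∷ʳ x) (W⊆V (All.head inW))
        (λ v∈ _ → ∈set⁻ (p ∷ e ∷ L ∷ʳ x) v∈)
        (≤-trans (cnt-∷≤ p p (e ∷ L ∷ʳ x)) (s≤s (cnt≤ p (L ∷ʳ x) (Linked.tail path′) (≤-reflexive ∣L∷ʳx∣)))))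
      hole′ : p ∈ Y′ ⊎ ¬ (D₁ ≈ p)
      -- In the first slide `p` is `e`, so nothing is really given back.
      hole′ = [ (λ { refl → inj₁ (∈set⁺ (e ∷ L ∷ʳ x) (here refl)) })
              , (λ D≉p → inj₂ λ (z , z∈ , z~p) → D≉p (z , D₁⊆D z∈ , z~p)) ]′ hole
      unique′ : Unique (p ∷ L) → Unique (L ∷ʳ x)
      unique′ (_ ∷ u) = unique-∷ʳ L u λ x∈L → x∉Y (∈set⁺ (e ∷ p ∷ L) (there (there x∈L)))

    descend : ∀ e p c arm D → Acc _<_ ∣ D ∣ → Window e p c arm D → Copy W
    descend e p c arm D (acc rec) window with D ≈? c
    ... | yes D≈c = found {e} {p} {c} {arm} {D} window D≈c
    ... | no  D≉c = go arm window
      where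
      go : ∀ arm → Window e p c arm D → Copy W
      -- For a = 0 the last vertex of the window is `c`, to which the piece is adjacent by
      -- construction.
      go []           window = contradiction (Window.next window) D≉c
      go (c′ ∷ arm′)  window = descend e c c′ (arm′ ∷ʳ x) D₁ (rec smaller) window′
        where
        slid : ∃[ x ] ∃[ D₁ ] ∣ D₁ ∣ < ∣ D ∣ × Window e c c′ (arm′ ∷ʳ x) D₁
        slid = slide {e} {p} {c} {c′} {arm′} {D} window D≉c
        x       = proj₁ slid
        D₁      = proj₁ (proj₂ slid)
        smaller = proj₁ (proj₂ (proj₂ slid))
        window′ = proj₂ (proj₂ (proj₂ slid))

    record Start (p : Fin n) (L : List (Fin n)) (D : Subset n) : Set where
      field
        linked  : k -LinkedOff (set (p ∷ L))
        minD    : MinPiece k (set (p ∷ L)) D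
        D⊆W     : D ⊆ W
        path    : IsPath (p ∷ L)
        unique  : Unique (p ∷ L)
        inW     : All (_∈ W) (p ∷ L)
        next    : D ≈ last p L

    build : ∀ r p L D → length L + r ≡ suc a → Start p L D → Copy W
    build zero p [] D () start
    -- The first vertex of the path plays both `e` and `p`, so it is listed twice.
    build zero p (c ∷ arm) D eq start = descend p p c arm D (<-wellFounded ∣ D ∣) record
      { linked = subst (k -LinkedOff_) Y≡ linked ; minD = subst (λ Z → MinPiece k Z D) Y≡ minD
      ; D⊆W = D⊆W ; path = path ; unique = unique ; inW = inW
      ; ∣arm∣ = suc-injective (trans (sym (+-identityʳ (suc (length arm)))) eq) ; hole = inj₁ refl ; next = next }
      where
      open Start start
      Y≡ : set (p ∷ c ∷ arm) ≡ set (p ∷ p ∷ c ∷ arm)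
      Y≡ = ⊆-antisym ∈▷ˡ λ v∈ → [ id , (λ { refl → ∈▷ʳ p }) ]′ (∈▷⁻ v∈)
    build (suc r) p L D eq start = build r p (L ∷ʳ x) (proj₁ next′)
      (trans (cong (_+ r) (trans (List.length-++ L) (+-comm (length L) 1)))
             (trans (sym (+-suc (length L) r)) eq)) record
      { linked = subst (k -LinkedOff_) Y▷x≡ (proj₂ (proj₂ (proj₂ (proj₂ (proj₂ next′)))))
      ; minD   = subst (λ Z → MinPiece k Z (proj₁ next′)) Y▷x≡ (proj₁ (proj₂ (proj₂ (proj₂ (proj₂ next′)))))
      ; D⊆W    = D⊆W ∘ proj₁ (proj₂ next′)
      ; path   = linked-∷ʳ p L path (~-sym x~l)
      ; unique = unique-∷ʳ (p ∷ L) unique (x∉Y ∘ ∈set⁺ (p ∷ L))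
      ; inW    = All.++⁺ inW (D⊆W x∈D ∷ [])
      ; next   = subst (proj₁ next′ ≈_) (sym (last-∷ʳ p L x)) (proj₁ (proj₂ (proj₂ (proj₂ next′))))
      }
      where
      open Start start
      Y = set (p ∷ L)
      x = proj₁ next
      x∈D = proj₁ (proj₂ next)
      x~l = proj₂ (proj₂ next)
      x∉Y : x ∉ Y
      x∉Y = proj₂ (∈─⁻ (proj₁ (proj₁ minD) x∈D))
      next′ : Advance Y D x
      next′ = advance Y D x linked minD x∈D λ {z} z∈U → set-deg (p ∷ L) (proj₁ (∈─⁻ z∈U)) (begin
        cnt z (p ∷ L)            ≤⟨ cnt-path z path ⟩
        ⌈ suc (length L) /2⌉     ≤⟨ ⌈n/2⌉-mono (≤-trans (m<m+n (length L) {suc r} z<s) (≤-reflexive eq)) ⟩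
        ⌈ 1 + a /2⌉              ≤⟨ ⌈/2⌉-subadditive 1 a ⟩
        1 + ⌈ a /2⌉              ≤⟨ +-monoˡ-≤ ⌈ a /2⌉ (≤-trans (n≤1+n 1) 2≤K) ⟩
        K + ⌈ a /2⌉              ≡⟨ +-comm K ⌈ a /2⌉ ⟩
        ⌈ a /2⌉ + K              ∎)
        where open ≤-Reasoning
      Y▷x≡ : Y ▷ x ≡ set (p ∷ L ∷ʳ x)
      Y▷x≡ = ⊆-antisym to from
        where
        to : Y ▷ x ⊆ set (p ∷ L ∷ʳ x)
        to v∈ with ∈▷⁻ v∈
        ... | inj₂ refl = ∈set⁺ (p ∷ L ∷ʳ x) (∈-++⁺ʳ (p ∷ L) (here refl))
        ... | inj₁ v∈Y  = ∈set⁺ (p ∷ L ∷ʳ x) (∈-++⁺ˡ (∈set⁻ (p ∷ L) v∈Y))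
        from : set (p ∷ L ∷ʳ x) ⊆ Y ▷ x
        from v∈ with ∈-++⁻ (p ∷ L) (∈set⁻ (p ∷ L ∷ʳ x) v∈)
        ... | inj₁ v∈L         = ∈▷ˡ (∈set⁺ (p ∷ L) v∈L)
        ... | inj₂ (here refl) = ∈▷ʳ x

    copy : k -LinkedOff ⊥ → Piece k ⊥ W → Copy W
    copy linked pieceW = build (suc a) x [] (proj₁ next′) refl record
      { linked = proj₂ (proj₂ (proj₂ (proj₂ (proj₂ next′))))
      ; minD   = proj₁ (proj₂ (proj₂ (proj₂ (proj₂ next′))))
      ; D⊆W    = D⊆W ∘ proj₁ (proj₂ next′)
      ; path   = [-] ; unique = [] ∷ [] ; inW = D⊆W x∈D ∷ []
      ; next   = proj₁ (proj₂ (proj₂ (proj₂ next′)))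
      }
      where
      least : ∃[ D ] D ⊆ W × MinPiece k ⊥ D
      least = minPiece k {⊥} {W} pieceW
      D = proj₁ least
      D⊆W : D ⊆ W
      D⊆W = proj₁ (proj₂ least)
      minD : MinPiece k ⊥ D
      minD = proj₂ (proj₂ least)
      D≢∅ : Nonempty D
      D≢∅ = 0<∣p∣⇒Nonempty D (≤-trans (s≤s z≤n) (proj₁ (proj₂ (proj₁ minD))))
      x   = proj₁ D≢∅
      x∈D = proj₂ D≢∅
      next′ : Advance ⊥ D x
      next′ = advance ⊥ D x linked minD x∈D λ z∈U → set-deg [] (proj₁ (∈─⁻ z∈U)) z≤n

-- The colour classes and the copies of the tree

Σ< : ℕ → (ℕ → ℕ) → ℕ
Σ< zero    f = 0
Σ< (suc l) f = f 0 + Σ< l (f ∘ suc)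

Σ<-+ : ∀ l l′ f → Σ< (l + l′) f ≡ Σ< l f + Σ< l′ (λ j → f (l + j))
Σ<-+ zero    l′ f = refl
Σ<-+ (suc l) l′ f = trans (cong (f 0 +_) (Σ<-+ l l′ (f ∘ suc))) (sym (+-assoc (f 0) _ _))

Σ<-pairs : ∀ l f → (∀ {j} → suc j < l → 1 ≤ f j + f (suc j)) → ⌊ l /2⌋ ≤ Σ< l f
Σ<-pairs zero          f pair = z≤n
Σ<-pairs (suc zero)    f pair = z≤n
Σ<-pairs (suc (suc l)) f pair = ≤-trans
  (+-mono-≤ (pair (s≤s (s≤s z≤n))) (Σ<-pairs l (λ j → f (suc (suc j))) (λ j< → pair (s≤s (s≤s j<)))))
  (≤-reflexive (+-assoc (f 0) (f 1) _))

Σ<-first : ∀ l f → (∀ {j} → suc j < l → 1 ≤ f j + f (suc j)) → (0 < l → 1 ≤ f 0) → ⌈ l /2⌉ ≤ Σ< l f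
Σ<-first zero    f pair first = z≤n
Σ<-first (suc l) f pair first = +-mono-≤ (first z<s) (Σ<-pairs l (f ∘ suc) (pair ∘ s≤s))

Σ<-last : ∀ l f → (∀ {j} → suc j < l → 1 ≤ f j + f (suc j)) → (∀ {j} → suc j ≡ l → 1 ≤ f j) → ⌈ l /2⌉ ≤ Σ< l f
Σ<-last zero    f pair last = z≤n
Σ<-last (suc l) f pair last = begin
  1 + ⌊ l /2⌋                       ≡⟨ +-comm 1 ⌊ l /2⌋ ⟩
  ⌊ l /2⌋ + 1                       ≤⟨ +-mono-≤ (Σ<-pairs l f (pair ∘ m<n⇒m<1+n)) (last {l} refl) ⟩
  Σ< l f + f l                      ≡⟨ cong (λ j → Σ< l f + f j) (+-identityʳ l) ⟨
  Σ< l f + f (l + 0)                ≡⟨ cong (Σ< l f +_) (+-identityʳ _) ⟨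
  Σ< l f + (f (l + 0) + 0)          ≡⟨ Σ<-+ l 1 f ⟨
  Σ< (l + 1) f                      ≡⟨ cong (λ l → Σ< l f) (+-comm l 1) ⟩
  Σ< (suc l) f                      ∎
  where open ≤-Reasoning

-- An indicator on natural numbers, so that the arms can be summed as intervals of positions.
bit : ∀ {m} → Subset m → ℕ → ℕ
bit []          _       = 0
bit (true  ∷ p) zero    = 1
bit (false ∷ p) zero    = 0
bit (_     ∷ p) (suc j) = bit p j

∣p∣≡Σbit : ∀ {m} (p : Subset m) → ∣ p ∣ ≡ Σ< m (bit p)
∣p∣≡Σbit []          = refl
∣p∣≡Σbit (true  ∷ p) = cong suc (∣p∣≡Σbit p)
∣p∣≡Σbit (false ∷ p) = ∣p∣≡Σbit p

bit-∈ : ∀ {m} {p : Subset m} {x} → x ∈ p → 1 ≤ bit p (toℕ x)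
bit-∈ {p = true ∷ p} {zero}  here       = ≤-refl
bit-∈ {p = true ∷ p}  {suc x} (there x∈) = bit-∈ x∈
bit-∈ {p = false ∷ p} {suc x} (there x∈) = bit-∈ x∈

module _ (i′ r : ℕ) where
  private
    i m : ℕ
    i = suc i′
    m = suc (i + r)

    P : Graph m
    P = P⁺ m i

    i<m : i < m
    i<m = s≤s (m≤m+n i r)

  -- The class without v_i contains `u` and the neighbours of v_i, and at least one of any two
  -- consecutive vertices of an arm; so it takes half of each arm, rounded up.
  colour-class : ∀ (Z Z′ : Subset m) → (∀ x → x ∈ Z ⊎ x ∈ Z′) →
                 (∀ {x y} → x ∈ Z′ → y ∈ Z′ → ¬ Adj P x y) →
                 fromℕ< i<m ∈ Z′ → suc (⌈ i′ /2⌉ + ⌈ r /2⌉) ≤ ∣ Z ∣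
  colour-class Z Z′ cover indep vᵢ∈Z′ = begin
    -- The summand dropped by `m≤n+m` is that of v_i, which lies between the arms.
    1 + (⌈ i′ /2⌉ + ⌈ r /2⌉)                                         ≤⟨ +-mono-≤ f0 (+-mono-≤ left (≤-trans right (m≤n+m _ (f (suc (i′ + 0)))))) ⟩
    f 0 + (Σ< i′ (f ∘ suc) + Σ< (suc r) (λ j → f (suc (i′ + j))))    ≡⟨ cong (f 0 +_) (Σ<-+ i′ (suc r) (f ∘ suc)) ⟨
    f 0 + Σ< (i′ + suc r) (f ∘ suc)                                  ≡⟨ cong (λ l → f 0 + Σ< l (f ∘ suc)) (+-suc i′ r) ⟩
    Σ< m f                                                           ≡⟨ ∣p∣≡Σbit Z ⟨
    ∣ Z ∣                                                            ∎
    where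
    open ≤-Reasoning
    f = bit Z

    at : ∀ {a} (a<m : a < m) → fromℕ< a<m ∈ Z → 1 ≤ f a
    at a<m a∈ = subst (λ a → 1 ≤ f a) (toℕ-fromℕ< a<m) (bit-∈ a∈)

    adj : ∀ {a b} (a<m : a < m) (b<m : b < m) → TreeEdge i a b → Adj P (fromℕ< a<m) (fromℕ< b<m)
    adj a<m b<m edge = graphOn⁺ (treeEdge? i) (treeEdge-irrefl i) (fromℕ< a<m) (fromℕ< b<m)
      (inj₁ (subst₂ (TreeEdge i) (sym (toℕ-fromℕ< a<m)) (sym (toℕ-fromℕ< b<m)) edge))

    at-neighbour : ∀ {a} (a<m : a < m) → TreeEdge i a i ⊎ TreeEdge i i a → 1 ≤ f a
    at-neighbour a<m edge = [ at a<m , (λ a∈Z′ → contradiction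
      ([ adj a<m i<m , N-sym P (fromℕ< i<m) (fromℕ< a<m) ∘ adj i<m a<m ]′ edge) (indep a∈Z′ vᵢ∈Z′)) ]′ (cover (fromℕ< a<m))

    at-pair : ∀ {a} → 1 ≤ a → suc a < m → 1 ≤ f a + f (suc a)
    at-pair {a} 1≤a 1+a<m = one-of (cover (fromℕ< a<m)) (cover (fromℕ< 1+a<m))
      where
      a<m : a < m
      a<m = <-trans (n<1+n a) 1+a<m
      one-of : fromℕ< a<m ∈ Z ⊎ fromℕ< a<m ∈ Z′ → fromℕ< 1+a<m ∈ Z ⊎ fromℕ< 1+a<m ∈ Z′ → 1 ≤ f a + f (suc a)
      one-of (inj₁ a∈Z)  _           = ≤-trans (at a<m a∈Z) (m≤m+n (f a) _)
      one-of _           (inj₁ b∈Z)  = ≤-trans (at 1+a<m b∈Z) (m≤n+m _ (f a))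
      one-of (inj₂ a∈Z′) (inj₂ b∈Z′) = contradiction (adj a<m 1+a<m (inj₁ (1≤a , refl))) (indep a∈Z′ b∈Z′)

    f0 : 1 ≤ f 0
    f0 = at-neighbour z<s (inj₁ (inj₂ (refl , refl)))

    left : ⌈ i′ /2⌉ ≤ Σ< i′ (f ∘ suc)
    left = Σ<-last i′ (f ∘ suc)
      (λ {j} 1+j<i′ → at-pair (s≤s z≤n) (<-trans (s≤s 1+j<i′) i<m))
      (λ { refl → at-neighbour (<-trans (n<1+n _) i<m) (inj₁ (inj₁ (s≤s z≤n , refl))) })

    right : ⌈ r /2⌉ ≤ Σ< r (λ j → f (suc (i′ + suc j)))
    right = Σ<-first r (λ j → f (suc (i′ + suc j)))
      (λ {j} 1+j<r → subst (λ a → 1 ≤ f (suc (i′ + suc j)) + f a) (cong suc (sym (+-suc i′ (suc j))))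
        (at-pair (s≤s z≤n) (s≤s (subst (_≤ suc (i′ + r)) (cong suc (+-suc i′ (suc j))) (s≤s (+-monoʳ-≤ i′ 1+j<r))))))
      (λ 0<r → at-neighbour (s≤s (s≤s (+-monoʳ-≤ i′ 0<r))) (inj₂ (inj₁ (s≤s z≤n , cong suc (+-comm i′ 1)))))

  colour-bound : ∀ {X Y} → IsBipartition P X Y → suc (⌈ i′ /2⌉ + ⌈ r /2⌉) ≤ ∣ X ∣ ⊔ ∣ Y ∣
  colour-bound {X} {Y} bip = [ (λ vᵢ∈X → ≤-trans (colour-class Y X (swap ∘ cover) X-independent vᵢ∈X) (m≤n⊔m ∣ X ∣ ∣ Y ∣))
                             , (λ vᵢ∈Y → ≤-trans (colour-class X Y cover Y-independent vᵢ∈Y) (m≤m⊔n ∣ X ∣ ∣ Y ∣)) ]′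
                             (cover (fromℕ< i<m))
    where
    open IsBipartition bip
    cover : ∀ x → x ∈ X ⊎ x ∈ Y
    cover x = x∈p∪q⁻ X Y (subst (x ∈_) (sym covers) ∈⊤)

-- Placing the tree in the graph

module Image {m n} (P : Graph m) (V≡⊤ : ∀ x → x ∈ V P) (φ : Fin m → Fin n)
  (φ-injective : ∀ {x y} → φ x ≡ φ y → x ≡ y) where

  vertex? : Decidable (λ v → ∃[ x ] φ x ≡ v)
  vertex? v = any? λ x → φ x ≟ᶠ v

  edge? : ∀ v → Decidable (λ w → ∃[ x ] ∃[ y ] φ x ≡ v × φ y ≡ w × Adj P x y)
  edge? v w = any? λ x → any? λ y → (φ x ≟ᶠ v) ×-dec ((φ y ≟ᶠ w) ×-dec (y ∈? N P x))

  image : Graph n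
  image = record
    { V        = ⟦ vertex? ⟧
    ; N        = λ v → ⟦ edge? v ⟧
    ; N⊆V      = λ v w∈ → let (_ , y , _ , φy≡w , _) = ∈⟦⟧⁻ (edge? v) w∈ in ∈⟦⟧⁺ vertex? (y , φy≡w)
    ; N-sym    = λ v w w∈ → let (x , y , φx≡v , φy≡w , x~y) = ∈⟦⟧⁻ (edge? v) w∈ in
                   ∈⟦⟧⁺ (edge? w) (y , x , φy≡w , φx≡v , N-sym P x y x~y)
    ; N-irrefl = λ v v∈ → let (x , y , φx≡v , φy≡v , x~y) = ∈⟦⟧⁻ (edge? v) v∈ in
                   N-irrefl P x (subst (Adj P x) (φ-injective (trans φy≡v (sym φx≡v))) x~y)
    }

  preimage : Vertex image → Fin m
  preimage (_ , v∈) = proj₁ (∈⟦⟧⁻ vertex? v∈)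

  φ-preimage : ∀ v → φ (preimage v) ≡ proj₁ v
  φ-preimage (_ , v∈) = proj₂ (∈⟦⟧⁻ vertex? v∈)

  image≅ : image ≅ P
  image≅ = record
    { bijection = mk↔ₛ′ (λ v → preimage v , V≡⊤ _) (λ (x , _) → φ x , ∈⟦⟧⁺ vertex? (x , refl))
        (λ (x , x∈) → vertex≡ {p = V P} {w = x , x∈} (φ-injective (φ-preimage (φ x , ∈⟦⟧⁺ vertex? (x , refl)))))
        (λ v → vertex≡ {w = v} (φ-preimage v))
    ; adjacency = λ v w → mk⇔
        (λ v~w → let (x , y , φx≡v , φy≡w , x~y) = ∈⟦⟧⁻ (edge? (proj₁ v)) v~w in
          subst₂ (Adj P) (φ-injective (trans φx≡v (sym (φ-preimage v)))) (φ-injective (trans φy≡w (sym (φ-preimage w)))) x~y)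
        (λ x~y → ∈⟦⟧⁺ (edge? (proj₁ v)) (preimage v , preimage w , φ-preimage v , φ-preimage w , x~y))
    }

at : ∀ {A : Set} → A → List A → ℕ → A
at d []      _       = d
at d (x ∷ L) zero    = x
at d (x ∷ L) (suc j) = at d L j

module _ {A : Set} {d : A} where
  at-∈ : ∀ {L j} → j < length L → at d L j ∈ᴸ L
  at-∈ {x ∷ L} {zero}  _        = here refl
  at-∈ {x ∷ L} {suc j} (s≤s j<) = there (at-∈ j<)

  ∈-at : ∀ {L x} → x ∈ᴸ L → ∃[ j ] j < length L × at d L j ≡ x
  ∈-at (here refl) = 0 , z<s , refl
  ∈-at (there x∈)  = let (j , j< , eq) = ∈-at x∈ in suc j , s≤s j< , eq

  at-injective : ∀ {L i j} → Unique L → i < length L → j < length L → at d L i ≡ at d L j → i ≡ j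
  at-injective {x ∷ L} {zero}  {zero}  _        _        _        _  = refl
  at-injective {x ∷ L} {zero}  {suc j} (x≢ ∷ _) _        (s≤s j<) eq = contradiction eq (All.lookup x≢ (at-∈ j<))
  at-injective {x ∷ L} {suc i} {zero}  (x≢ ∷ _) (s≤s i<) _        eq = contradiction (sym eq) (All.lookup x≢ (at-∈ i<))
  at-injective {x ∷ L} {suc i} {suc j} (_ ∷ u)  (s≤s i<) (s≤s j<) eq = cong suc (at-injective u i< j< eq)

  at-linked : ∀ {R : A → A → Set} {L j} → Linked R L → suc j < length L → R (at d L j) (at d L (suc j))
  at-linked {L = x ∷ y ∷ L} {zero}  (r ∷ l) _        = r
  at-linked {L = x ∷ y ∷ L} {suc j} (r ∷ l) (s≤s j<) = at-linked l j<
  at-linked {L = x ∷ []}    {_}     _       (s≤s ())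

  at-++ : ∀ L {c M} → at d (L ++ c ∷ M) (length L) ≡ c
  at-++ []      = refl
  at-++ (x ∷ L) = at-++ L

linked-reverse : ∀ {A : Set} {R : A → A → Set} → (∀ {x y} → R x y → R y x) →
                 ∀ {L} → Linked R L → Linked R (reverse L)
linked-reverse         symR []  = []
linked-reverse         symR [-] = [-]
linked-reverse {R = R} symR {x ∷ y ∷ L} (r ∷ l) = subst (Linked R) (sym (List.unfold-reverse x (y ∷ L)))
  (subst (λ M → Linked R (M ∷ʳ x)) (sym (List.unfold-reverse y L))
    (snoc (reverse L) (subst (Linked R) (List.unfold-reverse y L) (linked-reverse symR l)) (symR r)))
  where
  snoc : ∀ M {y z} → Linked R (M ∷ʳ y) → R y z → Linked R (M ∷ʳ y ∷ʳ z)
  snoc []          [-]     r = r ∷ [-]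
  snoc (_ ∷ [])    (s ∷ l) r = s ∷ snoc [] l r
  snoc (_ ∷ x ∷ M) (s ∷ l) r = s ∷ snoc (x ∷ M) l r

-- `W` is the whole vertex set for the first claim and the vertex set of the end for the second.
Found : ∀ {m n} → Graph m → Graph n → Subset n → ℕ → Set
Found P G W k = ∃[ T ] V T ⊆ W × T ≤ᴳ G × T ≅ P × k -Connected (G ∖ V T)

-- The list `u ∷ l₁ ++ c ∷ l₂` is numbered like the vertices of `P⁺`: `u` has position 0, v_j
-- position j, and `c` is v_i with i = suc i′.
module Realise {n} (G : Graph n) (i′ r : ℕ) (u c : Fin n) (l₁ l₂ : List (Fin n))
  (path : Linked (Adj G) (l₁ ++ c ∷ l₂)) (unique : Unique (l₁ ++ c ∷ l₂)) (u∉ : u ∉ᴸ (l₁ ++ c ∷ l₂))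
  (u~c : Adj G u c) (∣l₁∣ : length l₁ ≡ i′) (∣l₂∣ : length l₂ ≡ r) where

  private
    m : ℕ
    m = suc (suc i′ + r)

    L : List (Fin n)
    L = l₁ ++ c ∷ l₂

    P : Graph m
    P = P⁺ m (suc i′)

    ∣L∣ : length L ≡ suc (i′ + r)
    ∣L∣ = trans (List.length-++ l₁) (trans (cong₂ (λ a b → a + suc b) ∣l₁∣ ∣l₂∣) (+-suc i′ r))

    index< : ∀ (x : Fin m) → toℕ x < length (u ∷ L)
    index< x = subst (toℕ x <_) (cong suc (sym ∣L∣)) (toℕ<n x)

    φ : Fin m → Fin n
    φ x = at u (u ∷ L) (toℕ x)

    φ-injective : ∀ {x y} → φ x ≡ φ y → x ≡ y
    φ-injective {x} {y} eq = toℕ-injective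
      (at-injective {d = u} {L = u ∷ L} (∉⇒All≢ L u∉ ∷ unique) (index< x) (index< y) eq)

    tree-edge : ∀ a b → b < m → TreeEdge (suc i′) a b → Adj G (at u (u ∷ L) a) (at u (u ∷ L) b)
    tree-edge (suc a) _ b<m (inj₁ (_ , refl)) =
      at-linked {d = u} path (s≤s⁻¹ (subst (suc (suc a) <_) (cong suc (sym ∣L∣)) b<m))
    tree-edge _ _ _ (inj₂ (refl , refl)) =
      subst (Adj G u) (sym (trans (cong (at u L) (sym ∣l₁∣)) (at-++ l₁))) u~c

    φ-edge : ∀ x y → Adj P x y → Adj G (φ x) (φ y)
    φ-edge x y x~y = [ tree-edge (toℕ x) (toℕ y) (toℕ<n y)
                         , N-sym G (φ y) (φ x) ∘ tree-edge (toℕ y) (toℕ x) (toℕ<n x) ]′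
      (graphOn⁻ (treeEdge? (suc i′)) (treeEdge-irrefl (suc i′)) x y x~y)

  open Image P (λ _ → ∈⊤) φ φ-injective public

  image-edge : ∀ {v w} → Adj image v w → Adj G v w
  image-edge {v} v~w with ∈⟦⟧⁻ (edge? v) v~w
  ... | x , y , refl , refl , x~y = φ-edge x y x~y

  image-vertex⁻ : ∀ {v} → v ∈ V image → v ∈ᴸ u ∷ L
  image-vertex⁻ v∈ with ∈⟦⟧⁻ vertex? v∈
  ... | x , refl = at-∈ {d = u} (index< x)

  image-vertex⁺ : ∀ {v} → v ∈ᴸ u ∷ L → v ∈ V image
  image-vertex⁺ {v} v∈ with ∈-at {d = u} v∈
  ... | j , j< , eq = ∈⟦⟧⁺ vertex? (fromℕ< j<m , trans (cong (at u (u ∷ L)) (toℕ-fromℕ< j<m)) eq)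
    where
    j<m : j < m
    j<m = subst (j <_) (cong suc ∣L∣) j<

  realise : ∀ {W k Z} → W ⊆ V G → All (_∈ W) (u ∷ L) → k -Connected (G ∖ Z) →
            (∀ {v} → v ∈ Z → v ∈ᴸ u ∷ L) → (∀ {v} → v ∈ᴸ u ∷ L → v ∈ Z) → Found P G W k
  realise {W} {k} {Z} W⊆V inW connected Z⊆ Z⊇ = image , V⊆W
    , (W⊆V ∘ V⊆W , λ v → image-edge) , image≅
    , subst (λ Y → k -Connected (G ∖ Y)) (⊆-antisym (image-vertex⁺ ∘ Z⊆) (Z⊇ ∘ image-vertex⁻)) connected
    where
    V⊆W : V image ⊆ W
    V⊆W v∈ = All.lookup inW (image-vertex⁻ v∈)

module _ {n} (G : Graph n) (triangleFree : TriangleFree G) (k : ℕ) (1≤k : 1 ≤ k)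
  (a b₁ K : ℕ) (2≤K : 2 ≤ K) (b₁≤K : suc ⌈ b₁ /2⌉ ≤ K)
  (minDegree : ∀ {z} → z ∈ V G → suc k + (⌈ a /2⌉ + K) ≤ ∣ N G z ∣)
  (W : Subset n) (W⊆V : W ⊆ V G) where

  open Search G triangleFree k 1≤k a b₁ K 2≤K b₁≤K minDegree

  module _ (cp : Copy W) where
    open Copy cp

    private
      Z : Subset n
      Z = set (p ∷ c ∷ arm) ▷* ys

      Z⊆ : ∀ {v} → v ∈ Z → v ∈ᴸ (p ∷ ys ++ c ∷ arm)
      Z⊆ v∈ with ∈▷*⁻ ys v∈
      ... | inj₂ v∈ys = there (∈-++⁺ˡ v∈ys)
      ... | inj₁ v∈′ with ∈set⁻ (p ∷ c ∷ arm) v∈′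
      ...   | here eq  = here eq
      ...   | there v∈ = there (∈-++⁺ʳ ys v∈)

      Z⊇ : ∀ {v} → v ∈ᴸ (p ∷ ys ++ c ∷ arm) → v ∈ Z
      Z⊇ (here refl) = ∈▷*ˡ ys (∈set⁺ (p ∷ c ∷ arm) (here refl))
      Z⊇ (there v∈) with ∈-++⁻ ys v∈
      ... | inj₁ v∈ys = ∈▷*ʳ ys v∈ys
      ... | inj₂ v∈′  = ∈▷*ˡ ys (∈set⁺ (p ∷ c ∷ arm) (there v∈′))

      degree : ∀ {z} → z ∈ V G → k ≤ deg Z z
      degree {z} z∈V = k≤deg (p ∷ ys ++ c ∷ arm) z∈V (λ v∈ _ → Z⊆ v∈) (begin
        cnt z (p ∷ ys ++ c ∷ arm)        ≤⟨ Grow.cnt-spider W p p c arm ∣arm∣ p~c p∈W W⊆V z ys (linked-++ˡ ys path)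
                                              (subst (λ l → cnt z arm ≤ ⌈ l /2⌉) ∣arm∣ (cnt-path z (Linked.tail (linked-++ʳ ys path)))) ⟩
        suc ⌈ length ys /2⌉ + ⌈ a /2⌉    ≡⟨ cong (λ l → suc ⌈ l /2⌉ + ⌈ a /2⌉) ∣ys∣ ⟩
        suc ⌈ 1 + b₁ /2⌉ + ⌈ a /2⌉       ≤⟨ +-monoˡ-≤ ⌈ a /2⌉ (s≤s (≤-trans (⌈/2⌉-subadditive 1 b₁) b₁≤K)) ⟩
        suc K + ⌈ a /2⌉                  ≡⟨ cong suc (+-comm K ⌈ a /2⌉) ⟩
        suc (⌈ a /2⌉ + K)                ∎)
        where open ≤-Reasoning

      -- `p` keeps a neighbour `z` outside the tree; `z` and its at least k neighbours outside the
      -- tree make k + 1 vertices.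
      room : k < ∣ U Z ∣
      room with 0<∣p∣⇒Nonempty (N G p ─ Z) (≤-trans 1≤k (≤-trans (degree (W⊆V p∈W)) (≤-reflexive (deg≡ Z p))))
      ... | z , z∈ = ≤-trans (s≤s (≤-trans (degree z∈V) (≤-reflexive (deg≡ Z z))))
        (p⊂q⇒∣p∣<∣q∣ {p = N G z ─ Z} {U Z} (N⊆U , z , x∈p∧x∉q⇒x∈p─q z∈V (proj₂ (∈─⁻ z∈)) , z∉N))
        where
        z∈V : z ∈ V G
        z∈V = ~-∈V (proj₁ (∈─⁻ z∈))
        N⊆U : N G z ─ Z ⊆ U Z
        N⊆U v∈ = let (z~v , v∉) = ∈─⁻ v∈ in x∈p∧x∉q⇒x∈p─q (~-∈V z~v) v∉
        z∉N : z ∉ N G z ─ Z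
        z∉N z∈N = N-irrefl G z (proj₁ (∈─⁻ z∈N))

      connected : k -Connected (G ∖ Z)
      connected = linked⇒connected linked room

    found-forward : Found (P⁺ (suc (suc (suc b₁) + a)) (suc (suc b₁))) G W k
    found-forward = Realise.realise G (suc b₁) a p c ys arm path unique p∉ p~c ∣ys∣ ∣arm∣
      W⊆V (p∈W ∷ inW) connected Z⊆ Z⊇

    -- The same copy with the path read in the opposite direction, for the case that the arm grown
    -- last lies behind v_i.
    found-backward : Found (P⁺ (suc (suc a + suc b₁)) (suc a)) G W k
    found-backward = Realise.realise G a (suc b₁) p c (reverse arm) (reverse ys)
      (subst (Linked _~_) reversed (linked-reverse ~-sym path))
      (subst Unique reversed (PermutationSetoid.Unique-resp-↭ (setoid (Fin n)) (↭⇒↭ₛ (↭-sym (↭-reverse P))) unique))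
      (p∉ ∘ flip⁻) p~c
      (trans (List.length-reverse arm) ∣arm∣) (trans (List.length-reverse ys) ∣ys∣)
      W⊆V (p∈W ∷ All.tabulate (All.lookup inW ∘ flip⁻)) connected
      (λ v∈ → cons flip⁺ (Z⊆ v∈)) (Z⊇ ∘ cons flip⁻)
      where
      P = ys ++ c ∷ arm
      R = reverse arm ++ c ∷ reverse ys
      reversed : reverse P ≡ R
      reversed = trans (List.reverse-++ ys (c ∷ arm)) (trans (cong (_++ reverse ys) (List.unfold-reverse c arm))
        (List.++-assoc (reverse arm) (c ∷ []) (reverse ys)))
      flip⁺ : ∀ {v} → v ∈ᴸ P → v ∈ᴸ R
      flip⁺ v∈ = subst (_ ∈ᴸ_) reversed (∈-resp-↭ (↭-sym (↭-reverse P)) v∈)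
      flip⁻ : ∀ {v} → v ∈ᴸ R → v ∈ᴸ P
      flip⁻ v∈ = ∈-resp-↭ (↭-reverse P) (subst (_ ∈ᴸ_) (sym reversed) v∈)
      cons : ∀ {A B : List (Fin n)} {x} → (∀ {v} → v ∈ᴸ A → v ∈ᴸ B) → ∀ {v} → v ∈ᴸ x ∷ A → v ∈ᴸ x ∷ B
      cons f (here eq)  = here eq
      cons f (there v∈) = there (f v∈)

  tree : k -LinkedOff ⊥ → Piece k ⊥ W → Copy W
  tree = copy W W⊆V

-- The arm that is grown last is the odd one if the tree is good; if it is bad,
-- the extra unit in the minimum degree makes every nonempty arm suitable.
module _ {n} (G : Graph n) (triangleFree : TriangleFree G) (k : ℕ) (1≤k : 1 ≤ k) (W : Subset n) (W⊆V : W ⊆ V G)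
  (linked : Cut._-LinkedOff_ G k ⊥) (piece : Cut.Piece G k ⊥ W) where

  -- The two demands on K = ⌈ suc b₁ /2⌉ + β. An odd order makes ⌈ suc b₁ /2⌉ one more than ⌈ b₁
  -- /2⌉, and order at least three makes it at least 2; otherwise β adds the unit.
  odd-arm : ∀ b₁ β → OddAtLeast3 (suc b₁) ⊎ 1 ≤ β →
            2 ≤ ⌈ suc b₁ /2⌉ + β × suc ⌈ b₁ /2⌉ ≤ ⌈ suc b₁ /2⌉ + β
  odd-arm b₁ β (inj₂ 1≤β) = +-mono-≤ {1} (s≤s z≤n) 1≤β
    , ≤-trans (≤-reflexive (+-comm 1 ⌈ b₁ /2⌉)) (+-mono-≤ (⌈n/2⌉-mono (n≤1+n b₁)) 1≤β)
  odd-arm b₁ β (inj₁ (odd , 3≤b)) = ≤-trans (⌈n/2⌉-mono 3≤b) (m≤m+n _ β)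
    , ≤-trans (≤-reflexive (sym (step b₁ odd))) (m≤m+n _ β)
    where
    step : ∀ b₁ → suc b₁ % 2 ≡ 1 → ⌈ suc b₁ /2⌉ ≡ suc ⌈ b₁ /2⌉
    step zero           _   = refl
    step (suc (suc b₁)) odd = cong suc (step b₁ odd)

  tree-found : ∀ i′ r β (M : ℕ) → 2 ≤ i′ + r → suc (⌈ i′ /2⌉ + ⌈ r /2⌉) ≤ M →
               OddAtLeast3 i′ ⊎ OddAtLeast3 r ⊎ 1 ≤ β →
               (∀ {z} → z ∈ V G → k + M + β ≤ ∣ N G z ∣) → Found (P⁺ (suc (suc i′ + r)) (suc i′)) G W k
  tree-found i′ r β M 2≤ w≤M odd-or-bad minDegree = choose i′ r odd-or-bad 2≤ w≤M
    where
    open ≤-Reasoning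
    degrees : ∀ a b → suc (⌈ a /2⌉ + ⌈ b /2⌉) ≤ M → ∀ {z} → z ∈ V G → suc k + (⌈ a /2⌉ + (⌈ b /2⌉ + β)) ≤ ∣ N G z ∣
    degrees a b w≤M {z} z∈V = begin
      suc k + (⌈ a /2⌉ + (⌈ b /2⌉ + β))    ≡⟨ cong (suc k +_) (+-assoc ⌈ a /2⌉ ⌈ b /2⌉ β) ⟨
      suc k + (⌈ a /2⌉ + ⌈ b /2⌉ + β)      ≡⟨ +-suc k _ ⟨
      k + (suc (⌈ a /2⌉ + ⌈ b /2⌉) + β)    ≤⟨ +-monoʳ-≤ k (+-monoˡ-≤ β w≤M) ⟩
      k + (M + β)                          ≡⟨ +-assoc k M β ⟨
      k + M + β                            ≤⟨ minDegree z∈V ⟩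
      ∣ N G z ∣                            ∎

    forward : ∀ b₁ r → suc (⌈ suc b₁ /2⌉ + ⌈ r /2⌉) ≤ M → OddAtLeast3 (suc b₁) ⊎ 1 ≤ β →
              Found (P⁺ (suc (suc (suc b₁) + r)) (suc (suc b₁))) G W k
    forward b₁ r w≤M odd-or-bad = found-forward G triangleFree k 1≤k r b₁ K (proj₁ bounds) (proj₂ bounds) deg W W⊆V
      (tree G triangleFree k 1≤k r b₁ K (proj₁ bounds) (proj₂ bounds) deg W W⊆V linked piece)
      where
      K = ⌈ suc b₁ /2⌉ + β
      bounds = odd-arm b₁ β odd-or-bad
      deg : ∀ {z} → z ∈ V G → suc k + (⌈ r /2⌉ + K) ≤ ∣ N G z ∣
      deg = degrees r (suc b₁) (≤-trans (≤-reflexive (cong suc (+-comm ⌈ r /2⌉ _))) w≤M)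

    backward : ∀ i′ b₁ → suc (⌈ i′ /2⌉ + ⌈ suc b₁ /2⌉) ≤ M → OddAtLeast3 (suc b₁) ⊎ 1 ≤ β →
               Found (P⁺ (suc (suc i′ + suc b₁)) (suc i′)) G W k
    backward i′ b₁ w≤M odd-or-bad = found-backward G triangleFree k 1≤k i′ b₁ K (proj₁ bounds) (proj₂ bounds) deg W W⊆V
      (tree G triangleFree k 1≤k i′ b₁ K (proj₁ bounds) (proj₂ bounds) deg W W⊆V linked piece)
      where
      K = ⌈ suc b₁ /2⌉ + β
      bounds = odd-arm b₁ β odd-or-bad
      deg : ∀ {z} → z ∈ V G → suc k + (⌈ i′ /2⌉ + K) ≤ ∣ N G z ∣
      deg = degrees i′ (suc b₁) w≤M

    choose : ∀ i′ r → OddAtLeast3 i′ ⊎ OddAtLeast3 r ⊎ 1 ≤ β → 2 ≤ i′ + r → suc (⌈ i′ /2⌉ + ⌈ r /2⌉) ≤ M →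
             Found (P⁺ (suc (suc i′ + r)) (suc i′)) G W k
    choose (suc b₁) r        (inj₁ odd)        _ w≤M = forward b₁ r w≤M (inj₁ odd)
    choose i′       (suc b₁) (inj₂ (inj₁ odd)) _ w≤M = backward i′ b₁ w≤M (inj₁ odd)
    choose i′       (suc b₁) (inj₂ (inj₂ bad)) _ w≤M = backward i′ b₁ w≤M (inj₂ bad)
    choose (suc b₁) zero     (inj₂ (inj₂ bad)) _ w≤M = forward b₁ zero w≤M (inj₂ bad)
    choose zero     zero     (inj₂ (inj₂ bad)) () _
    choose zero     r        (inj₁ (() , _))
    choose i′       zero     (inj₂ (inj₁ (() , _)))

[]≡1 : ∀ {A : Set} (d : Dec A) → A → 1 ≤ [ d ]
[]≡1 (yes _) _ = ≤-refl
[]≡1 (no ¬a) a = contradiction a ¬a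

theorem1p5 : (k m i : ℕ) .{{_ : NonZero k}} .{{_ : NonZero m}} .{{_ : NonZero i}} →
    (4≤m : 4 ≤ m) (i≤m∸1 : i ≤ m ∸ 1) →
    (X Y : Subset m) → IsBipartition (P⁺ m i) X Y →
    (n : ℕ) (G : Graph n) → k -Connected G → TriangleFree G →
    (δ : ℕ) → IsMinDegree G δ → δ ≥ k + (∣ X ∣ ⊔ ∣ Y ∣) + [ bad? m i i≤m∸1 ] →
    (∃[ T ] T ≤ᴳ G × T ≅ P⁺ m i × k -Connected (G ∖ V T))
    × (IsConnectivity G k → (F : Graph n) → IsEnd G F →
    ∃[ T ] T ≤ᴳ F × T ≤ᴳ G × T ≅ P⁺ m i × k -Connected (G ∖ V T))
theorem1p5 k m zero = contradiction refl (≢-nonZero⁻¹ 0)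
theorem1p5 k m i@(suc i′) 4≤m i≤m∸1 X Y bip n G κ≥k triangleFree δ ((v , v∈V , _) , δ≤) bound =
  solve (m ∸ 1 ∸ i) m m≡ 4≤m i≤m∸1 X Y bip bound
  where
  m≡ : m ≡ suc (i + (m ∸ 1 ∸ i))
  m≡ = trans (sym (m+[n∸m]≡n (≤-trans (s≤s z≤n) 4≤m))) (cong suc (sym (m+[n∸m]≡n i≤m∸1)))

  -- Generalised over `r` and `m` so that the equation can be matched and the orders `i′` and `r` of
  -- the arms appear in the type of the tree.
  solve : ∀ r m → m ≡ suc (i + r) → 4 ≤ m → (i≤m∸1 : i ≤ m ∸ 1) → (X Y : Subset m) →
          IsBipartition (P⁺ m i) X Y → δ ≥ k + (∣ X ∣ ⊔ ∣ Y ∣) + [ bad? m i i≤m∸1 ] →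
          (∃[ T ] T ≤ᴳ G × T ≅ P⁺ m i × k -Connected (G ∖ V T))
          × (IsConnectivity G k → (F : Graph n) → IsEnd G F →
          ∃[ T ] T ≤ᴳ F × T ≤ᴳ G × T ≅ P⁺ m i × k -Connected (G ∖ V T))
  solve r m refl 4≤m i≤m∸1 X Y bip bound = in-graph , in-end
    where
    M = ∣ X ∣ ⊔ ∣ Y ∣
    β = [ bad? m i i≤m∸1 ]

    w≤M : suc (⌈ i′ /2⌉ + ⌈ r /2⌉) ≤ M
    w≤M = colour-bound i′ r bip

    minDegree : ∀ {z} → z ∈ V G → k + M + β ≤ ∣ N G z ∣
    minDegree z∈V = ≤-trans bound (δ≤ _ (_ , z∈V , refl))

    odd-or-bad : OddAtLeast3 i′ ⊎ OddAtLeast3 r ⊎ 1 ≤ β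
    odd-or-bad = from-dec (good? m i i≤m∸1)
      where
      from-dec : Dec (Good m i) → OddAtLeast3 i′ ⊎ OddAtLeast3 r ⊎ 1 ≤ β
      from-dec (no  bad)  = inj₂ (inj₂ ([]≡1 (bad? m i i≤m∸1) bad))
      from-dec (yes good) = [ inj₁ , inj₂ ∘ inj₁ ∘ subst OddAtLeast3 (m+n∸m≡n i r) ]′
        (Equivalence.to (good⇔ m i i≤m∸1) good)

    open Pieces G triangleFree k (λ z∈V → ≤-trans (m<m+n k (≤-trans (s≤s z≤n) w≤M)) (≤-trans (m≤m+n (k + M) β) (minDegree z∈V)))

    within : ∀ W → W ⊆ V G → Piece k ⊥ W → Found (P⁺ m i) G W k
    within W W⊆V piece = tree-found G triangleFree k (>-nonZero⁻¹ k) W W⊆V (connected⇒linked κ≥k) piece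
      i′ r β M (s≤s⁻¹ (s≤s⁻¹ 4≤m)) w≤M odd-or-bad minDegree

    in-graph : ∃[ T ] T ≤ᴳ G × T ≅ P⁺ m i × k -Connected (G ∖ V T)
    in-graph = let (T , _ , found) = within (V G) id (graph-piece (v , v∈V)) in T , found

    in-end : IsConnectivity G k → (F : Graph n) → IsEnd G F →
             ∃[ T ] T ≤ᴳ F × T ≤ᴳ G × T ≅ P⁺ m i × k -Connected (G ∖ V T)
    in-end κ≡k F ((S , fragment) , _) = T , (T⊆F , edges) , proj₂ (proj₂ found)
      where
      open IsFragmentTo fragment
      ∣S∣≤k : ∣ S ∣ ≤ k
      ∣S∣≤k = proj₂ (proj₂ minimumCut) k (proj₁ κ≡k)
      found : Found (P⁺ m i) G (V F) k
      found = within (V F) (λ x∈ → proj₁ (semifragment⊆V semifragment x∈))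
        (semifragment-piece {S} {F} semifragment ∣S∣≤k)
      T : Graph n
      T = proj₁ found
      T⊆F : V T ⊆ V F
      T⊆F = proj₁ (proj₂ found)
      edges : ∀ x → N T x ⊆ N F x
      edges x {y} x~y = semifragment-closed semifragment (T⊆F (N⊆V T y (N-sym T x y x~y)))
        (proj₂ (proj₁ (proj₂ (proj₂ found))) x x~y)
        (proj₂ (semifragment⊆V semifragment (T⊆F (N⊆V T x x~y))))
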